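{- Let $p$ be a prime, let $r\in\mathbb{Z}$, and let $m,n\in\mathbb{N}=\{0,1,2,\ldots\}$ with $m\neq n$ and $m\equiv n\pmod{p(p-1)}$. Then $$\frac{F_p(m,r)-F_p(n,r)}{m-n}\equiv\frac{(-1)^{n^*}}{n^*!}\sum_{1<k\le n^*}\binom{n^*}{k}\frac{B_k}{k}B^{(\{ -n\}_p)}_{n^*-k}(-r) \equiv(-1)^{n_*-1}n_*!\sum_{1<k\le n^*}\binom{n_*+k}{n_*}r^{n^*-k}\sum_{1<j\le k}\binom kj\frac{B_j}{j}B^{(\{ -n\}_p)}_{k-j}\pmod p.$$
   Context: For $n\in\mathbb{N}$ and $r\in\mathbb{Z}$ let $C_p(n,r)=\sum_{k\equiv r\,(\mathrm{mod}\ p)}\binom nk(-1)^k$ and define the Fleck quotient $F_p(n,r)=(-p)^{ -\lfloor (n-1)/(p-1)\rfloor}C_p(n,r)+[\![n=0]\!]$, where $[\![A]\!]$ is $1$ if $A$ holds and $0$ otherwise (this is an integer). For an integer $x$ and modulus $M>0$, $\{x\}_M$ denotes the least nonnegative residue of $x$ modulo $M$. $n_*$ denotes the smallest positive residue of $n$ modulo $p-1$ (so $n_*\in\{1,\ldots,p-1\}$), and $n^*=\{ -n\}_{p-1}$. For $m\in\mathbb{N}$ the $m$th order Bernoulli polynomials are defined by $\frac{x^me^{tx}}{(e^x-1)^m}=\sum_{k\ge0}B^{(m)}_k(t)\frac{x^k}{k!}$, with $B^{(m)}_k=B^{(m)}_k(0)$, $B_k(t)=B^{(1)}_k(t)$,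 $B_k=B_k(0)$. Congruences between rational numbers modulo $p$ mean that the difference divided by $p$ is a $p$-adic integer. -}

module Defs where

open import Data.Nat as ℕ using (ℕ; zero; suc; _∸_)
open import Data.Nat.Combinatorics using (_C_)
open import Data.Nat.Base using (_!)
open import Data.Nat.Divisibility using (_∣_)
open import Data.Integer as ℤ using (ℤ; +_; -[1+_]; +[1+_]; _/ℕ_; _%ℕ_)
open import Data.Rational as ℚ using (ℚ; mkℚ; 0ℚ; 1ℚ; ↧ₙ_; 1/_)
open import Data.List using (List; []; _∷_; _++_; zipWith; upTo)
open import Relation.Nullary using (¬_; does)
open import Data.Bool using (if_then_else_)

ℤ→ℚ : ℤ → ℚ
ℤ→ℚ z = z ℚ./ 1

ℕ→ℚ : ℕ → ℚ
ℕ→ℚ n = ℤ→ℚ (+ n)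

-- total inverse on ℚ (inv 0 = 0; only used on nonzero arguments)
inv : ℚ → ℚ
inv (mkℚ (+ zero) _ _) = 0ℚ
inv q@(mkℚ +[1+ n ] d c) = 1/ q
inv q@(mkℚ -[1+ n ] d c) = 1/ q

_^ℚ_ : ℚ → ℕ → ℚ
x ^ℚ zero = 1ℚ
x ^ℚ suc k = x ℚ.* (x ^ℚ k)

_^ℚℤ_ : ℚ → ℤ → ℚ
x ^ℚℤ (+ k) = x ^ℚ k
x ^ℚℤ -[1+ k ] = inv (x ^ℚ suc k)

-- {x}_M : least nonnegative residue of an integer x modulo M (M > 0;
-- the value for M = 0 is junk and never used)
lnr : ℤ → ℕ → ℕ
lnr x zero = 0
lnr x (suc M) = x %ℕ suc M

-- floor division of an integer by a positive natural (junk for 0)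
floorDiv : ℤ → ℕ → ℤ
floorDiv x zero = + 0
floorDiv x (suc M) = x /ℕ suc M

-- Σ_{lo ≤ k ≤ hi} f k  (empty if hi < lo)
sumCount : ℕ → ℕ → (ℕ → ℚ) → ℚ
sumCount lo zero f = 0ℚ
sumCount lo (suc c) f = f lo ℚ.+ sumCount (suc lo) c f

Σ[_≤k≤_] : ℕ → ℕ → (ℕ → ℚ) → ℚ
Σ[ lo ≤k≤ hi ] f = sumCount lo (suc hi ∸ lo) f

Cp : ℕ → ℕ → ℤ → ℚ
Cp p n r = Σ[ 0 ≤k≤ n ] λ k →
  if does (lnr (+ k) p ℕ.≟ lnr r p)
  then ℕ→ℚ (n C k) ℚ.* (ℚ.- 1ℚ) ^ℚ k
  else 0ℚ

iv0 : ℕ → ℚ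
iv0 zero = 1ℚ
iv0 (suc _) = 0ℚ

Fp : ℕ → ℕ → ℤ → ℚ
Fp p n r =
  ((ℚ.- ℕ→ℚ p) ^ℚℤ (ℤ.- floorDiv (+ n ℤ.- + 1) (p ∸ 1))) ℚ.* Cp p n r
  ℚ.+ iv0 n

-- n_* : smallest positive residue of n modulo p-1
nLow : ℕ → ℕ → ℕ
nLow p n = suc (lnr (+ n ℤ.- + 1) (p ∸ 1))

nUp : ℕ → ℕ → ℕ
nUp p n = lnr (ℤ.- + n) (p ∸ 1)

-- Bernoulli numbers B_k from x/(e^x-1) = Σ B_k x^k/k!, i.e.
-- B_0 = 1 and Σ_{j=0}^{k} binom(k+1,j) B_j = 0 for k ≥ 1.
sumL : List ℚ → ℚ
sumL [] = 0ℚ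
sumL (x ∷ xs) = x ℚ.+ sumL xs

nthOr : List ℚ → ℕ → ℚ
nthOr [] _ = 0ℚ
nthOr (x ∷ xs) zero = x
nthOr (x ∷ xs) (suc i) = nthOr xs i

bernList : ℕ → List ℚ
bernList zero = 1ℚ ∷ []
bernList (suc n) = bs ++ (nxt ∷ [])
  where
  bs = bernList n
  k = suc n
  nxt = ℚ.- (inv (ℕ→ℚ (suc k)) ℚ.*
          sumL (zipWith (λ j b → ℕ→ℚ (suc k C j) ℚ.* b) (upTo k) bs))

B : ℕ → ℚ
B k = nthOr (bernList k) k

-- m-th order Bernoulli polynomials B^{(m)}_k(t), from
-- x^m e^{tx}/(e^x-1)^m = (x/(e^x-1))^m e^{tx}:
-- B^{(0)}_k(t) = t^k,  B^{(m+1)}_k(t) = Σ_{j=0}^k binom(k,j) B_j B^{(m)}_{k-j}(t).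
BP : ℕ → ℕ → ℚ → ℚ
BP zero k t = t ^ℚ k
BP (suc m) k t = Σ[ 0 ≤k≤ k ] λ j → ℕ→ℚ (k C j) ℚ.* B j ℚ.* BP m (k ∸ j) t

Bo : ℕ → ℕ → ℚ
Bo m k = BP m k 0ℚ

-- congruence of rationals modulo p: (x - y)/p is a p-adic integer,
-- i.e. p does not divide the reduced denominator of (x - y)/p
_≡_[modℚ_] : ℚ → ℚ → ℕ → Set
x ≡ y [modℚ p ] = ¬ (p ∣ ↧ₙ ((x ℚ.- y) ℚ.* inv (ℕ→ℚ p)))

{-# OPTIONS --safe #-}
module Submission where

-- C_p(n, ·) is the n-th backward difference of the indicator δ of pℤ, and polynomials
-- in ∇ act on functions of r. On ∇ g with g p-periodic, (1 - ∇)^p = 1 gives, for odd p,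
-- ∇^(p-1) = - p u with u = Σ (C(p,k)/p) (-∇)^(k-1) over 0 < k < p; hence
-- F_p(n + p - 1, ·) = u F_p(n, ·). Moreover u^p acts as 1 + p Y for a p-integral
-- polynomial Y in ∇, so
--   F_p(n + s p (p - 1), ·) - F_p(n, ·) = ((1 + p Y)^s - 1) F_p(n, ·),
-- and dividing by s p (p - 1) leaves - Y F_p(n, ·) modulo p.
--
-- This is evaluated modulo p by Fermat's theorem δ(r) = 1 - r^(p-1): the function
-- r^(p-1) is the coefficient of x^(p-1)/(p-1)! in e^(-rx), on which ∇ acts as
-- multiplication by 1 - e^x. Up to x^(p-2), modulo p, u then becomes x/(e^x - 1) and
-- Y becomes - Σ_{k>1} (B_k/k) x^k/k!: with u = 1 + ∇ u₁, the logarithm of u misses this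
-- by a linear term, which (∇ u₁)^p = - p ∇ u u₁^p removes. The second congruence is a
-- comparison of coefficients by Wilson's theorem.

open import Defs

-- The relation for ∇^(p-1) is that of 1 - ζ for a p-th root of unity ζ = 1 - ∇. Periodicity gives
-- it only with one more factor ∇, which can be absorbed on differences of periodic functions. The
-- summand for n = 0 makes F_p(0, r) = 1 - p δ(r) such a difference, namely of the residue of r.
-- Division by p precedes reduction modulo p. So `Y` has to be an explicit p-integral polynomial,
-- and its part coming from (∇ u₁)^p cannot be read off from power series, where that power vanishes
-- below x^p. The logarithm of `u` is never formed: (u^p - 1)/p has the derivative u^(p-1) Du, and
-- u^(p-1) inverts u modulo p. Series are compared only below x^(p-1), where (e^x - 1)/x and its
-- inverse are p-integral. This is enough since n_* is positive: F_p(n, ·) carries a factor x^(n_*),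
-- which leaves the coefficients up to x^(n^*) with n^* = p - 1 - n_*. Oddness of p enters through
-- signs and through p dividing p^k/(k + 1) for k > 0. For p = 2 both sums are empty and F_p(n, ·)
-- has period 2 in n.

module FleckQuotients where

  open import Data.Nat as ℕ using (ℕ; zero; suc; _∸_; _!; s≤s; z≤n)
  import Data.Nat.Properties as ℕₚ
  import Data.Nat.Divisibility as ℕᵈ
  import Data.Nat.DivMod as ℕᵐ
  open import Data.Nat.Combinatorics
    using (_C_; nCn≡1; nC1≡n; k>n⇒nCk≡0; nCk≡nC[n∸k]; nCk+nC[k+1]≡[n+1]C[k+1]; nCk≡n!/k![n-k]!; k![n∸k]!∣n!)
  open import Data.Nat.Coprimality as Coprime using (coprime-divisor)
  open import Data.Nat.Primality
    using (Prime; euclidsLemma; prime⇒nonTrivial; prime⇒irreducible; ¬prime[0]; ¬prime[1])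
  open import Data.Integer as ℤ using (ℤ; -[1+_]; +[1+_]) renaming (+_ to pos)
  import Data.Integer.Properties as ℤₚ
  open import Data.Integer.DivMod using (n%ℕd<d; a≡a%ℕn+[a/ℕn]*n)
  open import Data.Integer.Divisibility using (_∣_)
  open import Data.Rational as ℚ using (ℚ; mkℚ; 0ℚ; 1ℚ; ↥_; ↧ₙ_; toℚᵘ)
  import Data.Rational.Properties as ℚₚ
  import Data.Rational.Literals as Literals
  import Data.Rational.Unnormalised as ℚᵘ
  import Data.Rational.Unnormalised.Properties as ℚᵘₚ
  open import Data.Bool using (true; false; if_then_else_)
  open import Data.Empty using (⊥-elim)
  open import Data.List using (_∷_; []; _++_; length; zipWith; upTo; applyUpTo)
  open import Data.List.Properties using (length-++)
  open import Data.Product using (_×_; _,_; proj₁; proj₂; ∃)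
  open import Data.Sum using (_⊎_; inj₁; inj₂; [_,_]′)
  open import Function using (_∘_; id)
  open import Level using (0ℓ)
  open import Relation.Nullary using (¬_; does; yes; no)
  open import Relation.Nullary.Decidable using (dec⇒maybe; dec-true; dec-false)
  open import Relation.Binary.Definitions using (Tri; tri<; tri≈; tri>)
  open import Relation.Binary.PropositionalEquality
  open import Algebra.Bundles using (CommutativeMonoid; CommutativeRing)
  open import Algebra.Structures using (IsCommutativeRing)
  import Algebra.Construct.Pointwise as Pointwise
  open import Algebra.Properties.AbelianGroup ℤₚ.+-0-abelianGroup using (∙-cancelʳ)
  open import Tactic.RingSolver using (solve; solve-∀)
  open import Tactic.RingSolver.Core.AlmostCommutativeRing using (AlmostCommutativeRing; fromCommutativeRing)
  open ≡-Reasoning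

  -- Rational numbers and residues

  infixl 6 _+_ _-_
  infixl 7 _*_
  infix 8 -_

  -- Opaque copies of the rational operations: the library ones unfold on
  -- variables, which defeats unification.
  opaque
    _+_ _*_ : ℚ → ℚ → ℚ
    _+_ = ℚ._+_
    _*_ = ℚ._*_

    -_ recip : ℚ → ℚ
    -_ = ℚ.-_
    recip = inv

    fromℤ : ℤ → ℚ
    fromℤ = ℤ→ℚ

  _-_ : ℚ → ℚ → ℚ
  x - y = x + (- y)

  fromℕ : ℕ → ℚ
  fromℕ n = fromℤ (pos n)

  opaque
    unfolding _+_

    ℚ-isCommutativeRing : IsCommutativeRing _≡_ _+_ _*_ -_ 0ℚ 1ℚ
    ℚ-isCommutativeRing = CommutativeRing.isCommutativeRing ℚₚ.+-*-commutativeRing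

  ℚ-commutativeRing : CommutativeRing 0ℓ 0ℓ
  ℚ-commutativeRing = record { isCommutativeRing = ℚ-isCommutativeRing }

  ℚ-ring : AlmostCommutativeRing 0ℓ 0ℓ
  ℚ-ring = fromCommutativeRing ℚ-commutativeRing (λ x → dec⇒maybe (0ℚ ℚₚ.≟ x))

  ℤ-ring : AlmostCommutativeRing 0ℓ 0ℓ
  ℤ-ring = fromCommutativeRing ℤₚ.+-*-commutativeRing (λ x → dec⇒maybe (pos 0 ℤ.≟ x))

  module Q where
    open CommutativeRing ℚ-commutativeRing public
      using (ring; +-abelianGroup; +-commutativeMonoid; +-assoc; +-comm; +-identityˡ; +-identityʳ; *-assoc; *-comm; *-identityˡ; *-identityʳ;
             distribˡ; distribʳ; zeroˡ; zeroʳ; -‿inverseʳ; commutativeSemiring; *-commutativeSemigroup)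
    open import Algebra.Properties.CommutativeSemiring.Exp commutativeSemiring public
    open import Algebra.Properties.AbelianGroup +-abelianGroup public using (inverseʳ-unique; ⁻¹-involutive; ε⁻¹≈ε)
    open import Algebra.Properties.Ring ring public using (-1*x≈-x)
    open import Algebra.Properties.CommutativeSemigroup (CommutativeMonoid.commutativeSemigroup +-commutativeMonoid) public
      using () renaming (interchange to +-interchange)
    open import Algebra.Properties.CommutativeSemigroup *-commutativeSemigroup public
      using () renaming (x∙yz≈y∙xz to x*yz≡y*xz)
  open Q using (_^_)

  opaque
    unfolding _+_

    ℤ→ℚ≡literal : ∀ z → ℤ→ℚ z ≡ Literals.fromℤ z
    ℤ→ℚ≡literal z = ℚₚ.↥p/↧p≡p (Literals.fromℤ z)

    fromℤ-+ : ∀ x y → fromℤ (x ℤ.+ y) ≡ fromℤ x + fromℤ y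
    fromℤ-+ x y = trans
      (cong₂ (λ a b → ℤ→ℚ (a ℤ.+ b)) (sym (ℤₚ.*-identityʳ x)) (sym (ℤₚ.*-identityʳ y)))
      (sym (cong₂ ℚ._+_ (ℤ→ℚ≡literal x) (ℤ→ℚ≡literal y)))

    fromℤ-* : ∀ x y → fromℤ (x ℤ.* y) ≡ fromℤ x * fromℤ y
    fromℤ-* x y = sym (cong₂ ℚ._*_ (ℤ→ℚ≡literal x) (ℤ→ℚ≡literal y))

    fromℤ-injective : ∀ {x y} → fromℤ x ≡ fromℤ y → x ≡ y
    fromℤ-injective {x} {y} eq = cong ↥_ (trans (sym (ℤ→ℚ≡literal x)) (trans eq (ℤ→ℚ≡literal y)))

    fromℤ-0 : fromℤ (pos 0) ≡ 0ℚ
    fromℤ-0 = refl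

    fromℤ-1 : fromℤ (pos 1) ≡ 1ℚ
    fromℤ-1 = refl

    recip-inverse : ∀ x → x ≢ 0ℚ → x * recip x ≡ 1ℚ
    recip-inverse (mkℚ (pos zero) zero _) x≢0 = ⊥-elim (x≢0 refl)
    recip-inverse (mkℚ (pos zero) (suc d) c) x≢0 = ⊥-elim (x≢0 (ℚₚ.≃⇒≡ (ℚ.*≡* refl)))
    recip-inverse q@(mkℚ +[1+ _ ] _ _) _ = ℚₚ.*-inverseʳ q
    recip-inverse q@(mkℚ -[1+ _ ] _ _) _ = ℚₚ.*-inverseʳ q

  opaque
    unfolding _+_

    -*- : ∀ x y → (- x) * (- y) ≡ x * y
    -*- = solve-∀ ℚ-ring

  -- Finite sums and binomial coefficients

  ∑ : ℕ → ℕ → (ℕ → ℚ) → ℚ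
  ∑ lo zero f = 0ℚ
  ∑ lo (suc n) f = f lo + ∑ (suc lo) n f

  opaque
    unfolding _+_

    sumCount≡∑ : ∀ lo n f → sumCount lo n f ≡ ∑ lo n f
    sumCount≡∑ lo zero f = refl
    sumCount≡∑ lo (suc n) f = cong (f lo +_) (sumCount≡∑ (suc lo) n f)

    ^ℚ≡^ : ∀ x n → x ^ℚ n ≡ x ^ n
    ^ℚ≡^ x zero = refl
    ^ℚ≡^ x (suc n) = cong (x *_) (^ℚ≡^ x n)

  1^n≡1 : ∀ n → 1ℚ ^ n ≡ 1ℚ
  1^n≡1 zero = refl
  1^n≡1 (suc n) = trans (Q.*-identityˡ _) (1^n≡1 n)

  fromℤ-neg : ∀ x → fromℤ (ℤ.- x) ≡ - fromℤ x
  fromℤ-neg x = Q.inverseʳ-unique _ _ (trans (sym (fromℤ-+ x (ℤ.- x))) (trans (cong fromℤ (ℤₚ.+-inverseʳ x)) fromℤ-0))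

  fromℤ-sub : ∀ x y → fromℤ (x ℤ.- y) ≡ fromℤ x - fromℤ y
  fromℤ-sub x y = trans (fromℤ-+ x (ℤ.- y)) (cong (fromℤ x +_) (fromℤ-neg y))

  fromℕ-+ : ∀ m n → fromℕ (m ℕ.+ n) ≡ fromℕ m + fromℕ n
  fromℕ-+ m n = fromℤ-+ (pos m) (pos n)

  fromℕ-* : ∀ m n → fromℕ (m ℕ.* n) ≡ fromℕ m * fromℕ n
  fromℕ-* m n = trans (cong fromℤ (ℤₚ.pos-* m n)) (fromℤ-* (pos m) (pos n))

  fromℕ-suc : ∀ n → fromℕ (suc n) ≡ 1ℚ + fromℕ n
  fromℕ-suc n = trans (fromℕ-+ 1 n) (cong (_+ fromℕ n) fromℤ-1)

  fromℕ-injective : ∀ {m n} → fromℕ m ≡ fromℕ n → m ≡ n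
  fromℕ-injective eq = ℤₚ.+-injective (fromℤ-injective eq)

  fromℕ≢0 : ∀ n → fromℕ (suc n) ≢ 0ℚ
  fromℕ≢0 n eq with () ← fromℕ-injective {suc n} {0} (trans eq (sym fromℤ-0))

  fromℕ1-* : ∀ x → fromℕ 1 * x ≡ x
  fromℕ1-* x = trans (cong (_* x) fromℤ-1) (Q.*-identityˡ x)

  *-recip : ∀ n → fromℕ (suc n) * recip (fromℕ (suc n)) ≡ 1ℚ
  *-recip n = recip-inverse _ (fromℕ≢0 n)

  recip-* : ∀ n → recip (fromℕ (suc n)) * fromℕ (suc n) ≡ 1ℚ
  recip-* n = trans (Q.*-comm _ _) (*-recip n)

  *-cancelˡ : ∀ a b x y → b * a ≡ 1ℚ → a * x ≡ a * y → x ≡ y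
  *-cancelˡ a b x y ba eq = begin
    x            ≡⟨ Q.*-identityˡ x ⟨
    1ℚ * x       ≡⟨ cong (_* x) ba ⟨
    b * a * x    ≡⟨ Q.*-assoc b a x ⟩
    b * (a * x)  ≡⟨ cong (b *_) eq ⟩
    b * (a * y)  ≡⟨ Q.*-assoc b a y ⟨
    b * a * y    ≡⟨ cong (_* y) ba ⟩
    1ℚ * y       ≡⟨ Q.*-identityˡ y ⟩
    y            ∎

  cancel-ℕ : ∀ n {x y} → fromℕ (suc n) * x ≡ fromℕ (suc n) * y → x ≡ y
  cancel-ℕ n = *-cancelˡ _ (recip (fromℕ (suc n))) _ _ (trans (Q.*-comm _ _) (*-recip n))

  recip-unique : ∀ x y → x * y ≡ 1ℚ → recip x ≡ y
  recip-unique x y eq = *-cancelˡ x y _ _ (trans (Q.*-comm y x) eq) (trans (recip-inverse x x≢0) (sym eq))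
    where
    x≢0 : x ≢ 0ℚ
    x≢0 refl with () ← trans (sym (Q.zeroˡ y)) eq

  ∑-cong : ∀ lo n {f g} → (∀ k → lo ℕ.≤ k → k ℕ.< lo ℕ.+ n → f k ≡ g k) → ∑ lo n f ≡ ∑ lo n g
  ∑-cong lo zero h = refl
  ∑-cong lo (suc n) h = cong₂ _+_
    (h lo ℕₚ.≤-refl (subst (lo ℕ.<_) (sym (ℕₚ.+-suc lo n)) (s≤s (ℕₚ.m≤m+n lo n))))
    (∑-cong (suc lo) n (λ k lo≤k k< → h k (ℕₚ.<⇒≤ lo≤k) (subst (k ℕ.<_) (sym (ℕₚ.+-suc lo n)) k<)))

  ∑-cong′ : ∀ lo n {f g} → f ≗ g → ∑ lo n f ≡ ∑ lo n g
  ∑-cong′ lo n h = ∑-cong lo n (λ k _ _ → h k)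

  ∑-shift : ∀ lo n f → ∑ (suc lo) n f ≡ ∑ lo n (f ∘ suc)
  ∑-shift lo zero f = refl
  ∑-shift lo (suc n) f = cong (f (suc lo) +_) (∑-shift (suc lo) n f)

  ∑-+ : ∀ lo n f g → ∑ lo n (λ k → f k + g k) ≡ ∑ lo n f + ∑ lo n g
  ∑-+ lo zero f g = sym (Q.+-identityˡ 0ℚ)
  ∑-+ lo (suc n) f g rewrite ∑-+ (suc lo) n f g =
    Q.+-interchange (f lo) (g lo) (∑ (suc lo) n f) (∑ (suc lo) n g)

  ∑-* : ∀ lo n c f → ∑ lo n (λ k → c * f k) ≡ c * ∑ lo n f
  ∑-* lo zero c f = sym (Q.zeroʳ c)
  ∑-* lo (suc n) c f rewrite ∑-* (suc lo) n c f = sym (Q.distribˡ c _ _)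

  ∑-last : ∀ lo n f → ∑ lo (suc n) f ≡ ∑ lo n f + f (lo ℕ.+ n)
  ∑-last lo zero f rewrite ℕₚ.+-identityʳ lo = Q.+-comm (f lo) 0ℚ
  ∑-last lo (suc n) f = begin
    f lo + ∑ (suc lo) (suc n) f              ≡⟨ cong (f lo +_) (∑-last (suc lo) n f) ⟩
    f lo + (∑ (suc lo) n f + f (suc lo ℕ.+ n)) ≡⟨ Q.+-assoc (f lo) _ _ ⟨
    ∑ lo (suc n) f + f (suc lo ℕ.+ n)        ≡⟨ cong (λ j → ∑ lo (suc n) f + f j) (ℕₚ.+-suc lo n) ⟨
    ∑ lo (suc n) f + f (lo ℕ.+ suc n)        ∎

  choose-pascal : ∀ n k → suc n C suc k ≡ n C k ℕ.+ n C suc k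
  choose-pascal n k = sym (nCk+nC[k+1]≡[n+1]C[k+1] n k)

  choose-absorb : ∀ n k → suc k ℕ.* (suc n C suc k) ≡ suc n ℕ.* (n C k)
  choose-absorb zero zero = refl
  choose-absorb zero (suc k) = trans
    (cong (suc (suc k) ℕ.*_) (k>n⇒nCk≡0 {1} {suc (suc k)} (s≤s (s≤s z≤n))))
    (ℕₚ.*-zeroʳ (suc (suc k)))
  choose-absorb (suc n) zero = begin
    1 ℕ.* (suc (suc n) C 1)   ≡⟨ cong (1 ℕ.*_) (nC1≡n (suc (suc n))) ⟩
    1 ℕ.* suc (suc n)         ≡⟨ ℕₚ.*-comm 1 (suc (suc n)) ⟩
    suc (suc n) ℕ.* 1         ∎
  choose-absorb (suc n) (suc k) = begin
    suc (suc k) ℕ.* (suc (suc n) C suc (suc k))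
      ≡⟨ cong (suc (suc k) ℕ.*_) (choose-pascal (suc n) (suc k)) ⟩
    suc (suc k) ℕ.* (a ℕ.+ suc n C suc (suc k))
      ≡⟨ ℕₚ.*-distribˡ-+ (suc (suc k)) a _ ⟩
    (a ℕ.+ suc k ℕ.* a) ℕ.+ suc (suc k) ℕ.* (suc n C suc (suc k))
      ≡⟨ cong₂ (λ x y → (a ℕ.+ x) ℕ.+ y) (choose-absorb n k) (choose-absorb n (suc k)) ⟩
    (a ℕ.+ suc n ℕ.* (n C k)) ℕ.+ suc n ℕ.* (n C suc k)
      ≡⟨ ℕₚ.+-assoc a _ _ ⟩
    a ℕ.+ (suc n ℕ.* (n C k) ℕ.+ suc n ℕ.* (n C suc k))
      ≡⟨ cong (a ℕ.+_) (ℕₚ.*-distribˡ-+ (suc n) (n C k) (n C suc k)) ⟨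
    a ℕ.+ suc n ℕ.* (n C k ℕ.+ n C suc k)
      ≡⟨ cong (λ x → a ℕ.+ suc n ℕ.* x) (choose-pascal n k) ⟨
    suc (suc n) ℕ.* a ∎
    where a = suc n C suc k

  choose-absorb-ℚ : ∀ n k → fromℕ (suc k) * fromℕ (suc n C suc k) ≡ fromℕ (suc n) * fromℕ (n C k)
  choose-absorb-ℚ n k = begin
    fromℕ (suc k) * fromℕ (suc n C suc k)  ≡⟨ fromℕ-* (suc k) (suc n C suc k) ⟨
    fromℕ (suc k ℕ.* (suc n C suc k))    ≡⟨ cong fromℕ (choose-absorb n k) ⟩
    fromℕ (suc n ℕ.* (n C k))            ≡⟨ fromℕ-* (suc n) (n C k) ⟩
    fromℕ (suc n) * fromℕ (n C k)          ∎

  choose-zero : ∀ {n k} → n ℕ.< k → fromℕ (n C k) ≡ 0ℚ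
  choose-zero n<k = trans (cong fromℕ (k>n⇒nCk≡0 n<k)) fromℤ-0

  -- Pascal's rule as a recursion for binomial sums with arbitrary `h`. It turns the Leibniz rule
  -- into the binomial convolution, proves the binomial theorem for operators and gives the
  -- recursion of `Cp`.
  sum-pascal : ∀ n (h : ℕ → ℚ) →
    ∑ 0 (suc (suc n)) (λ k → fromℕ (suc n C k) * h k)
    ≡ ∑ 0 (suc n) (λ k → fromℕ (n C k) * h (suc k)) + ∑ 0 (suc n) (λ k → fromℕ (n C k) * h k)
  sum-pascal n h = begin
    first + ∑ 1 (suc n) (λ k → fromℕ (suc n C k) * h k)
      ≡⟨ cong (first +_) (∑-shift 0 (suc n) _) ⟩
    first + ∑ 0 (suc n) (λ k → fromℕ (suc n C suc k) * h (suc k))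
      ≡⟨ cong (first +_) (∑-cong′ 0 (suc n) split) ⟩
    first + ∑ 0 (suc n) (λ k → fromℕ (n C k) * h (suc k) + fromℕ (n C suc k) * h (suc k))
      ≡⟨ cong (first +_) (∑-+ 0 (suc n) _ _) ⟩
    first + (Σ₁ + ∑ 0 (suc n) (λ k → fromℕ (n C suc k) * h (suc k)))
      ≡⟨ rearrange first Σ₁ _ ⟩
    Σ₁ + (first + ∑ 0 (suc n) (λ k → fromℕ (n C suc k) * h (suc k)))
      ≡⟨ cong (λ x → Σ₁ + (first + x)) (∑-shift 0 (suc n) _) ⟨
    Σ₁ + ∑ 0 (suc (suc n)) (λ k → fromℕ (n C k) * h k)
      ≡⟨ cong (Σ₁ +_) (∑-last 0 (suc n) _) ⟩
    Σ₁ + (Σ₂ + fromℕ (n C suc n) * h (suc n))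
      ≡⟨ cong (λ x → Σ₁ + (Σ₂ + x * h (suc n))) (choose-zero (ℕₚ.n<1+n n)) ⟩
    Σ₁ + (Σ₂ + 0ℚ * h (suc n))
      ≡⟨ drop Σ₁ Σ₂ (h (suc n)) ⟩
    Σ₁ + Σ₂ ∎
    where
    first = fromℕ 1 * h 0
    Σ₁ = ∑ 0 (suc n) (λ k → fromℕ (n C k) * h (suc k))
    Σ₂ = ∑ 0 (suc n) (λ k → fromℕ (n C k) * h k)
    split : ∀ k → fromℕ (suc n C suc k) * h (suc k) ≡ fromℕ (n C k) * h (suc k) + fromℕ (n C suc k) * h (suc k)
    split k = trans
      (cong (_* h (suc k)) (trans (cong fromℕ (choose-pascal n k)) (fromℕ-+ (n C k) (n C suc k))))
      (Q.distribʳ (h (suc k)) _ _)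
    opaque
      unfolding _+_
      rearrange : ∀ a b c → a + (b + c) ≡ b + (a + c)
      rearrange = solve-∀ ℚ-ring
    opaque
      unfolding _+_
      drop : ∀ a b c → a + (b + 0ℚ * c) ≡ a + b
      drop = solve-∀ ℚ-ring

  -- Euclidean division of integers

  /ℕ-%ℕ-unique : ∀ x b {a M} → a ℕ.< suc M → x ≡ pos a ℤ.+ b ℤ.* pos (suc M) →
    x ℤ.%ℕ suc M ≡ a × x ℤ./ℕ suc M ≡ b
  /ℕ-%ℕ-unique x b {a} {M} a<M eq = ℤₚ.+-injective (∙-cancelʳ (b ℤ.* pos (suc M)) (pos a′) (pos a) same) , sym b≡b′
    where
    a′ = x ℤ.%ℕ suc M
    b′ = x ℤ./ℕ suc M
    eqs : pos a ℤ.+ b ℤ.* pos (suc M) ≡ pos a′ ℤ.+ b′ ℤ.* pos (suc M)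
    eqs = trans (sym eq) (a≡a%ℕn+[a/ℕn]*n x (suc M))
    move : ∀ a b a′ b′ m → a ℤ.+ b ℤ.* m ≡ a′ ℤ.+ b′ ℤ.* m → (b ℤ.- b′) ℤ.* m ≡ a′ ℤ.- a
    move a b a′ b′ m e = begin
      (b ℤ.- b′) ℤ.* m                       ≡⟨ solve (a ∷ b ∷ b′ ∷ m ∷ []) ℤ-ring ⟩
      (a ℤ.+ b ℤ.* m) ℤ.- a ℤ.- b′ ℤ.* m     ≡⟨ cong (λ y → y ℤ.- a ℤ.- b′ ℤ.* m) e ⟩
      (a′ ℤ.+ b′ ℤ.* m) ℤ.- a ℤ.- b′ ℤ.* m   ≡⟨ solve (a ∷ a′ ∷ b′ ∷ m ∷ []) ℤ-ring ⟩
      a′ ℤ.- a                               ∎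
    -- The difference of the quotients times the modulus is a difference of two remainders, hence
    -- smaller than the modulus.
    small : ℤ.∣ b ℤ.- b′ ∣ ℕ.* suc M ℕ.< suc M
    small = subst (ℕ._< suc M) (begin
      ℤ.∣ a′ ℤ.⊖ a ∣                         ≡⟨ cong ℤ.∣_∣ (ℤₚ.m-n≡m⊖n a′ a) ⟨
      ℤ.∣ pos a′ ℤ.- pos a ∣                 ≡⟨ cong ℤ.∣_∣ (move (pos a) b (pos a′) b′ (pos (suc M)) eqs) ⟨
      ℤ.∣ (b ℤ.- b′) ℤ.* pos (suc M) ∣       ≡⟨ ℤₚ.∣i*j∣≡∣i∣*∣j∣ (b ℤ.- b′) (pos (suc M)) ⟩
      ℤ.∣ b ℤ.- b′ ∣ ℕ.* suc M               ∎)
      (ℕₚ.≤-<-trans (ℤₚ.∣m⊝n∣≤m⊔n a′ a) (ℕₚ.⊔-pres-<m (n%ℕd<d x (suc M)) a<M))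
    vanish : ∀ k → k ℕ.* suc M ℕ.< suc M → k ≡ 0
    vanish zero _ = refl
    vanish (suc k) lt = ⊥-elim (ℕₚ.<⇒≱ lt (ℕₚ.m≤m+n (suc M) (k ℕ.* suc M)))
    b≡b′ : b ≡ b′
    b≡b′ = ℤₚ.i-j≡0⇒i≡j b b′ (ℤₚ.∣i∣≡0⇒i≡0 (vanish _ small))
    same : pos a′ ℤ.+ b ℤ.* pos (suc M) ≡ pos a ℤ.+ b ℤ.* pos (suc M)
    same = trans (cong (λ c → pos a′ ℤ.+ c ℤ.* pos (suc M)) b≡b′) (sym eqs)

  lnr-unique : ∀ {x a M} b → a ℕ.< M → x ≡ pos a ℤ.+ b ℤ.* pos M → lnr x M ≡ a
  lnr-unique {M = suc M} b a<M eq = proj₁ (/ℕ-%ℕ-unique _ b a<M eq)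

  floorDiv-unique : ∀ {x a M} b → a ℕ.< M → x ≡ pos a ℤ.+ b ℤ.* pos M → floorDiv x M ≡ b
  floorDiv-unique {M = suc M} b a<M eq = proj₂ (/ℕ-%ℕ-unique _ b a<M eq)

  lnr-< : ∀ x {M} → 0 ℕ.< M → lnr x M ℕ.< M
  lnr-< x {suc M} _ = n%ℕd<d x (suc M)

  lnr-division : ∀ x {M} → 0 ℕ.< M → x ≡ pos (lnr x M) ℤ.+ floorDiv x M ℤ.* pos M
  lnr-division x {suc M} _ = a≡a%ℕn+[a/ℕn]*n x (suc M)

  lnr-cong : ∀ {x y M} z → 0 ℕ.< M → x ≡ y ℤ.+ z ℤ.* pos M → lnr x M ≡ lnr y M
  lnr-cong {x} {y} {M} z 0<M eq = lnr-unique (floorDiv y M ℤ.+ z) (lnr-< y 0<M) (begin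
    x                                                            ≡⟨ eq ⟩
    y ℤ.+ z ℤ.* pos M                                            ≡⟨ cong (ℤ._+ z ℤ.* pos M) (lnr-division y 0<M) ⟩
    pos (lnr y M) ℤ.+ floorDiv y M ℤ.* pos M ℤ.+ z ℤ.* pos M     ≡⟨ regroup (pos (lnr y M)) (floorDiv y M) z (pos M) ⟩
    pos (lnr y M) ℤ.+ (floorDiv y M ℤ.+ z) ℤ.* pos M             ∎)
    where
    regroup : ∀ a b c m → a ℤ.+ b ℤ.* m ℤ.+ c ℤ.* m ≡ a ℤ.+ (b ℤ.+ c) ℤ.* m
    regroup = solve-∀ ℤ-ring

  lnr-≡⇒ : ∀ {x y M} → 0 ℕ.< M → lnr x M ≡ lnr y M → x ≡ y ℤ.+ (floorDiv x M ℤ.- floorDiv y M) ℤ.* pos M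
  lnr-≡⇒ {x} {y} {M} 0<M eq = begin
    x                                                       ≡⟨ lnr-division x 0<M ⟩
    pos (lnr x M) ℤ.+ b ℤ.* pos M                           ≡⟨ cong (λ a → pos a ℤ.+ b ℤ.* pos M) eq ⟩
    pos (lnr y M) ℤ.+ b ℤ.* pos M                           ≡⟨ regroup (pos (lnr y M)) b b′ (pos M) ⟩
    (pos (lnr y M) ℤ.+ b′ ℤ.* pos M) ℤ.+ (b ℤ.- b′) ℤ.* pos M ≡⟨ cong (ℤ._+ (b ℤ.- b′) ℤ.* pos M) (lnr-division y 0<M) ⟨
    y ℤ.+ (b ℤ.- b′) ℤ.* pos M                              ∎
    where
    b = floorDiv x M
    b′ = floorDiv y M
    regroup : ∀ a b c m → a ℤ.+ b ℤ.* m ≡ (a ℤ.+ c ℤ.* m) ℤ.+ (b ℤ.- c) ℤ.* m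
    regroup = solve-∀ ℤ-ring

  -- Exponential power series

  Series : Set
  Series = ℕ → ℚ

  D : Series → Series
  D f n = f (suc n)

  infixl 6 _⊕_
  infixl 7 _⊛_ _∙_
  infix 8 ⊖_

  _⊕_ : Series → Series → Series
  (f ⊕ g) n = f n + g n

  ⊖_ : Series → Series
  (⊖ f) n = - f n

  _∙_ : ℚ → Series → Series
  (c ∙ f) n = c * f n

  𝟘 : Series
  𝟘 n = 0ℚ

  constant : ℚ → Series
  constant c zero = c
  constant c (suc n) = 0ℚ

  𝟙 : Series
  𝟙 = constant 1ℚ

  -- A series is the sequence of coefficients of x^k/k!, so that the product is
  -- the binomial convolution, here defined through the Leibniz rule.
  _⊛_ : Series → Series → Series
  (f ⊛ g) zero = f 0 * g 0
  (f ⊛ g) (suc n) = (D f ⊛ g) n + (f ⊛ D g) n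

  ⊛-cong : ∀ {f f′ g g′} → f ≗ f′ → g ≗ g′ → f ⊛ g ≗ f′ ⊛ g′
  ⊛-cong ef eg zero = cong₂ _*_ (ef 0) (eg 0)
  ⊛-cong ef eg (suc n) = cong₂ _+_ (⊛-cong (ef ∘ suc) eg n) (⊛-cong ef (eg ∘ suc) n)

  ⊛-distribʳ : ∀ h f g → (f ⊕ g) ⊛ h ≗ f ⊛ h ⊕ g ⊛ h
  ⊛-distribʳ h f g zero = Q.distribʳ (h 0) (f 0) (g 0)
  ⊛-distribʳ h f g (suc n) = trans
    (cong₂ _+_ (⊛-distribʳ h (D f) (D g) n) (⊛-distribʳ (D h) f g n))
    (Q.+-interchange ((D f ⊛ h) n) ((D g ⊛ h) n) ((f ⊛ D h) n) ((g ⊛ D h) n))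

  ⊛-comm : ∀ f g → f ⊛ g ≗ g ⊛ f
  ⊛-comm f g zero = Q.*-comm (f 0) (g 0)
  ⊛-comm f g (suc n) = trans
    (cong₂ _+_ (⊛-comm (D f) g n) (⊛-comm f (D g) n))
    (Q.+-comm ((g ⊛ D f) n) ((D g ⊛ f) n))

  ⊛-distribˡ : ∀ f g h → f ⊛ (g ⊕ h) ≗ f ⊛ g ⊕ f ⊛ h
  ⊛-distribˡ f g h n = trans (⊛-comm f (g ⊕ h) n)
    (trans (⊛-distribʳ f g h n) (cong₂ _+_ (⊛-comm g f n) (⊛-comm h f n)))

  ⊛-assoc : ∀ f g h → (f ⊛ g) ⊛ h ≗ f ⊛ (g ⊛ h)
  ⊛-assoc f g h zero = Q.*-assoc (f 0) (g 0) (h 0)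
  ⊛-assoc f g h (suc n) = begin
    ((D f ⊛ g ⊕ f ⊛ D g) ⊛ h) n + ((f ⊛ g) ⊛ D h) n
      ≡⟨ cong (_+ ((f ⊛ g) ⊛ D h) n) (⊛-distribʳ h (D f ⊛ g) (f ⊛ D g) n) ⟩
    (((D f ⊛ g) ⊛ h) n + ((f ⊛ D g) ⊛ h) n) + ((f ⊛ g) ⊛ D h) n
      ≡⟨ cong₂ _+_ (cong₂ _+_ (⊛-assoc (D f) g h n) (⊛-assoc f (D g) h n)) (⊛-assoc f g (D h) n) ⟩
    ((D f ⊛ (g ⊛ h)) n + (f ⊛ (D g ⊛ h)) n) + (f ⊛ (g ⊛ D h)) n
      ≡⟨ Q.+-assoc _ _ _ ⟩
    (D f ⊛ (g ⊛ h)) n + ((f ⊛ (D g ⊛ h)) n + (f ⊛ (g ⊛ D h)) n)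
      ≡⟨ cong ((D f ⊛ (g ⊛ h)) n +_) (⊛-distribˡ f (D g ⊛ h) (g ⊛ D h) n) ⟨
    (D f ⊛ (g ⊛ h)) n + (f ⊛ (D g ⊛ h ⊕ g ⊛ D h)) n ∎

  ∙-⊛ : ∀ c f g → (c ∙ f) ⊛ g ≗ c ∙ (f ⊛ g)
  ∙-⊛ c f g zero = Q.*-assoc c (f 0) (g 0)
  ∙-⊛ c f g (suc n) = trans
    (cong₂ _+_ (∙-⊛ c (D f) g n) (∙-⊛ c f (D g) n))
    (sym (Q.distribˡ c ((D f ⊛ g) n) ((f ⊛ D g) n)))

  ⊛-∙ : ∀ c f g → f ⊛ (c ∙ g) ≗ c ∙ (f ⊛ g)
  ⊛-∙ c f g n = trans (⊛-comm f (c ∙ g) n) (trans (∙-⊛ c g f n) (cong (c *_) (⊛-comm g f n)))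

  𝟘-⊛ : ∀ f → 𝟘 ⊛ f ≗ 𝟘
  𝟘-⊛ f zero = Q.zeroˡ (f 0)
  𝟘-⊛ f (suc n) = trans (cong₂ _+_ (𝟘-⊛ f n) (𝟘-⊛ (D f) n)) (Q.+-identityˡ 0ℚ)

  constant-⊛ : ∀ c f → constant c ⊛ f ≗ c ∙ f
  constant-⊛ c f zero = refl
  constant-⊛ c f (suc n) = trans (cong₂ _+_ (𝟘-⊛ f n) (constant-⊛ c (D f) n)) (Q.+-identityˡ _)

  ⊛-identityˡ : ∀ f → 𝟙 ⊛ f ≗ f
  ⊛-identityˡ f n = trans (constant-⊛ 1ℚ f n) (Q.*-identityˡ (f n))

  ⊛-identityʳ : ∀ f → f ⊛ 𝟙 ≗ f
  ⊛-identityʳ f n = trans (⊛-comm f 𝟙 n) (⊛-identityˡ f n)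

  Series-commutativeRing : CommutativeRing 0ℓ 0ℓ
  Series-commutativeRing = record
    { Carrier = Series ; _≈_ = _≗_ ; _+_ = _⊕_ ; _*_ = _⊛_ ; -_ = ⊖_ ; 0# = 𝟘 ; 1# = 𝟙
    ; isCommutativeRing = record
      { isRing = record
        { +-isAbelianGroup = Pointwise.isAbelianGroup ℕ (IsCommutativeRing.+-isAbelianGroup ℚ-isCommutativeRing)
        ; *-cong = ⊛-cong
        ; *-assoc = ⊛-assoc
        ; *-identity = ⊛-identityˡ , ⊛-identityʳ
        ; distrib = ⊛-distribˡ , ⊛-distribʳ
        }
      ; *-comm = ⊛-comm
      }
    }

  module S where
    open CommutativeRing Series-commutativeRing public
      using (ring; commutativeSemiring)
    open import Algebra.Properties.CommutativeSemiring.Exp commutativeSemiring public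
    open import Algebra.Properties.Ring ring public using (-‿distribˡ-*; -‿distribʳ-*)
    open import Algebra.Solver.Ring.NaturalCoefficients.Default commutativeSemiring public using (solve; _:+_; _:*_; _:=_)

  ⊛-binomial : ∀ f g n → (f ⊛ g) n ≡ ∑ 0 (suc n) (λ k → fromℕ (n C k) * (f k * g (n ∸ k)))
  ⊛-binomial f g zero = sym (trans (Q.+-identityʳ _) (fromℕ1-* _))
  ⊛-binomial f g (suc n) = begin
    (D f ⊛ g) n + (f ⊛ D g) n
      ≡⟨ cong₂ _+_ (⊛-binomial (D f) g n) (⊛-binomial f (D g) n) ⟩
    ∑ 0 (suc n) (λ k → fromℕ (n C k) * (f (suc k) * g (n ∸ k)))
    + ∑ 0 (suc n) (λ k → fromℕ (n C k) * (f k * g (suc (n ∸ k))))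
      ≡⟨ cong (∑ 0 (suc n) (λ k → fromℕ (n C k) * (f (suc k) * g (n ∸ k))) +_)
           (∑-cong 0 (suc n) (λ k _ k≤n →
             cong (λ j → fromℕ (n C k) * (f k * g j)) (sym (ℕₚ.+-∸-assoc 1 (ℕₚ.≤-pred k≤n))))) ⟩
    ∑ 0 (suc n) (λ k → fromℕ (n C k) * (f (suc k) * g (n ∸ k)))
    + ∑ 0 (suc n) (λ k → fromℕ (n C k) * (f k * g (suc n ∸ k)))
      ≡⟨ sum-pascal n (λ k → f k * g (suc n ∸ k)) ⟨
    ∑ 0 (suc (suc n)) (λ k → fromℕ (suc n C k) * (f k * g (suc n ∸ k))) ∎

  exp : ℚ → Series
  exp t k = t ^ k

  exp-+ : ∀ s t → exp s ⊛ exp t ≗ exp (s + t)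
  exp-+ s t zero = Q.*-identityˡ 1ℚ
  exp-+ s t (suc n) = begin
    ((s ∙ exp s) ⊛ exp t) n + (exp s ⊛ (t ∙ exp t)) n
      ≡⟨ cong₂ _+_ (∙-⊛ s (exp s) (exp t) n) (⊛-∙ t (exp s) (exp t) n) ⟩
    s * (exp s ⊛ exp t) n + t * (exp s ⊛ exp t) n
      ≡⟨ Q.distribʳ ((exp s ⊛ exp t) n) s t ⟨
    (s + t) * (exp s ⊛ exp t) n
      ≡⟨ cong ((s + t) *_) (exp-+ s t n) ⟩
    (s + t) * (s + t) ^ n ∎

  exp-0 : exp 0ℚ ≗ 𝟙
  exp-0 zero = refl
  exp-0 (suc n) = Q.zeroˡ (0ℚ ^ n)

  X : Series
  X zero = 0ℚ
  X (suc k) = 𝟙 k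

  -- In exponential coefficients multiplication by x is a weighted shift, because x x^n/n! = (n + 1)
  -- x^(n+1)/(n+1)!.
  X-⊛-suc : ∀ f n → (X ⊛ f) (suc n) ≡ fromℕ (suc n) * f n
  X-⊛-suc f zero = trans (cong₂ _+_ (⊛-identityˡ f 0) (Q.zeroˡ (f 1))) (trans (Q.+-identityʳ (f 0)) (sym (fromℕ1-* (f 0))))
  X-⊛-suc f (suc n) = begin
    (𝟙 ⊛ f) (suc n) + (X ⊛ D f) (suc n)   ≡⟨ cong₂ _+_ (⊛-identityˡ f (suc n)) (X-⊛-suc (D f) n) ⟩
    f (suc n) + fromℕ (suc n) * f (suc n)   ≡⟨ collect (fromℕ (suc n)) (f (suc n)) ⟩
    (1ℚ + fromℕ (suc n)) * f (suc n)        ≡⟨ cong (_* f (suc n)) (fromℕ-suc (suc n)) ⟨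
    fromℕ (suc (suc n)) * f (suc n)         ∎
    where
    opaque
      unfolding _+_
      collect : ∀ a x → x + a * x ≡ (1ℚ + a) * x
      collect = solve-∀ ℚ-ring

  -- The ratio (a + b)!/b! is cleared of its denominator; division by b! is left to places where b!
  -- is known to be prime to p.
  X^-⊛ : ∀ a b f → fromℕ (b !) * (X S.^ a ⊛ f) (a ℕ.+ b) ≡ fromℕ ((a ℕ.+ b) !) * f b
  X^-⊛ zero b f = cong (fromℕ (b !) *_) (⊛-identityˡ f b)
  X^-⊛ (suc a) b f = begin
    fromℕ (b !) * ((X ⊛ X S.^ a) ⊛ f) (suc (a ℕ.+ b))
      ≡⟨ cong (fromℕ (b !) *_) (⊛-assoc X (X S.^ a) f (suc (a ℕ.+ b))) ⟩
    fromℕ (b !) * (X ⊛ (X S.^ a ⊛ f)) (suc (a ℕ.+ b))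
      ≡⟨ cong (fromℕ (b !) *_) (X-⊛-suc (X S.^ a ⊛ f) (a ℕ.+ b)) ⟩
    fromℕ (b !) * (fromℕ (suc (a ℕ.+ b)) * (X S.^ a ⊛ f) (a ℕ.+ b))
      ≡⟨ Q.x*yz≡y*xz (fromℕ (b !)) (fromℕ (suc (a ℕ.+ b))) _ ⟩
    fromℕ (suc (a ℕ.+ b)) * (fromℕ (b !) * (X S.^ a ⊛ f) (a ℕ.+ b))
      ≡⟨ cong (fromℕ (suc (a ℕ.+ b)) *_) (X^-⊛ a b f) ⟩
    fromℕ (suc (a ℕ.+ b)) * (fromℕ ((a ℕ.+ b) !) * f b)
      ≡⟨ Q.*-assoc (fromℕ (suc (a ℕ.+ b))) (fromℕ ((a ℕ.+ b) !)) (f b) ⟨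
    fromℕ (suc (a ℕ.+ b)) * fromℕ ((a ℕ.+ b) !) * f b
      ≡⟨ cong (_* f b) (fromℕ-* (suc (a ℕ.+ b)) ((a ℕ.+ b) !)) ⟨
    fromℕ ((suc a ℕ.+ b) !) * f b ∎

  -- The series (e^x - 1)/x: the coefficient of x^k is 1/(k + 1)!, that of x^k/k! is therefore 1/(k
  -- + 1).
  expm1/X : Series
  expm1/X k = recip (fromℕ (suc k))

  X⊛expm1/X : ∀ k → (X ⊛ expm1/X) (suc k) ≡ 1ℚ
  X⊛expm1/X k = trans (X-⊛-suc expm1/X k) (*-recip k)

  1-exp : 𝟙 ⊕ ⊖ exp 1ℚ ≗ ⊖ (X ⊛ expm1/X)
  1-exp zero = trans (Q.-‿inverseʳ 1ℚ) (trans (sym Q.ε⁻¹≈ε) (cong -_ (sym (Q.zeroˡ _))))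
  1-exp (suc k) = begin
    0ℚ + - (1ℚ ^ suc k)         ≡⟨ Q.+-identityˡ _ ⟩
    - (1ℚ ^ suc k)              ≡⟨ cong -_ (1^n≡1 (suc k)) ⟩
    - 1ℚ                          ≡⟨ cong -_ (X⊛expm1/X k) ⟨
    - (X ⊛ expm1/X) (suc k)       ∎

  -- Polynomials in ∇

  infixl 6 _⊞_
  infixl 7 _⊠_
  infix 8 ⊟_

  -- Polynomials in the backward difference ∇, up to equality of their action on
  -- functions ℤ → ℚ.
  data Poly : Set where
    con : ℚ → Poly
    ∇   : Poly
    _⊞_ _⊠_ : Poly → Poly → Poly

  ⊟_ : Poly → Poly
  ⊟ a = con (- 1ℚ) ⊠ a

  act : Poly → (ℤ → ℚ) → ℤ → ℚ
  act (con c) f r = c * f r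
  act ∇ f r = f r - f (r ℤ.- pos 1)
  act (a ⊞ b) f r = act a f r + act b f r
  act (a ⊠ b) f r = act a (act b f) r

  infix 4 _≈_
  record _≈_ (a b : Poly) : Set where
    constructor same-action
    field apply : ∀ f r → act a f r ≡ act b f r
  open _≈_ public

  act-cong : ∀ a {f g} → f ≗ g → act a f ≗ act a g
  act-cong (con c) eq r = cong (c *_) (eq r)
  act-cong ∇ eq r = cong₂ _-_ (eq r) (eq (r ℤ.- pos 1))
  act-cong (a ⊞ b) eq r = cong₂ _+_ (act-cong a eq r) (act-cong b eq r)
  act-cong (a ⊠ b) eq r = act-cong a (act-cong b eq) r

  act-+ : ∀ a f g r → act a (λ s → f s + g s) r ≡ act a f r + act a g r
  act-+ (con c) f g r = Q.distribˡ c (f r) (g r)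
  act-+ ∇ f g r = interchange (f r) (g r) (f (r ℤ.- pos 1)) (g (r ℤ.- pos 1))
    where
    opaque
      unfolding _+_
      interchange : ∀ a b c d → (a + b) - (c + d) ≡ (a - c) + (b - d)
      interchange = solve-∀ ℚ-ring
  act-+ (a ⊞ b) f g r = trans (cong₂ _+_ (act-+ a f g r) (act-+ b f g r))
    (Q.+-interchange (act a f r) (act a g r) (act b f r) (act b g r))
  act-+ (a ⊠ b) f g r = trans (act-cong a (act-+ b f g) r) (act-+ a (act b f) (act b g) r)

  act-* : ∀ a c f r → act a (λ s → c * f s) r ≡ c * act a f r
  act-* (con d) c f r = Q.x*yz≡y*xz d c (f r)
  act-* ∇ c f r = factor c (f r) (f (r ℤ.- pos 1))
    where
    opaque
      unfolding _+_
      factor : ∀ c x y → c * x - c * y ≡ c * (x - y)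
      factor = solve-∀ ℚ-ring
  act-* (a ⊞ b) c f r = trans (cong₂ _+_ (act-* a c f r) (act-* b c f r)) (sym (Q.distribˡ c (act a f r) (act b f r)))
  act-* (a ⊠ b) c f r = trans (act-cong a (act-* b c f) r) (act-* a c (act b f) r)

  act-∇ : ∀ a f r → act ∇ (act a f) r ≡ act a (act ∇ f) r
  act-∇ (con c) f r = act-* ∇ c f r
  act-∇ ∇ f r = refl
  act-∇ (a ⊞ b) f r = trans (act-+ ∇ (act a f) (act b f) r) (cong₂ _+_ (act-∇ a f r) (act-∇ b f r))
  act-∇ (a ⊠ b) f r = trans (act-∇ a (act b f) r) (act-cong a (act-∇ b f) r)

  -- Every polynomial acts linearly and commutes with ∇, which settles constants and ∇; sums and
  -- products follow by induction on `a`.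
  act-comm : ∀ a b f r → act a (act b f) r ≡ act b (act a f) r
  act-comm (con c) b f r = sym (act-* b c f r)
  act-comm ∇ b f r = act-∇ b f r
  act-comm (a ⊞ a′) b f r = trans (cong₂ _+_ (act-comm a b f r) (act-comm a′ b f r)) (sym (act-+ b (act a f) (act a′ f) r))
  act-comm (a ⊠ a′) b f r = trans (act-cong a (act-comm a′ b f) r) (act-comm a b (act a′ f) r)

  Poly-commutativeRing : CommutativeRing 0ℓ 0ℓ
  Poly-commutativeRing = record
    { Carrier = Poly ; _≈_ = _≈_ ; _+_ = _⊞_ ; _*_ = _⊠_ ; -_ = ⊟_ ; 0# = con 0ℚ ; 1# = con 1ℚ
    ; isCommutativeRing = record
      { isRing = record
        { +-isAbelianGroup = record
          { isGroup = record
            { isMonoid = record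
              { isSemigroup = record
                { isMagma = record
                  { isEquivalence = record
                    { refl = same-action λ f r → refl
                    ; sym = λ e → same-action λ f r → sym (apply e f r)
                    ; trans = λ e e′ → same-action λ f r → trans (apply e f r) (apply e′ f r)
                    }
                  ; ∙-cong = λ e e′ → same-action λ f r → cong₂ _+_ (apply e f r) (apply e′ f r)
                  }
                ; assoc = λ a b c → same-action λ f r → Q.+-assoc (act a f r) (act b f r) (act c f r)
                }
              ; identity = (λ a → same-action λ f r → trans (cong (_+ act a f r) (Q.zeroˡ (f r))) (Q.+-identityˡ (act a f r)))
                         , (λ a → same-action λ f r → trans (cong (act a f r +_) (Q.zeroˡ (f r))) (Q.+-identityʳ (act a f r)))
              }
            ; inverse = (λ a → same-action λ f r → inverseˡ (act a f r) (f r))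
                      , (λ a → same-action λ f r → trans (Q.+-comm (act a f r) _) (inverseˡ (act a f r) (f r)))
            ; ⁻¹-cong = λ e → same-action λ f r → cong ((- 1ℚ) *_) (apply e f r)
            }
          ; comm = λ a b → same-action λ f r → Q.+-comm (act a f r) (act b f r)
          }
        ; *-cong = λ {a} {a′} {b} {b′} e e′ → same-action λ f r → trans (act-cong a (apply e′ f) r) (apply e (act b′ f) r)
        ; *-assoc = λ a b c → same-action λ f r → refl
        ; *-identity = (λ a → same-action λ f r → Q.*-identityˡ (act a f r))
                     , (λ a → same-action λ f r → trans (act-* a 1ℚ f r) (Q.*-identityˡ (act a f r)))
        ; distrib = (λ a b c → same-action λ f r → act-+ a (act b f) (act c f) r)
                  , (λ a b c → same-action λ f r → refl)
        }
      ; *-comm = λ a b → same-action λ f r → act-comm a b f r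
      }
    }
    where
    opaque
      unfolding _+_
      inverseˡ : ∀ x y → (- 1ℚ) * x + x ≡ 0ℚ * y
      inverseˡ = solve-∀ ℚ-ring

  module P where
    open CommutativeRing Poly-commutativeRing public
      using (ring; commutativeSemiring; refl; reflexive; trans; +-cong; *-cong; *-congˡ; +-congˡ; +-congʳ; *-identityˡ)
    open import Algebra.Properties.CommutativeSemiring.Exp commutativeSemiring public
    open import Algebra.Solver.Ring.NaturalCoefficients.Default commutativeSemiring public using (solve; _:+_; _:*_; _:=_)

  infixr 2 _≈⟨_⟩_
  infix 3 _□

  _≈⟨_⟩_ : ∀ a {b c} → a ≈ b → b ≈ c → a ≈ c
  a ≈⟨ e ⟩ e′ = P.trans e e′

  _□ : ∀ a → a ≈ a
  a □ = P.refl

  -- Polynomials in ∇ as power series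

  ser : Poly → Series
  ser (con c) = constant c
  ser ∇ = 𝟙 ⊕ ⊖ exp 1ℚ
  ser (a ⊞ b) = ser a ⊕ ser b
  ser (a ⊠ b) = ser a ⊛ ser b

  ser-^ : ∀ a n → ser (a P.^ n) ≗ ser a S.^ n
  ser-^ a zero k = refl
  ser-^ a (suc n) = ⊛-cong (λ k → refl) (ser-^ a n)

  -- The coefficient of x^k/k! in e^(-rx) `g`, seen as a function of `r`; with `𝟙` for `g` it is the
  -- monomial (-r)^k.
  W : ℕ → Series → ℤ → ℚ
  W k g r = (exp (- fromℤ r) ⊛ g) k

  W-cong : ∀ k {g h} → g ≗ h → W k g ≗ W k h
  W-cong k eq r = ⊛-cong {exp (- fromℤ r)} (λ _ → refl) eq k

  W-act : ∀ a k g r → W k (ser a ⊛ g) r ≡ act a (W k g) r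
  W-act (con c) k g r = trans (W-cong k (constant-⊛ c g) r) (⊛-∙ c (exp (- fromℤ r)) g k)
  W-act ∇ k g r = begin
    (E ⊛ ((𝟙 ⊕ ⊖ exp 1ℚ) ⊛ g)) k
      ≡⟨ S.solve 3 (λ e f g → e :* (f :* g) := (e :* f) :* g) (λ _ → refl) E (𝟙 ⊕ ⊖ exp 1ℚ) g k ⟩
    ((E ⊛ (𝟙 ⊕ ⊖ exp 1ℚ)) ⊛ g) k
      ≡⟨ ⊛-cong {g = g} shift (λ _ → refl) k ⟩
    ((E ⊕ ⊖ exp (- fromℤ (r ℤ.- pos 1))) ⊛ g) k
      ≡⟨ ⊛-distribʳ g E (⊖ exp (- fromℤ (r ℤ.- pos 1))) k ⟩
    (E ⊛ g) k + (⊖ exp (- fromℤ (r ℤ.- pos 1)) ⊛ g) k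
      ≡⟨ cong ((E ⊛ g) k +_) (S.-‿distribˡ-* (exp (- fromℤ (r ℤ.- pos 1))) g k) ⟨
    (E ⊛ g) k - (exp (- fromℤ (r ℤ.- pos 1)) ⊛ g) k ∎
    where
    open S using (_:*_; _:=_)
    E = exp (- fromℤ r)
    opaque
      unfolding _+_
      negate : ∀ x → (- x) + 1ℚ ≡ - (x - 1ℚ)
      negate = solve-∀ ℚ-ring
    shift : E ⊛ (𝟙 ⊕ ⊖ exp 1ℚ) ≗ E ⊕ ⊖ exp (- fromℤ (r ℤ.- pos 1))
    shift j = begin
      (E ⊛ (𝟙 ⊕ ⊖ exp 1ℚ)) j             ≡⟨ ⊛-distribˡ E 𝟙 (⊖ exp 1ℚ) j ⟩
      (E ⊛ 𝟙) j + (E ⊛ ⊖ exp 1ℚ) j       ≡⟨ cong₂ _+_ (⊛-identityʳ E j) (sym (S.-‿distribʳ-* E (exp 1ℚ) j)) ⟩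
      E j - (E ⊛ exp 1ℚ) j               ≡⟨ cong (λ x → E j - x) (exp-+ (- fromℤ r) 1ℚ j) ⟩
      E j - exp ((- fromℤ r) + 1ℚ) j     ≡⟨ cong (λ x → E j - exp x j) (negate (fromℤ r)) ⟩
      E j - exp (- (fromℤ r - 1ℚ)) j     ≡⟨ cong (λ x → E j - exp (- (fromℤ r - x)) j) fromℤ-1 ⟨
      E j - exp (- (fromℤ r - fromℤ (pos 1))) j ≡⟨ cong (λ x → E j - exp (- x) j) (fromℤ-sub r (pos 1)) ⟨
      E j - exp (- fromℤ (r ℤ.- pos 1)) j ∎
  W-act (a ⊞ b) k g r = begin
    W k ((ser a ⊕ ser b) ⊛ g) r                  ≡⟨ W-cong k (⊛-distribʳ g (ser a) (ser b)) r ⟩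
    W k (ser a ⊛ g ⊕ ser b ⊛ g) r                ≡⟨ ⊛-distribˡ (exp (- fromℤ r)) (ser a ⊛ g) (ser b ⊛ g) k ⟩
    W k (ser a ⊛ g) r + W k (ser b ⊛ g) r        ≡⟨ cong₂ _+_ (W-act a k g r) (W-act b k g r) ⟩
    act a (W k g) r + act b (W k g) r            ∎
  W-act (a ⊠ b) k g r = begin
    W k ((ser a ⊛ ser b) ⊛ g) r     ≡⟨ W-cong k (⊛-assoc (ser a) (ser b) g) r ⟩
    W k (ser a ⊛ (ser b ⊛ g)) r     ≡⟨ W-act a k (ser b ⊛ g) r ⟩
    act a (W k (ser b ⊛ g)) r       ≡⟨ act-cong a (W-act b k g) r ⟩
    act a (act b (W k g)) r         ∎

  W-0 : ∀ k g → W k g (pos 0) ≡ g k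
  W-0 k g = trans (⊛-cong {g = g} (λ j → trans (cong (λ x → exp x j) (trans (cong -_ fromℤ-0) Q.ε⁻¹≈ε)) (exp-0 j)) (λ _ → refl) k) (⊛-identityˡ g k)

  -- The coefficients of `ser a` are recovered from the action of `a` on the monomials (-r)^k at r =
  -- 0. Hence an identity of operators, which is all that `_≈_` records, is also an identity of
  -- series.
  ser-act : ∀ a k → ser a k ≡ act a (W k 𝟙) (pos 0)
  ser-act a k = begin
    ser a k                    ≡⟨ ⊛-identityʳ (ser a) k ⟨
    (ser a ⊛ 𝟙) k              ≡⟨ W-0 k (ser a ⊛ 𝟙) ⟨
    W k (ser a ⊛ 𝟙) (pos 0)    ≡⟨ W-act a k 𝟙 (pos 0) ⟩
    act a (W k 𝟙) (pos 0)      ∎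

  ser-cong : ∀ {a b} → a ≈ b → ser a ≗ ser b
  ser-cong {a} {b} eq k = trans (ser-act a k) (trans (apply eq (W k 𝟙) (pos 0)) (sym (ser-act b k)))

  -- Polynomials given by coefficients, and the binomial theorem

  ∑-poly : (ℕ → ℚ) → ℕ → ℕ → Poly → Poly
  ∑-poly c lo zero x = con 0ℚ
  ∑-poly c lo (suc n) x = con (c lo) ⊠ x P.^ lo ⊞ ∑-poly c (suc lo) n x

  act-∑-poly : ∀ c lo n x f r → act (∑-poly c lo n x) f r ≡ ∑ lo n (λ k → c k * act (x P.^ k) f r)
  act-∑-poly c lo zero x f r = Q.zeroˡ (f r)
  act-∑-poly c lo (suc n) x f r = cong (c lo * act (x P.^ lo) f r +_) (act-∑-poly c (suc lo) n x f r)

  ∑-poly-cong : ∀ {c d} lo n x → c ≗ d → ∑-poly c lo n x ≈ ∑-poly d lo n x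
  ∑-poly-cong {c} {d} lo n x eq = same-action λ f r → begin
    act (∑-poly c lo n x) f r                  ≡⟨ act-∑-poly c lo n x f r ⟩
    ∑ lo n (λ k → c k * act (x P.^ k) f r)     ≡⟨ ∑-cong′ lo n (λ k → cong (_* act (x P.^ k) f r) (eq k)) ⟩
    ∑ lo n (λ k → d k * act (x P.^ k) f r)     ≡⟨ act-∑-poly d lo n x f r ⟨
    act (∑-poly d lo n x) f r                  ∎

  ∑-poly-* : ∀ a c lo n x → ∑-poly (λ k → a * c k) lo n x ≈ con a ⊠ ∑-poly c lo n x
  ∑-poly-* a c lo n x = same-action λ f r → begin
    act (∑-poly (λ k → a * c k) lo n x) f r            ≡⟨ act-∑-poly (λ k → a * c k) lo n x f r ⟩
    ∑ lo n (λ k → a * c k * act (x P.^ k) f r)         ≡⟨ ∑-cong′ lo n (λ k → Q.*-assoc a (c k) (act (x P.^ k) f r)) ⟩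
    ∑ lo n (λ k → a * (c k * act (x P.^ k) f r))       ≡⟨ ∑-* lo n a (λ k → c k * act (x P.^ k) f r) ⟩
    a * ∑ lo n (λ k → c k * act (x P.^ k) f r)         ≡⟨ cong (a *_) (act-∑-poly c lo n x f r) ⟨
    a * act (∑-poly c lo n x) f r                      ∎

  ∑-poly-first : ∀ c n x → ∑-poly c 0 (suc n) x ≈ con (c 0) ⊞ x ⊠ ∑-poly (c ∘ suc) 0 n x
  ∑-poly-first c n x = same-action λ f r → begin
    c 0 * (1ℚ * f r) + act (∑-poly c 1 n x) f r
      ≡⟨ cong₂ (λ y z → c 0 * y + z) (Q.*-identityˡ (f r)) (act-∑-poly c 1 n x f r) ⟩
    c 0 * f r + ∑ 1 n (λ k → c k * act (x P.^ k) f r)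
      ≡⟨ cong (c 0 * f r +_) (∑-shift 0 n _) ⟩
    c 0 * f r + ∑ 0 n (λ k → c (suc k) * act x (act (x P.^ k) f) r)
      ≡⟨ cong (c 0 * f r +_) (∑-cong′ 0 n (λ k → cong (c (suc k) *_) (act-comm x (x P.^ k) f r))) ⟩
    c 0 * f r + ∑ 0 n (λ k → c (suc k) * act (x P.^ k) (act x f) r)
      ≡⟨ cong (c 0 * f r +_) (act-∑-poly (c ∘ suc) 0 n x (act x f) r) ⟨
    c 0 * f r + act (∑-poly (c ∘ suc) 0 n x) (act x f) r
      ≡⟨ cong (c 0 * f r +_) (act-comm (∑-poly (c ∘ suc) 0 n x) x f r) ⟩
    c 0 * f r + act x (act (∑-poly (c ∘ suc) 0 n x) f) r ∎

  ∑-poly-last : ∀ c n x → ∑-poly c 0 (suc n) x ≈ ∑-poly c 0 n x ⊞ con (c n) ⊠ x P.^ n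
  ∑-poly-last c n x = same-action λ f r → begin
    act (∑-poly c 0 (suc n) x) f r                              ≡⟨ act-∑-poly c 0 (suc n) x f r ⟩
    ∑ 0 (suc n) (λ k → c k * act (x P.^ k) f r)                 ≡⟨ ∑-last 0 n _ ⟩
    ∑ 0 n (λ k → c k * act (x P.^ k) f r) + c n * act (x P.^ n) f r ≡⟨ cong (_+ c n * act (x P.^ n) f r) (act-∑-poly c 0 n x f r) ⟨
    act (∑-poly c 0 n x) f r + c n * act (x P.^ n) f r          ∎

  binomial-act : ∀ x n f r → act ((con 1ℚ ⊞ x) P.^ n) f r ≡ ∑ 0 (suc n) (λ k → fromℕ (n C k) * act (x P.^ k) f r)
  binomial-act x zero f r = sym (trans (Q.+-identityʳ _) (fromℕ1-* (1ℚ * f r)))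
  binomial-act x (suc n) f r = begin
    act (con 1ℚ ⊞ x) (act ((con 1ℚ ⊞ x) P.^ n) f) r
      -- The extra factor is moved onto `f`, so that the induction hypothesis applies to (1 + x) f.
      ≡⟨ act-comm (con 1ℚ ⊞ x) ((con 1ℚ ⊞ x) P.^ n) f r ⟩
    act ((con 1ℚ ⊞ x) P.^ n) (act (con 1ℚ ⊞ x) f) r
      ≡⟨ binomial-act x n (act (con 1ℚ ⊞ x) f) r ⟩
    ∑ 0 (suc n) (λ k → fromℕ (n C k) * act (x P.^ k) (act (con 1ℚ ⊞ x) f) r)
      ≡⟨ ∑-cong′ 0 (suc n) (λ k → trans (cong (fromℕ (n C k) *_) (step k)) (Q.distribˡ (fromℕ (n C k)) (h (suc k)) (h k))) ⟩
    ∑ 0 (suc n) (λ k → fromℕ (n C k) * h (suc k) + fromℕ (n C k) * h k)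
      ≡⟨ ∑-+ 0 (suc n) (λ k → fromℕ (n C k) * h (suc k)) (λ k → fromℕ (n C k) * h k) ⟩
    ∑ 0 (suc n) (λ k → fromℕ (n C k) * h (suc k)) + ∑ 0 (suc n) (λ k → fromℕ (n C k) * h k)
      ≡⟨ sum-pascal n h ⟨
    ∑ 0 (suc (suc n)) (λ k → fromℕ (suc n C k) * h k) ∎
    where
    h : ℕ → ℚ
    h k = act (x P.^ k) f r
    step : ∀ k → act (x P.^ k) (act (con 1ℚ ⊞ x) f) r ≡ h (suc k) + h k
    step k = begin
      act (x P.^ k) (λ s → 1ℚ * f s + act x f s) r                    ≡⟨ act-+ (x P.^ k) (λ s → 1ℚ * f s) (act x f) r ⟩
      act (x P.^ k) (λ s → 1ℚ * f s) r + act (x P.^ k) (act x f) r    ≡⟨ cong₂ _+_ (trans (act-* (x P.^ k) 1ℚ f r) (Q.*-identityˡ (h k))) (act-comm (x P.^ k) x f r) ⟩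
      h k + h (suc k)                                                 ≡⟨ Q.+-comm (h k) (h (suc k)) ⟩
      h (suc k) + h k                                                 ∎

  binomial : ∀ x n → (con 1ℚ ⊞ x) P.^ n ≈ ∑-poly (λ k → fromℕ (n C k)) 0 (suc n) x
  binomial x n = same-action λ f r → trans (binomial-act x n f r) (sym (act-∑-poly _ 0 (suc n) x f r))

  -- The operator 1 - ∇ evaluates at r - 1. So p-periodicity is invariance under (1 - ∇)^p.
  shift-act : ∀ n f r → act ((con 1ℚ ⊞ ⊟ ∇) P.^ n) f r ≡ f (r ℤ.- pos n)
  shift-act zero f r = trans (Q.*-identityˡ (f r)) (cong f (sym (ℤₚ.+-identityʳ r)))
  shift-act (suc n) f r = begin
    1ℚ * g r + (- 1ℚ) * (g r - g (r ℤ.- pos 1))     ≡⟨ cancel (g r) (g (r ℤ.- pos 1)) ⟩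
    g (r ℤ.- pos 1)                                 ≡⟨ shift-act n f (r ℤ.- pos 1) ⟩
    f ((r ℤ.- pos 1) ℤ.- pos n)                     ≡⟨ cong f (regroup r (pos n)) ⟩
    f (r ℤ.- pos (suc n))                           ∎
    where
    g = act ((con 1ℚ ⊞ ⊟ ∇) P.^ n) f
    opaque
      unfolding _+_
      cancel : ∀ x y → 1ℚ * x + (- 1ℚ) * (x - y) ≡ y
      cancel = solve-∀ ℚ-ring
    regroup : ∀ r n → (r ℤ.- pos 1) ℤ.- n ≡ r ℤ.- (pos 1 ℤ.+ n)
    regroup = solve-∀ ℤ-ring

  -- Bernoulli numbers

  nthOr-++ˡ : ∀ xs {ys} i → i ℕ.< length xs → nthOr (xs ++ ys) i ≡ nthOr xs i
  nthOr-++ˡ (x ∷ xs) zero lt = refl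
  nthOr-++ˡ (x ∷ xs) (suc i) (s≤s lt) = nthOr-++ˡ xs i lt

  nthOr-++-length : ∀ xs y → nthOr (xs ++ y ∷ []) (length xs) ≡ y
  nthOr-++-length [] y = refl
  nthOr-++-length (x ∷ xs) y = nthOr-++-length xs y

  length-bernList : ∀ n → length (bernList n) ≡ suc n
  length-bernList zero = refl
  length-bernList (suc n) = trans (length-++ (bernList n)) (trans (cong (ℕ._+ 1) (length-bernList n)) (ℕₚ.+-comm (suc n) 1))

  nthOr-bernList : ∀ n j → j ℕ.≤ n → nthOr (bernList n) j ≡ B j
  nthOr-bernList zero zero _ = refl
  nthOr-bernList (suc n) j j≤ with ℕₚ.m≤n⇒m<n∨m≡n j≤
  ... | inj₁ (s≤s j≤n) = trans
    (nthOr-++ˡ (bernList n) j (subst (j ℕ.<_) (sym (length-bernList n)) (s≤s j≤n))) (nthOr-bernList n j j≤n)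
  ... | inj₂ refl = refl

  opaque
    unfolding _+_

    -- Stated for any `g`, because passing to the tail replaces the index function by its composite
    -- with `suc`.
    sumL-zipWith : ∀ (f : ℕ → ℚ → ℚ) g xs → sumL (zipWith f (applyUpTo g (length xs)) xs) ≡ ∑ 0 (length xs) (λ j → f (g j) (nthOr xs j))
    sumL-zipWith f g [] = refl
    sumL-zipWith f g (x ∷ xs) = cong (f (g 0) x +_) (trans (sumL-zipWith f (g ∘ suc) xs) (sym (∑-shift 0 (length xs) _)))

    B-0 : B 0 ≡ 1ℚ
    B-0 = refl

    B-suc : ∀ n → B (suc n) ≡ - (recip (fromℕ (suc (suc n))) * ∑ 0 (suc n) (λ j → fromℕ (suc (suc n) C j) * B j))
    B-suc n = trans
      (trans (cong (nthOr (bernList (suc n))) (sym (length-bernList n))) (nthOr-++-length (bernList n) _))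
      (cong (λ x → - (recip (fromℕ (suc (suc n))) * x)) (begin
        sumL (zipWith f (upTo (suc n)) (bernList n))
          ≡⟨ cong (λ m → sumL (zipWith f (upTo m) (bernList n))) (length-bernList n) ⟨
        sumL (zipWith f (upTo (length (bernList n))) (bernList n))
          ≡⟨ sumL-zipWith f id (bernList n) ⟩
        ∑ 0 (length (bernList n)) (λ j → f j (nthOr (bernList n) j))
          ≡⟨ cong (λ m → ∑ 0 m (λ j → f j (nthOr (bernList n) j))) (length-bernList n) ⟩
        ∑ 0 (suc n) (λ j → f j (nthOr (bernList n) j))
          ≡⟨ ∑-cong 0 (suc n) (λ j _ j< → cong (f j) (nthOr-bernList n j (ℕₚ.≤-pred j<))) ⟩
        ∑ 0 (suc n) (λ j → f j (B j)) ∎))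
      where
      f : ℕ → ℚ → ℚ
      f j b = fromℕ (suc (suc n) C j) * b

  B-sum : ∀ n → ∑ 0 (suc (suc n)) (λ j → fromℕ (suc (suc n) C j) * B j) ≡ 0ℚ
  B-sum n = begin
    ∑ 0 (suc (suc n)) (λ j → fromℕ (suc (suc n) C j) * B j)
      ≡⟨ ∑-last 0 (suc n) (λ j → fromℕ (suc (suc n) C j) * B j) ⟩
    σ + fromℕ (suc (suc n) C suc n) * B (suc n)
      ≡⟨ cong₂ (λ x y → σ + fromℕ x * y) choose (B-suc n) ⟩
    σ + a * (- (recip a * σ))
      ≡⟨ regroup σ a (recip a) ⟩
    σ - a * recip a * σ
      ≡⟨ cong (λ x → σ - x * σ) (*-recip (suc n)) ⟩
    σ - 1ℚ * σ
      ≡⟨ cancel σ ⟩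
    0ℚ ∎
    where
    a = fromℕ (suc (suc n))
    σ = ∑ 0 (suc n) (λ j → fromℕ (suc (suc n) C j) * B j)
    choose : suc (suc n) C suc n ≡ suc (suc n)
    choose = trans (nCk≡nC[n∸k] {suc n} {suc (suc n)} (ℕₚ.n≤1+n (suc n)))
      (trans (cong (suc (suc n) C_) (ℕₚ.m+n∸n≡m 1 (suc n))) (nC1≡n (suc (suc n))))
    opaque
      unfolding _+_
      regroup : ∀ s a b → s + a * (- (b * s)) ≡ s - a * b * s
      regroup = solve-∀ ℚ-ring
      cancel : ∀ s → s - 1ℚ * s ≡ 0ℚ
      cancel = solve-∀ ℚ-ring

  -- The recursion of the Bernoulli numbers as B e^x = B + x, read in degree n + 1; there `𝟙 n` is
  -- the coefficient of x.
  B⊛exp : ∀ n → (B ⊛ exp 1ℚ) (suc n) ≡ B (suc n) + 𝟙 n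
  B⊛exp n = trans (⊛-binomial B (exp 1ℚ) (suc n)) (trans
    (∑-cong′ 0 (suc (suc n)) (λ k → cong (fromℕ (suc n C k) *_) (trans (cong (B k *_) (1^n≡1 (suc n ∸ k))) (Q.*-identityʳ (B k)))))
    (trans (∑-last 0 (suc n) (λ k → fromℕ (suc n C k) * B k))
      (trans (cong₂ _+_ (lower n) (trans (cong (λ c → fromℕ c * B (suc n)) (nCn≡1 (suc n))) (fromℕ1-* (B (suc n))))) (Q.+-comm (𝟙 n) (B (suc n))))))
    where
    lower : ∀ n → ∑ 0 (suc n) (λ k → fromℕ (suc n C k) * B k) ≡ 𝟙 n
    lower zero = trans (Q.+-identityʳ _) (trans (fromℕ1-* (B 0)) B-0)
    lower (suc n) = B-sum n

  X⊛expm1/X≗ : X ⊛ expm1/X ≗ exp 1ℚ ⊕ ⊖ 𝟙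
  X⊛expm1/X≗ k = trans (sym (Q.⁻¹-involutive ((X ⊛ expm1/X) k))) (trans (cong -_ (sym (1-exp k))) (flip (𝟙 k) (exp 1ℚ k)))
    where
    opaque
      unfolding _+_
      flip : ∀ x y → - (x - y) ≡ y - x
      flip = solve-∀ ℚ-ring

  -- After multiplication by x this is B (e^x - 1) = x. Dividing by x again means cancelling n + 1
  -- in degree n.
  B⊛expm1/X : B ⊛ expm1/X ≗ 𝟙
  B⊛expm1/X n = cancel-ℕ n (begin
    fromℕ (suc n) * (B ⊛ expm1/X) n            ≡⟨ X-⊛-suc (B ⊛ expm1/X) n ⟨
    (X ⊛ (B ⊛ expm1/X)) (suc n)                ≡⟨ S.solve 3 (λ x b e → x :* (b :* e) := b :* (x :* e)) (λ _ → refl) X B expm1/X (suc n) ⟩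
    (B ⊛ (X ⊛ expm1/X)) (suc n)                ≡⟨ ⊛-cong {B} (λ _ → refl) X⊛expm1/X≗ (suc n) ⟩
    (B ⊛ (exp 1ℚ ⊕ ⊖ 𝟙)) (suc n)               ≡⟨ ⊛-distribˡ B (exp 1ℚ) (⊖ 𝟙) (suc n) ⟩
    (B ⊛ exp 1ℚ) (suc n) + (B ⊛ ⊖ 𝟙) (suc n)   ≡⟨ cong₂ _+_ (B⊛exp n) (trans (sym (S.-‿distribʳ-* B 𝟙 (suc n))) (cong -_ (⊛-identityʳ B (suc n)))) ⟩
    B (suc n) + 𝟙 n - B (suc n)                ≡⟨ cancel (B (suc n)) (𝟙 n) ⟩
    𝟙 n                                        ≡⟨ scaled n ⟩
    fromℕ (suc n) * 𝟙 n                        ∎)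
    where
    open S using (_:*_; _:=_)
    opaque
      unfolding _+_
      cancel : ∀ x y → x + y - x ≡ y
      cancel = solve-∀ ℚ-ring
    scaled : ∀ n → 𝟙 n ≡ fromℕ (suc n) * 𝟙 n
    scaled zero = sym (fromℕ1-* 1ℚ)
    scaled (suc n) = sym (Q.zeroʳ (fromℕ (suc (suc n))))

  -- For E = (e^x - 1)/x one has x E' = e^x - E, so x E'/E = B e^x - 1 = B + x - 1. This yields the
  -- logarithmic derivative of E.
  B⊛D-expm1/X : ∀ k → fromℕ (suc k) * (B ⊛ D expm1/X) k ≡ B (suc k) + 𝟙 k
  B⊛D-expm1/X k = begin
    fromℕ (suc k) * (B ⊛ D expm1/X) k                   ≡⟨ X-⊛-suc (B ⊛ D expm1/X) k ⟨
    (X ⊛ (B ⊛ D expm1/X)) (suc k)                       ≡⟨ S.solve 3 (λ x b e → x :* (b :* e) := b :* (x :* e)) (λ _ → refl) X B (D expm1/X) (suc k) ⟩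
    (B ⊛ (X ⊛ D expm1/X)) (suc k)                       ≡⟨ ⊛-cong {B} (λ _ → refl) derivative (suc k) ⟩
    (B ⊛ (exp 1ℚ ⊕ ⊖ expm1/X)) (suc k)                  ≡⟨ ⊛-distribˡ B (exp 1ℚ) (⊖ expm1/X) (suc k) ⟩
    (B ⊛ exp 1ℚ) (suc k) + (B ⊛ ⊖ expm1/X) (suc k)      ≡⟨ cong₂ _+_ (B⊛exp k) (trans (sym (S.-‿distribʳ-* B expm1/X (suc k))) (cong -_ (B⊛expm1/X (suc k)))) ⟩
    B (suc k) + 𝟙 k + - 0ℚ                              ≡⟨ tidy _ ⟩
    B (suc k) + 𝟙 k                                     ∎
    where
    open S using (_:*_; _:=_)
    opaque
      unfolding _+_
      tidy : ∀ x → x + - 0ℚ ≡ x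
      tidy = solve-∀ ℚ-ring
      solve-for : ∀ a b → a + b - a ≡ b
      solve-for = solve-∀ ℚ-ring
      one-zero : ∀ x → 1ℚ * x + - 0ℚ ≡ x
      one-zero = solve-∀ ℚ-ring
    derivative : X ⊛ D expm1/X ≗ exp 1ℚ ⊕ ⊖ expm1/X
    derivative j = begin
      (X ⊛ D expm1/X) j
        ≡⟨ solve-for (expm1/X j) _ ⟨
      expm1/X j + (X ⊛ D expm1/X) j - expm1/X j
        ≡⟨ cong (λ x → x + (X ⊛ D expm1/X) j - expm1/X j) (⊛-identityˡ expm1/X j) ⟨
      (X ⊛ expm1/X) (suc j) - expm1/X j
        ≡⟨ cong (_- expm1/X j) (X⊛expm1/X≗ (suc j)) ⟩
      exp 1ℚ (suc j) + - 0ℚ - expm1/X j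
        ≡⟨ cong (_- expm1/X j) (one-zero (exp 1ℚ j)) ⟩
      exp 1ℚ j - expm1/X j ∎

  -- log((e^x - 1)/x) without its linear term x/2
  bernLog : Series
  bernLog zero = 0ℚ
  bernLog (suc zero) = 0ℚ
  bernLog k@(suc (suc _)) = B k * recip (fromℕ k)

  B⊛D-expm1/X-suc : ∀ k → (B ⊛ D expm1/X) (suc k) ≡ D bernLog (suc k)
  B⊛D-expm1/X-suc k = cancel-ℕ (suc k) (begin
    a * (B ⊛ D expm1/X) (suc k)        ≡⟨ B⊛D-expm1/X (suc k) ⟩
    B (suc (suc k)) + 0ℚ               ≡⟨ Q.+-identityʳ _ ⟩
    B (suc (suc k))                    ≡⟨ Q.*-identityˡ _ ⟨
    1ℚ * B (suc (suc k))               ≡⟨ cong (_* B (suc (suc k))) (*-recip (suc k)) ⟨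
    a * recip a * B (suc (suc k))      ≡⟨ regroup a (recip a) (B (suc (suc k))) ⟩
    a * (B (suc (suc k)) * recip a)    ∎)
    where
    a = fromℕ (suc (suc k))
    opaque
      unfolding _+_
      regroup : ∀ a b c → a * b * c ≡ a * (c * b)
      regroup = solve-∀ ℚ-ring

  -- The Bernoulli sums of the theorem as coefficients of power series

  opaque
    unfolding _+_

    BP-series : ∀ q t → (λ k → BP q k t) ≗ (B S.^ q) ⊛ exp t
    BP-series zero t k = trans (^ℚ≡^ t k) (sym (⊛-identityˡ (exp t) k))
    BP-series (suc q) t k = begin
      BP (suc q) k t
        ≡⟨ sumCount≡∑ 0 (suc k) (λ j → fromℕ (k C j) * B j * BP q (k ∸ j) t) ⟩
      ∑ 0 (suc k) (λ j → fromℕ (k C j) * B j * BP q (k ∸ j) t)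
        ≡⟨ ∑-cong′ 0 (suc k) (λ j → Q.*-assoc (fromℕ (k C j)) (B j) (BP q (k ∸ j) t)) ⟩
      ∑ 0 (suc k) (λ j → fromℕ (k C j) * (B j * BP q (k ∸ j) t))
        ≡⟨ ⊛-binomial B (λ i → BP q i t) k ⟨
      (B ⊛ (λ i → BP q i t)) k
        ≡⟨ ⊛-cong {B} (λ _ → refl) (BP-series q t) k ⟩
      (B ⊛ (B S.^ q ⊛ exp t)) k
        ≡⟨ ⊛-assoc B (B S.^ q) (exp t) k ⟨
      ((B ⊛ B S.^ q) ⊛ exp t) k ∎

  choose-factorial : ∀ k j → fromℕ ((k ℕ.+ j) C k) * (fromℕ (k !) * fromℕ (j !)) ≡ fromℕ ((k ℕ.+ j) !)
  choose-factorial k j = trans (cong (fromℕ ((k ℕ.+ j) C k) *_) (sym (fromℕ-* (k !) (j !))))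
    (trans (sym (fromℕ-* ((k ℕ.+ j) C k) (k ! ℕ.* j !))) (cong fromℕ
      (subst (λ i → ((k ℕ.+ j) C k) ℕ.* (k ! ℕ.* i !) ≡ (k ℕ.+ j) !) (ℕₚ.m+n∸m≡n k j) (exact k (k ℕ.+ j) (ℕₚ.m≤m+n k j)))))
    where
    exact : ∀ k n → k ℕ.≤ n → (n C k) ℕ.* (k ! ℕ.* (n ∸ k) !) ≡ n !
    exact k n k≤n = trans (cong (ℕ._* (k ! ℕ.* (n ∸ k) !)) (nCk≡n!/k![n-k]! k≤n))
      (ℕᵐ.m/n*n≡m {{k ℕₚ.!* (n ∸ k) !≢0}} (k![n∸k]!∣n! k≤n))

  ∑-from-2 : ∀ n f → f 0 ≡ 0ℚ → f 1 ≡ 0ℚ → ∑ 2 (suc n ∸ 2) f ≡ ∑ 0 (suc n) f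
  ∑-from-2 zero f f0 f1 = sym (trans (Q.+-identityʳ (f 0)) f0)
  ∑-from-2 (suc zero) f f0 f1 = sym (trans (cong₂ (λ x y → x + (y + 0ℚ)) f0 f1) (trans (Q.+-identityˡ _) (Q.+-identityˡ 0ℚ)))
  ∑-from-2 (suc (suc n)) f f0 f1 = sym (trans (cong₂ (λ x y → x + (y + ∑ 2 (suc n) f)) f0 f1) (trans (Q.+-identityˡ _) (Q.+-identityˡ _)))

  -- `bernLog` vanishes in degrees 0 and 1, so the sum from 2 is the whole binomial convolution. For
  -- n < 2 the count `suc n ∸ 2` is zero and the sum is empty.
  bernLog-sum : ∀ n g → ∑ 2 (suc n ∸ 2) (λ k → fromℕ (n C k) * (B k * recip (fromℕ k)) * g (n ∸ k)) ≡ (bernLog ⊛ g) n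
  bernLog-sum n g = begin
    ∑ 2 (suc n ∸ 2) (λ k → fromℕ (n C k) * (B k * recip (fromℕ k)) * g (n ∸ k))
      ≡⟨ ∑-cong 2 (suc n ∸ 2) (λ { (suc (suc k)) _ _ → Q.*-assoc _ _ _ ; (suc zero) (s≤s ()) _ ; zero () _ }) ⟩
    ∑ 2 (suc n ∸ 2) (λ k → fromℕ (n C k) * (bernLog k * g (n ∸ k)))
      ≡⟨ ∑-from-2 n _ (vanish 0 refl) (vanish 1 refl) ⟩
    ∑ 0 (suc n) (λ k → fromℕ (n C k) * (bernLog k * g (n ∸ k)))
      ≡⟨ ⊛-binomial bernLog g n ⟨
    (bernLog ⊛ g) n ∎
    where
    vanish : ∀ k → bernLog k ≡ 0ℚ → fromℕ (n C k) * (bernLog k * g (n ∸ k)) ≡ 0ℚ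
    vanish k eq = trans (cong (λ x → fromℕ (n C k) * (x * g (n ∸ k))) eq) (trans (cong (fromℕ (n C k) *_) (Q.zeroˡ _)) (Q.zeroʳ _))

  -- Here and in `secondExpression`, `nu` stands for n^*, `nl` for n_* and `q` for the residue of -n
  -- modulo p. They are independent arguments because the two sums are compared for every `q` and
  -- all `nu`, `nl` with sum p - 1.
  firstExpression : ℕ → ℕ → ℤ → ℚ
  firstExpression nu q r = ((ℚ.- 1ℚ) ^ℚ nu) ℚ.* inv (ℕ→ℚ (nu !)) ℚ.*
    Σ[ 2 ≤k≤ nu ] (λ k → ℕ→ℚ (nu C k) ℚ.* (B k ℚ.* inv (ℕ→ℚ k)) ℚ.* BP q (nu ∸ k) (ℚ.- ℤ→ℚ r))

  secondExpression : ℕ → ℕ → ℕ → ℤ → ℚ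
  secondExpression nu nl q r = ((ℚ.- 1ℚ) ^ℚ (nl ∸ 1)) ℚ.* ℕ→ℚ (nl !) ℚ.*
    Σ[ 2 ≤k≤ nu ] (λ k → ℕ→ℚ ((nl ℕ.+ k) C nl) ℚ.* (ℤ→ℚ r ^ℚ (nu ∸ k))
      ℚ.* Σ[ 2 ≤k≤ k ] (λ j → ℕ→ℚ (k C j) ℚ.* (B j ℚ.* inv (ℕ→ℚ j)) ℚ.* Bo q (k ∸ j)))

  opaque
    unfolding _+_

    firstExpression≡ : ∀ nu q r → firstExpression nu q r ≡ (- 1ℚ) ^ nu * recip (fromℕ (nu !)) * W nu (bernLog ⊛ B S.^ q) r
    firstExpression≡ nu q r = cong₂ (λ x y → x * recip (fromℕ (nu !)) * y) (^ℚ≡^ (- 1ℚ) nu) (begin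
      sumCount 2 (suc nu ∸ 2) (λ k → fromℕ (nu C k) * (B k * recip (fromℕ k)) * BP q (nu ∸ k) (- fromℤ r))
        ≡⟨ sumCount≡∑ 2 (suc nu ∸ 2) (λ k → fromℕ (nu C k) * (B k * recip (fromℕ k)) * BP q (nu ∸ k) (- fromℤ r)) ⟩
      ∑ 2 (suc nu ∸ 2) (λ k → fromℕ (nu C k) * (B k * recip (fromℕ k)) * BP q (nu ∸ k) (- fromℤ r))
        ≡⟨ bernLog-sum nu (λ k → BP q k (- fromℤ r)) ⟩
      (bernLog ⊛ (λ k → BP q k (- fromℤ r))) nu
        ≡⟨ ⊛-cong {bernLog} (λ _ → refl) (BP-series q (- fromℤ r)) nu ⟩
      (bernLog ⊛ (B S.^ q ⊛ exp (- fromℤ r))) nu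
        ≡⟨ S.solve 3 (λ l b e → l :* (b :* e) := e :* (l :* b)) (λ _ → refl) bernLog (B S.^ q) (exp (- fromℤ r)) nu ⟩
      W nu (bernLog ⊛ B S.^ q) r ∎)
      where open S using (_:*_; _:=_)

    inner≡ : ∀ q k → Σ[ 2 ≤k≤ k ] (λ j → ℕ→ℚ (k C j) ℚ.* (B j ℚ.* inv (ℕ→ℚ j)) ℚ.* Bo q (k ∸ j)) ≡ (bernLog ⊛ B S.^ q) k
    inner≡ q k = begin
      sumCount 2 (suc k ∸ 2) (λ j → fromℕ (k C j) * (B j * recip (fromℕ j)) * Bo q (k ∸ j))
        ≡⟨ sumCount≡∑ 2 (suc k ∸ 2) (λ j → fromℕ (k C j) * (B j * recip (fromℕ j)) * Bo q (k ∸ j)) ⟩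
      ∑ 2 (suc k ∸ 2) (λ j → fromℕ (k C j) * (B j * recip (fromℕ j)) * Bo q (k ∸ j))
        ≡⟨ bernLog-sum k (Bo q) ⟩
      (bernLog ⊛ Bo q) k
        ≡⟨ ⊛-cong {bernLog} (λ _ → refl) (λ j → trans (BP-series q 0ℚ j) (trans (⊛-cong {B S.^ q} (λ _ → refl) exp-0 j) (⊛-identityʳ (B S.^ q) j))) k ⟩
      (bernLog ⊛ B S.^ q) k ∎

    secondExpression≡ : ∀ nu nl q r → secondExpression nu nl q r ≡
      (- 1ℚ) ^ (nl ∸ 1) * fromℕ (nl !) * ∑ 0 (suc nu) (λ k → fromℕ ((nl ℕ.+ k) C nl) * fromℤ r ^ (nu ∸ k) * (bernLog ⊛ B S.^ q) k)
    secondExpression≡ nu nl q r = cong₂ (λ x y → x * fromℕ (nl !) * y) (^ℚ≡^ (- 1ℚ) (nl ∸ 1)) (begin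
      sumCount 2 (suc nu ∸ 2) f
        ≡⟨ sumCount≡∑ 2 (suc nu ∸ 2) f ⟩
      ∑ 2 (suc nu ∸ 2) f
        ≡⟨ ∑-cong′ 2 (suc nu ∸ 2) (λ k → cong₂ (λ x y → fromℕ ((nl ℕ.+ k) C nl) * x * y) (^ℚ≡^ (fromℤ r) (nu ∸ k)) (inner≡ q k)) ⟩
      ∑ 2 (suc nu ∸ 2) (λ k → fromℕ ((nl ℕ.+ k) C nl) * fromℤ r ^ (nu ∸ k) * c k)
        ≡⟨ ∑-from-2 nu (λ k → fromℕ ((nl ℕ.+ k) C nl) * fromℤ r ^ (nu ∸ k) * c k) (vanish 0 c-0) (vanish 1 c-1) ⟩
      ∑ 0 (suc nu) (λ k → fromℕ ((nl ℕ.+ k) C nl) * fromℤ r ^ (nu ∸ k) * c k) ∎)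
      where
      c : Series
      c = bernLog ⊛ B S.^ q
      f : ℕ → ℚ
      f k = fromℕ ((nl ℕ.+ k) C nl) * (fromℤ r ^ℚ (nu ∸ k))
        * Σ[ 2 ≤k≤ k ] (λ j → ℕ→ℚ (k C j) ℚ.* (B j ℚ.* inv (ℕ→ℚ j)) ℚ.* Bo q (k ∸ j))
      c-0 : c 0 ≡ 0ℚ
      c-0 = Q.zeroˡ ((B S.^ q) 0)
      c-1 : c 1 ≡ 0ℚ
      c-1 = trans (cong₂ _+_ (Q.zeroˡ ((B S.^ q) 0)) (Q.zeroˡ ((B S.^ q) 1))) (Q.+-identityˡ 0ℚ)
      vanish : ∀ k → c k ≡ 0ℚ → fromℕ ((nl ℕ.+ k) C nl) * fromℤ r ^ (nu ∸ k) * c k ≡ 0ℚ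
      vanish k eq = trans (cong (fromℕ ((nl ℕ.+ k) C nl) * fromℤ r ^ (nu ∸ k) *_) eq) (Q.zeroʳ (fromℕ ((nl ℕ.+ k) C nl) * fromℤ r ^ (nu ∸ k)))

  -- Rational numbers modulo p

  module Congruence (p : ℕ) (p-prime : Prime p) where

    -- Any denominator prime to p that clears `x` is accepted, not only the reduced one, so that for
    -- sums and products it suffices to multiply denominators.
    record Integral (x : ℚ) : Set where
      constructor integral
      field
        den      : ℕ
        num      : ℤ
        p∤den    : ¬ (p ℕᵈ.∣ den)
        clearing : fromℕ den * x ≡ fromℤ num

    1<p : 1 ℕ.< p
    1<p = ℕ.nonTrivial⇒n>1 p {{prime⇒nonTrivial p-prime}}

    0<p : 0 ℕ.< p
    0<p = ℕₚ.<⇒≤ 1<p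

    p∤small : ∀ {k} → suc k ℕ.< p → ¬ (p ℕᵈ.∣ suc k)
    p∤small lt = ℕᵈ.>⇒∤ lt

    integral-ℤ : ∀ z → Integral (fromℤ z)
    integral-ℤ z = integral 1 z (ℕᵈ.>⇒∤ 1<p) (trans (cong (_* fromℤ z) fromℤ-1) (Q.*-identityˡ _))

    integral-ℕ : ∀ n → Integral (fromℕ n)
    integral-ℕ n = integral-ℤ (pos n)

    integral-inv : ∀ {k} → suc k ℕ.< p → Integral (recip (fromℕ (suc k)))
    integral-inv {k} lt = integral (suc k) (pos 1) (p∤small lt) (trans (*-recip k) (sym fromℤ-1))

    p∤product : ∀ {m n} → ¬ (p ℕᵈ.∣ m) → ¬ (p ℕᵈ.∣ n) → ¬ (p ℕᵈ.∣ m ℕ.* n)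
    p∤product {m} {n} p∤m p∤n = [ p∤m , p∤n ]′ ∘ euclidsLemma m n p-prime

    integral-+ : ∀ {x y} → Integral x → Integral y → Integral (x + y)
    integral-+ {x} {y} (integral d z p∤d eq) (integral d′ z′ p∤d′ eq′) =
      integral (d ℕ.* d′) (pos d′ ℤ.* z ℤ.+ pos d ℤ.* z′) (p∤product p∤d p∤d′) (begin
        fromℕ (d ℕ.* d′) * (x + y)                               ≡⟨ cong (_* (x + y)) (fromℕ-* d d′) ⟩
        fromℕ d * fromℕ d′ * (x + y)                               ≡⟨ regroup (fromℕ d) (fromℕ d′) x y ⟩
        fromℕ d′ * (fromℕ d * x) + fromℕ d * (fromℕ d′ * y)            ≡⟨ cong₂ (λ a b → fromℕ d′ * a + fromℕ d * b) eq eq′ ⟩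
        fromℕ d′ * fromℤ z + fromℕ d * fromℤ z′                        ≡⟨ cong₂ _+_ (fromℤ-* (pos d′) z) (fromℤ-* (pos d) z′) ⟨
        fromℤ (pos d′ ℤ.* z) + fromℤ (pos d ℤ.* z′)                ≡⟨ fromℤ-+ (pos d′ ℤ.* z) (pos d ℤ.* z′) ⟨
        fromℤ (pos d′ ℤ.* z ℤ.+ pos d ℤ.* z′)                    ∎)
      where
      opaque
        unfolding _+_
        regroup : ∀ a b x y → a * b * (x + y) ≡ b * (a * x) + a * (b * y)
        regroup = solve-∀ ℚ-ring

    integral-* : ∀ {x y} → Integral x → Integral y → Integral (x * y)
    integral-* {x} {y} (integral d z p∤d eq) (integral d′ z′ p∤d′ eq′) =
      integral (d ℕ.* d′) (z ℤ.* z′) (p∤product p∤d p∤d′) (begin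
        fromℕ (d ℕ.* d′) * (x * y)          ≡⟨ cong (_* (x * y)) (fromℕ-* d d′) ⟩
        fromℕ d * fromℕ d′ * (x * y)          ≡⟨ regroup (fromℕ d) (fromℕ d′) x y ⟩
        (fromℕ d * x) * (fromℕ d′ * y)        ≡⟨ cong₂ _*_ eq eq′ ⟩
        fromℤ z * fromℤ z′                    ≡⟨ fromℤ-* z z′ ⟨
        fromℤ (z ℤ.* z′)                    ∎)
      where
      opaque
        unfolding _+_
        regroup : ∀ a b x y → a * b * (x * y) ≡ (a * x) * (b * y)
        regroup = solve-∀ ℚ-ring

    integral-0 : Integral 0ℚ
    integral-0 = subst Integral fromℤ-0 (integral-ℕ 0)

    integral-1 : Integral 1ℚ
    integral-1 = subst Integral fromℤ-1 (integral-ℕ 1)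

    integral-neg : ∀ {x} → Integral x → Integral (- x)
    integral-neg {x} ix = subst Integral (Q.-1*x≈-x x) (integral-* (subst Integral (trans (fromℤ-neg (pos 1)) (cong -_ fromℤ-1)) (integral-ℤ (ℤ.- pos 1))) ix)

    integral-- : ∀ {x y} → Integral x → Integral y → Integral (x - y)
    integral-- ix iy = integral-+ ix (integral-neg iy)

    integral-^ : ∀ {x} n → Integral x → Integral (x ^ n)
    integral-^ zero ix = integral-1
    integral-^ (suc n) ix = integral-* ix (integral-^ n ix)

    integral-sum : ∀ lo n {f} → (∀ k → lo ℕ.≤ k → k ℕ.< lo ℕ.+ n → Integral (f k)) → Integral (∑ lo n f)
    integral-sum lo zero h = integral-0
    integral-sum lo (suc n) h = integral-+
      (h lo ℕₚ.≤-refl (subst (lo ℕ.<_) (sym (ℕₚ.+-suc lo n)) (s≤s (ℕₚ.m≤m+n lo n))))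
      (integral-sum (suc lo) n (λ k lo≤k k< → h k (ℕₚ.<⇒≤ lo≤k) (subst (k ℕ.<_) (sym (ℕₚ.+-suc lo n)) k<)))

    -- The reduced denominator b divides every clearing denominator d: from a/b = z/d follows d a =
    -- b z, and b is coprime to a.
    integral⇒p∤↧ : ∀ {x} → Integral x → ¬ (p ℕᵈ.∣ ↧ₙ x)
    integral⇒p∤↧ {x@(mkℚ a b-1 coprime)} (integral d z p∤d eq) p∣b = p∤d (ℕᵈ.∣-trans p∣b b∣d)
      where
      b = suc b-1
      opaque
        unfolding _+_
        x-clearing : fromℕ b * x ≡ fromℤ a
        x-clearing = ℚₚ.toℚᵘ-injective (ℚᵘₚ.≃-trans (ℚₚ.toℚᵘ-homo-* (ℕ→ℚ b) x)
          (subst₂ (λ s t → toℚᵘ s ℚᵘ.* toℚᵘ x ℚᵘ.≃ toℚᵘ t) (sym (ℤ→ℚ≡literal (pos b))) (sym (ℤ→ℚ≡literal a))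
            (ℚᵘ.*≡* (swap₁ (pos b) a))))
          where
          swap₁ : ∀ b a → b ℤ.* a ℤ.* pos 1 ≡ a ℤ.* (pos 1 ℤ.* b)
          swap₁ = solve-∀ ℤ-ring
      da≡bz : pos d ℤ.* a ≡ pos b ℤ.* z
      da≡bz = fromℤ-injective (begin
        fromℤ (pos d ℤ.* a)     ≡⟨ fromℤ-* (pos d) a ⟩
        fromℕ d * fromℤ a         ≡⟨ cong (fromℕ d *_) x-clearing ⟨
        fromℕ d * (fromℕ b * x)   ≡⟨ Q.x*yz≡y*xz (fromℕ d) (fromℕ b) x ⟩
        fromℕ b * (fromℕ d * x)   ≡⟨ cong (fromℕ b *_) eq ⟩
        fromℕ b * fromℤ z         ≡⟨ fromℤ-* (pos b) z ⟨
        fromℤ (pos b ℤ.* z)     ∎)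
      b∣d : b ℕᵈ.∣ d
      b∣d = coprime-divisor (Coprime.sym (Coprime.recompute coprime)) (ℕᵈ.divides ℤ.∣ z ∣ (begin
        ℤ.∣ a ∣ ℕ.* d               ≡⟨ ℕₚ.*-comm ℤ.∣ a ∣ d ⟩
        d ℕ.* ℤ.∣ a ∣               ≡⟨ ℤₚ.∣i*j∣≡∣i∣*∣j∣ (pos d) a ⟨
        ℤ.∣ pos d ℤ.* a ∣           ≡⟨ cong ℤ.∣_∣ da≡bz ⟩
        ℤ.∣ pos b ℤ.* z ∣           ≡⟨ ℤₚ.∣i*j∣≡∣i∣*∣j∣ (pos b) z ⟩
        b ℕ.* ℤ.∣ z ∣               ≡⟨ ℕₚ.*-comm b ℤ.∣ z ∣ ⟩
        ℤ.∣ z ∣ ℕ.* b               ∎))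

    p⁻¹ : ℚ
    p⁻¹ = recip (fromℕ p)

    p*p⁻¹ : fromℕ p * p⁻¹ ≡ 1ℚ
    p*p⁻¹ = recip-inverse _ (λ eq → ℕₚ.<⇒≢ 0<p (sym (fromℕ-injective {p} {0} (trans eq (sym fromℤ-0)))))

    infix 4 _≋_
    record _≋_ (x y : ℚ) : Set where
      constructor congruent
      field
        quotient : Integral ((x - y) * p⁻¹)
    open _≋_ public

    ≡⇒≋ : ∀ {x y} → x ≡ y → x ≋ y
    ≡⇒≋ {x} refl = congruent (subst Integral (sym (vanish x p⁻¹)) integral-0)
      where
      opaque
        unfolding _+_
        vanish : ∀ x q → (x - x) * q ≡ 0ℚ
        vanish = solve-∀ ℚ-ring

    ≋-refl : ∀ {x} → x ≋ x
    ≋-refl = ≡⇒≋ refl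

    ≋-sym : ∀ {x y} → x ≋ y → y ≋ x
    ≋-sym {x} {y} (congruent i) = congruent (subst Integral (flip x y p⁻¹) (integral-neg i))
      where
      opaque
        unfolding _+_
        flip : ∀ x y q → - ((x - y) * q) ≡ (y - x) * q
        flip = solve-∀ ℚ-ring

    ≋-trans : ∀ {x y z} → x ≋ y → y ≋ z → x ≋ z
    ≋-trans {x} {y} {z} (congruent i) (congruent j) = congruent (subst Integral (telescope x y z p⁻¹) (integral-+ i j))
      where
      opaque
        unfolding _+_
        telescope : ∀ x y z q → (x - y) * q + (y - z) * q ≡ (x - z) * q
        telescope = solve-∀ ℚ-ring

    ≋-+ : ∀ {x y z w} → x ≋ y → z ≋ w → x + z ≋ y + w
    ≋-+ {x} {y} {z} {w} (congruent i) (congruent j) = congruent (subst Integral (regroup x y z w p⁻¹) (integral-+ i j))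
      where
      opaque
        unfolding _+_
        regroup : ∀ x y z w q → (x - y) * q + (z - w) * q ≡ (x + z - (y + w)) * q
        regroup = solve-∀ ℚ-ring

    ≋-neg : ∀ {x y} → x ≋ y → - x ≋ - y
    ≋-neg {x} {y} (congruent i) = congruent (subst Integral (regroup x y p⁻¹) (integral-neg i))
      where
      opaque
        unfolding _+_
        regroup : ∀ x y q → - ((x - y) * q) ≡ (- x - - y) * q
        regroup = solve-∀ ℚ-ring

    ≋-*ˡ : ∀ {a x y} → Integral a → x ≋ y → a * x ≋ a * y
    ≋-*ˡ {a} {x} {y} ia (congruent i) = congruent (subst Integral (regroup a x y p⁻¹) (integral-* ia i))
      where
      opaque
        unfolding _+_
        regroup : ∀ a x y q → a * ((x - y) * q) ≡ (a * x - a * y) * q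
        regroup = solve-∀ ℚ-ring

    ≋-*ʳ : ∀ {a x y} → Integral a → x ≋ y → x * a ≋ y * a
    ≋-*ʳ {a} {x} {y} ia e = subst₂ _≋_ (Q.*-comm a x) (Q.*-comm a y) (≋-*ˡ ia e)

    ≋-* : ∀ {x y z w} → Integral y → Integral z → x ≋ y → z ≋ w → x * z ≋ y * w
    ≋-* iy iz e f = ≋-trans (≋-*ʳ iz e) (≋-*ˡ iy f)

    p*≋0 : ∀ {x} → Integral x → fromℕ p * x ≋ 0ℚ
    p*≋0 {x} ix = congruent (subst Integral (begin
      x                              ≡⟨ Q.*-identityˡ x ⟨
      1ℚ * x                         ≡⟨ cong (_* x) p*p⁻¹ ⟨
      fromℕ p * p⁻¹ * x                ≡⟨ regroup (fromℕ p) p⁻¹ x ⟩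
      (fromℕ p * x - 0ℚ) * p⁻¹         ∎) ix)
      where
      opaque
        unfolding _+_
        regroup : ∀ a b x → a * b * x ≡ (a * x - 0ℚ) * b
        regroup = solve-∀ ℚ-ring

    p*+≋ : ∀ {x y} → Integral x → y + fromℕ p * x ≋ y
    p*+≋ {x} {y} ix = subst (y + fromℕ p * x ≋_) (Q.+-identityʳ y) (≋-+ ≋-refl (p*≋0 ix))

    ≋⇒p*+ : ∀ {x y} → x ≋ y → x ≡ y + fromℕ p * ((x - y) * p⁻¹)
    ≋⇒p*+ {x} {y} _ = begin
      x                                  ≡⟨ split x y ⟩
      y + 1ℚ * (x - y)                   ≡⟨ cong (λ e → y + e * (x - y)) p*p⁻¹ ⟨
      y + fromℕ p * p⁻¹ * (x - y)          ≡⟨ regroup x y (fromℕ p) p⁻¹ ⟩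
      y + fromℕ p * ((x - y) * p⁻¹)        ∎
      where
      opaque
        unfolding _+_
        split : ∀ x y → x ≡ y + 1ℚ * (x - y)
        split = solve-∀ ℚ-ring
      opaque
        unfolding _+_
        regroup : ∀ x y a b → y + a * b * (x - y) ≡ y + a * ((x - y) * b)
        regroup = solve-∀ ℚ-ring

    ≋-integral : ∀ {x y} → x ≋ y → Integral y → Integral x
    ≋-integral e iy = subst Integral (sym (≋⇒p*+ e)) (integral-+ iy (integral-* (integral-ℕ p) (quotient e)))

    ≋-cancelˡ : ∀ {a b x y} → Integral b → b * a ≡ 1ℚ → a * x ≋ a * y → x ≋ y
    ≋-cancelˡ {a} {b} {x} {y} ib ba e = subst₂ _≋_ (undo x) (undo y) (≋-*ˡ ib e)
      where
      undo : ∀ z → b * (a * z) ≡ z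
      undo z = trans (sym (Q.*-assoc b a z)) (trans (cong (_* z) ba) (Q.*-identityˡ z))

    ≋-cancel-ℕ : ∀ {k x y} → suc k ℕ.< p → fromℕ (suc k) * x ≋ fromℕ (suc k) * y → x ≋ y
    ≋-cancel-ℕ {k} lt = ≋-cancelˡ (integral-inv lt) (trans (Q.*-comm _ _) (*-recip k))

    ≋-sum : ∀ lo n {f g} → (∀ k → lo ℕ.≤ k → k ℕ.< lo ℕ.+ n → f k ≋ g k) → ∑ lo n f ≋ ∑ lo n g
    ≋-sum lo zero h = ≋-refl
    ≋-sum lo (suc n) h = ≋-+
      (h lo ℕₚ.≤-refl (subst (lo ℕ.<_) (sym (ℕₚ.+-suc lo n)) (s≤s (ℕₚ.m≤m+n lo n))))
      (≋-sum (suc lo) n (λ k lo≤k k< → h k (ℕₚ.<⇒≤ lo≤k) (subst (k ℕ.<_) (sym (ℕₚ.+-suc lo n)) k<)))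

    opaque
      unfolding _+_
      ≋⇒≡[modℚ] : ∀ {x y} → x ≋ y → x ≡ y [modℚ p ]
      ≋⇒≡[modℚ] (congruent i) = integral⇒p∤↧ i

  -- Fleck quotients for an arbitrary prime p = h + 2

  module AnyPrime (h : ℕ) (p-prime : Prime (suc (suc h))) where

    open Congruence (suc (suc h)) p-prime

    -- In this form p - 1 is `suc h` and p - 2 is `h`, here and for odd primes below.
    p : ℕ
    p = suc (suc h)

    -- A condition on the expression, not on the operator. It guarantees that the action preserves
    -- p-integral functions and congruences between functions.
    data IntegralPoly : Poly → Set where
      con : ∀ {c} → Integral c → IntegralPoly (con c)
      ∇   : IntegralPoly ∇
      _⊞_ : ∀ {a b} → IntegralPoly a → IntegralPoly b → IntegralPoly (a ⊞ b)
      _⊠_ : ∀ {a b} → IntegralPoly a → IntegralPoly b → IntegralPoly (a ⊠ b)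

    act-integral : ∀ {a f} → IntegralPoly a → (∀ r → Integral (f r)) → ∀ r → Integral (act a f r)
    act-integral (con ic) if r = integral-* ic (if r)
    act-integral ∇ if r = integral-- (if r) (if (r ℤ.- pos 1))
    act-integral (ia ⊞ ib) if r = integral-+ (act-integral ia if r) (act-integral ib if r)
    act-integral (ia ⊠ ib) if r = act-integral ia (act-integral ib if) r

    act-≋ : ∀ {a f g} → IntegralPoly a → (∀ r → f r ≋ g r) → ∀ r → act a f r ≋ act a g r
    act-≋ (con ic) eq r = ≋-*ˡ ic (eq r)
    act-≋ ∇ eq r = ≋-+ (eq r) (≋-neg (eq (r ℤ.- pos 1)))
    act-≋ (ia ⊞ ib) eq r = ≋-+ (act-≋ ia eq r) (act-≋ ib eq r)
    act-≋ (ia ⊠ ib) eq r = act-≋ ia (act-≋ ib eq) r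

    ⊟-integral : ∀ {a} → IntegralPoly a → IntegralPoly (⊟ a)
    ⊟-integral ia = con (integral-neg integral-1) ⊠ ia

    ^-integral : ∀ {a} n → IntegralPoly a → IntegralPoly (a P.^ n)
    ^-integral zero ia = con integral-1
    ^-integral (suc n) ia = ia ⊠ ^-integral n ia

    ∑-poly-integral : ∀ {c x} lo n → (∀ k → k ℕ.< lo ℕ.+ n → Integral (c k)) → IntegralPoly x → IntegralPoly (∑-poly c lo n x)
    ∑-poly-integral lo zero ic ix = con integral-0
    ∑-poly-integral {c} lo (suc n) ic ix =
      (con (ic lo (subst (lo ℕ.<_) (sym (ℕₚ.+-suc lo n)) (s≤s (ℕₚ.m≤m+n lo n)))) ⊠ ^-integral lo ix)
      ⊞ ∑-poly-integral {c} (suc lo) n (λ k k< → ic k (subst (k ℕ.<_) (sym (ℕₚ.+-suc lo n)) k<)) ix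

    -- The binomial expansion of a p-th power

    frobeniusCoeff : ℕ → ℚ
    frobeniusCoeff k = fromℕ (p C suc k) * p⁻¹

    p*frobeniusCoeff : ∀ k → fromℕ p * frobeniusCoeff k ≡ fromℕ (p C suc k)
    p*frobeniusCoeff k = begin
      fromℕ p * (fromℕ (p C suc k) * p⁻¹)   ≡⟨ regroup (fromℕ p) (fromℕ (p C suc k)) p⁻¹ ⟩
      fromℕ p * p⁻¹ * fromℕ (p C suc k)     ≡⟨ cong (_* fromℕ (p C suc k)) p*p⁻¹ ⟩
      1ℚ * fromℕ (p C suc k)                ≡⟨ Q.*-identityˡ _ ⟩
      fromℕ (p C suc k)                     ∎
      where
      opaque
        unfolding _+_
        regroup : ∀ a b c → a * (b * c) ≡ a * c * b
        regroup = solve-∀ ℚ-ring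

    frobeniusCoeff-0 : frobeniusCoeff 0 ≡ 1ℚ
    frobeniusCoeff-0 = trans (cong (λ n → fromℕ n * p⁻¹) (nC1≡n p)) p*p⁻¹

    -- By (k + 1) C(p, k + 1) = p C(p - 1, k), the number k + 1 < p clears the denominator.
    frobeniusCoeff-integral : ∀ {k} → suc k ℕ.< p → Integral (frobeniusCoeff k)
    frobeniusCoeff-integral {k} k<p = integral (suc k) (pos (suc h C k)) (p∤small k<p) (begin
      fromℕ (suc k) * (fromℕ (p C suc k) * p⁻¹)   ≡⟨ Q.*-assoc (fromℕ (suc k)) (fromℕ (p C suc k)) p⁻¹ ⟨
      fromℕ (suc k) * fromℕ (p C suc k) * p⁻¹     ≡⟨ cong (_* p⁻¹) (choose-absorb-ℚ (suc h) k) ⟩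
      fromℕ p * fromℕ (suc h C k) * p⁻¹           ≡⟨ regroup (fromℕ p) (fromℕ (suc h C k)) p⁻¹ ⟩
      fromℕ p * p⁻¹ * fromℕ (suc h C k)           ≡⟨ cong (_* fromℕ (suc h C k)) p*p⁻¹ ⟩
      1ℚ * fromℕ (suc h C k)                      ≡⟨ Q.*-identityˡ _ ⟩
      fromℕ (suc h C k)                           ∎)
      where
      opaque
        unfolding _+_
        regroup : ∀ a b c → a * b * c ≡ a * c * b
        regroup = solve-∀ ℚ-ring

    -- ((1 + x)^p - 1 - x^p) / (p x)
    frobeniusPoly : Poly → Poly
    frobeniusPoly = ∑-poly frobeniusCoeff 0 (suc h)

    -- An exact identity, so p can later be divided out. It is applied to constants (Fermat's
    -- theorem), to -∇ (the relation behind `u`) and to ∇ u₁ = u - 1 (the power u^p).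
    frobenius : ∀ x → (con 1ℚ ⊞ x) P.^ p ≈ con 1ℚ ⊞ (x P.^ p ⊞ con (fromℕ p) ⊠ (x ⊠ frobeniusPoly x))
    frobenius x =
      (con 1ℚ ⊞ x) P.^ p
        ≈⟨ binomial x p ⟩
      ∑-poly (λ k → fromℕ (p C k)) 0 (suc p) x
        ≈⟨ ∑-poly-first (λ k → fromℕ (p C k)) p x ⟩
      con (fromℕ (p C 0)) ⊞ x ⊠ ∑-poly (λ k → fromℕ (p C suc k)) 0 p x
        ≈⟨ P.reflexive (cong (λ c → con c ⊞ x ⊠ ∑-poly (λ k → fromℕ (p C suc k)) 0 p x) fromℤ-1) ⟩
      con 1ℚ ⊞ x ⊠ ∑-poly (λ k → fromℕ (p C suc k)) 0 p x
        ≈⟨ P.+-congˡ (P.*-congˡ (∑-poly-last (λ k → fromℕ (p C suc k)) (suc h) x)) ⟩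
      con 1ℚ ⊞ x ⊠ (∑-poly (λ k → fromℕ (p C suc k)) 0 (suc h) x ⊞ con (fromℕ (p C p)) ⊠ x P.^ suc h)
        ≈⟨ P.reflexive (cong (λ c → con 1ℚ ⊞ x ⊠ (∑-poly (λ k → fromℕ (p C suc k)) 0 (suc h) x ⊞ con c ⊠ x P.^ suc h)) (trans (cong fromℕ (nCn≡1 p)) fromℤ-1)) ⟩
      con 1ℚ ⊞ x ⊠ (∑-poly (λ k → fromℕ (p C suc k)) 0 (suc h) x ⊞ con 1ℚ ⊠ x P.^ suc h)
        ≈⟨ P.+-congˡ (P.*-congˡ (P.+-cong
             (P.trans (∑-poly-cong 0 (suc h) x (λ k → sym (p*frobeniusCoeff k))) (∑-poly-* (fromℕ p) frobeniusCoeff 0 (suc h) x))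
             (P.*-identityˡ (x P.^ suc h)))) ⟩
      con 1ℚ ⊞ x ⊠ (con (fromℕ p) ⊠ frobeniusPoly x ⊞ x P.^ suc h)
        ≈⟨ P.+-congˡ (P.solve 4 (λ x c q y → x :* (c :* q :+ y) := x :* y :+ c :* (x :* q)) P.refl x (con (fromℕ p)) (frobeniusPoly x) (x P.^ suc h)) ⟩
      con 1ℚ ⊞ (x P.^ p ⊞ con (fromℕ p) ⊠ (x ⊠ frobeniusPoly x)) □
      where
      open P using (_:+_; _:*_; _:=_)

    frobeniusPoly-first : ∀ x → frobeniusPoly x ≈ con 1ℚ ⊞ x ⊠ ∑-poly (frobeniusCoeff ∘ suc) 0 h x
    frobeniusPoly-first x = P.trans (∑-poly-first frobeniusCoeff h x)
      (same-action λ f r → cong (λ c → c * f r + act (x ⊠ ∑-poly (frobeniusCoeff ∘ suc) 0 h x) f r) frobeniusCoeff-0)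

    frobeniusPoly-integral : ∀ {x} → IntegralPoly x → IntegralPoly (frobeniusPoly x)
    frobeniusPoly-integral = ∑-poly-integral 0 (suc h) (λ k k< → frobeniusCoeff-integral (s≤s k<))

    -- Fermat's little theorem

    act-con-^ : ∀ a n f r → act (con a P.^ n) f r ≡ a ^ n * f r
    act-con-^ a zero f r = refl
    act-con-^ a (suc n) f r = trans (cong (a *_) (act-con-^ a n f r)) (sym (Q.*-assoc a (a ^ n) (f r)))

    fermat-step : ∀ {a} → Integral a → (1ℚ + a) ^ p ≋ 1ℚ + a ^ p
    fermat-step {a} ia = subst₂ _≋_ (sym expand) refl (p*+≋ (integral-* ia (act-integral (frobeniusPoly-integral (con ia)) (λ _ → integral-1) (pos 0))))
      where
      -- `frobenius` for the constant polynomial `con a` becomes a statement on numbers when it acts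
      -- on the constant function 1.
      one : ℤ → ℚ
      one _ = 1ℚ
      z = act (frobeniusPoly (con a)) one (pos 0)
      merge : con (1ℚ + a) ≈ con 1ℚ ⊞ con a
      merge = same-action λ f r → Q.distribʳ (f r) 1ℚ a
      expand : (1ℚ + a) ^ p ≡ 1ℚ + a ^ p + fromℕ p * (a * z)
      expand = begin
        (1ℚ + a) ^ p                                     ≡⟨ Q.*-identityʳ _ ⟨
        (1ℚ + a) ^ p * 1ℚ                                ≡⟨ act-con-^ (1ℚ + a) p one (pos 0) ⟨
        act (con (1ℚ + a) P.^ p) one (pos 0)             ≡⟨ apply (P.^-congˡ p merge) one (pos 0) ⟩
        act ((con 1ℚ ⊞ con a) P.^ p) one (pos 0)         ≡⟨ apply (frobenius (con a)) one (pos 0) ⟩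
        1ℚ * 1ℚ + (act (con a P.^ p) one (pos 0) + fromℕ p * (a * z))
          ≡⟨ cong₂ (λ x y → x + (y + fromℕ p * (a * z))) (Q.*-identityˡ 1ℚ) (trans (act-con-^ a p one (pos 0)) (Q.*-identityʳ _)) ⟩
        1ℚ + (a ^ p + fromℕ p * (a * z))                 ≡⟨ Q.+-assoc 1ℚ (a ^ p) _ ⟨
        1ℚ + a ^ p + fromℕ p * (a * z)                   ∎

    fermat-ℕ : ∀ n → fromℕ n ^ p ≋ fromℕ n
    fermat-ℕ zero = ≡⇒≋ (trans (cong (_^ p) fromℤ-0) (trans (Q.zeroˡ _) (sym fromℤ-0)))
    fermat-ℕ (suc n) = subst (λ x → x ^ p ≋ x) (sym (fromℕ-suc n))
      (≋-trans (fermat-step (integral-ℕ n)) (≋-+ ≋-refl (fermat-ℕ n)))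

    ≋-^ : ∀ {x y} n → Integral x → Integral y → x ≋ y → x ^ n ≋ y ^ n
    ≋-^ zero ix iy eq = ≋-refl
    ≋-^ (suc n) ix iy eq = ≋-* iy (integral-^ n ix) eq (≋-^ n ix iy eq)

    fromℤ≋lnr : ∀ z → fromℤ z ≋ fromℕ (lnr z p)
    fromℤ≋lnr z = subst (_≋ fromℕ (lnr z p)) (sym (begin
      fromℤ z                                                      ≡⟨ cong fromℤ (lnr-division z {p} (s≤s z≤n)) ⟩
      fromℤ (pos (lnr z p) ℤ.+ floorDiv z p ℤ.* pos p)             ≡⟨ fromℤ-+ (pos (lnr z p)) (floorDiv z p ℤ.* pos p) ⟩
      fromℕ (lnr z p) + fromℤ (floorDiv z p ℤ.* pos p)             ≡⟨ cong (fromℕ (lnr z p) +_) (trans (fromℤ-* (floorDiv z p) (pos p)) (Q.*-comm _ _)) ⟩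
      fromℕ (lnr z p) + fromℕ p * fromℤ (floorDiv z p)             ∎)) (p*+≋ (integral-ℤ (floorDiv z p)))

    fermat : ∀ z → fromℤ z ^ p ≋ fromℤ z
    fermat z = ≋-trans (≋-^ p (integral-ℤ z) (integral-ℕ (lnr z p)) (fromℤ≋lnr z))
      (≋-trans (fermat-ℕ (lnr z p)) (≋-sym (fromℤ≋lnr z)))

    fermat-unit : ∀ z {b} → Integral b → b * fromℤ z ≋ 1ℚ → fromℤ z ^ suc h ≋ 1ℚ
    fermat-unit z {b} ib bz≋1 = ≋-trans (≋-sym left) (≋-trans (≋-*ˡ ib (fermat z)) bz≋1)
      where
      left : b * fromℤ z ^ p ≋ fromℤ z ^ suc h
      left = subst₂ _≋_ (Q.*-assoc b (fromℤ z) (fromℤ z ^ suc h)) (Q.*-identityˡ _)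
        (≋-*ʳ (integral-^ (suc h) (integral-ℤ z)) bz≋1)

    -- The alternating sums as differences of an indicator

    indicator : ℕ → ℤ → ℚ
    indicator k r = if does (lnr (pos k) p ℕ.≟ lnr r p) then 1ℚ else 0ℚ

    δ : ℤ → ℚ
    δ = indicator 0

    indicator-yes : ∀ k r → lnr (pos k) p ≡ lnr r p → indicator k r ≡ 1ℚ
    indicator-yes k r eq = cong (λ b → if b then 1ℚ else 0ℚ) (dec-true (lnr (pos k) p ℕ.≟ lnr r p) eq)

    indicator-no : ∀ k r → lnr (pos k) p ≢ lnr r p → indicator k r ≡ 0ℚ
    indicator-no k r neq = cong (λ b → if b then 1ℚ else 0ℚ) (dec-false (lnr (pos k) p ℕ.≟ lnr r p) neq)

    indicator-suc : ∀ k r → indicator (suc k) r ≡ indicator k (r ℤ.- pos 1)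
    indicator-suc k r with lnr (pos (suc k)) p ℕ.≟ lnr r p
    ... | yes eq = trans (indicator-yes (suc k) r eq) (sym (indicator-yes k (r ℤ.- pos 1) (lnr-cong {pos k} {r ℤ.- pos 1} {p} z (s≤s z≤n)
                     (shiftDown (pos k) r z (pos p) (lnr-≡⇒ {pos (suc k)} {r} (s≤s z≤n) eq)))))
      where
      z = floorDiv (pos (suc k)) p ℤ.- floorDiv r p
      shiftDown : ∀ k r z m → pos 1 ℤ.+ k ≡ r ℤ.+ z ℤ.* m → k ≡ (r ℤ.- pos 1) ℤ.+ z ℤ.* m
      shiftDown k r z m e = begin
        k                              ≡⟨ solve (k ∷ []) ℤ-ring ⟩
        (pos 1 ℤ.+ k) ℤ.- pos 1        ≡⟨ cong (ℤ._- pos 1) e ⟩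
        (r ℤ.+ z ℤ.* m) ℤ.- pos 1      ≡⟨ solve (r ∷ z ∷ m ∷ []) ℤ-ring ⟩
        (r ℤ.- pos 1) ℤ.+ z ℤ.* m      ∎
    ... | no neq = trans (indicator-no (suc k) r neq) (sym (indicator-no k (r ℤ.- pos 1) (λ eq → neq (lnr-cong {pos (suc k)} {r} {p} z (s≤s z≤n)
                     (shiftUp (pos k) r z (pos p) (lnr-≡⇒ {pos k} {r ℤ.- pos 1} (s≤s z≤n) eq))))))
      where
      z = floorDiv (pos k) p ℤ.- floorDiv (r ℤ.- pos 1) p
      shiftUp : ∀ k r z m → k ≡ (r ℤ.- pos 1) ℤ.+ z ℤ.* m → pos 1 ℤ.+ k ≡ r ℤ.+ z ℤ.* m
      shiftUp k r z m e = begin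
        pos 1 ℤ.+ k                              ≡⟨ cong (ℤ._+_ (pos 1)) e ⟩
        pos 1 ℤ.+ ((r ℤ.- pos 1) ℤ.+ z ℤ.* m)    ≡⟨ solve (r ∷ z ∷ m ∷ []) ℤ-ring ⟩
        r ℤ.+ z ℤ.* m                            ∎

    opaque
      unfolding _+_

      Cp≡∑ : ∀ n r → Cp p n r ≡ ∑ 0 (suc n) (λ k → fromℕ (n C k) * (indicator k r * (- 1ℚ) ^ k))
      Cp≡∑ n r = trans (sumCount≡∑ 0 (suc n) (λ k → if does (lnr (pos k) p ℕ.≟ lnr r p) then fromℕ (n C k) * ((- 1ℚ) ^ℚ k) else 0ℚ)) (∑-cong′ 0 (suc n) term)
        where
        term : ∀ k → (if does (lnr (pos k) p ℕ.≟ lnr r p) then fromℕ (n C k) * ((- 1ℚ) ^ℚ k) else 0ℚ)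
                     ≡ fromℕ (n C k) * (indicator k r * (- 1ℚ) ^ k)
        term k = select (does (lnr (pos k) p ℕ.≟ lnr r p))
          where
          select : ∀ b → (if b then fromℕ (n C k) * ((- 1ℚ) ^ℚ k) else 0ℚ)
                         ≡ fromℕ (n C k) * ((if b then 1ℚ else 0ℚ) * (- 1ℚ) ^ k)
          select true = cong (fromℕ (n C k) *_) (trans (^ℚ≡^ (- 1ℚ) k) (sym (Q.*-identityˡ ((- 1ℚ) ^ k))))
          select false = sym (trans (cong (fromℕ (n C k) *_) (Q.zeroˡ ((- 1ℚ) ^ k))) (Q.zeroʳ (fromℕ (n C k))))

    Cp-0 : ∀ r → Cp p 0 r ≡ δ r
    Cp-0 r = begin
      Cp p 0 r                                    ≡⟨ Cp≡∑ 0 r ⟩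
      fromℕ 1 * (δ r * 1ℚ) + 0ℚ                   ≡⟨ Q.+-identityʳ _ ⟩
      fromℕ 1 * (δ r * 1ℚ)                        ≡⟨ fromℕ1-* _ ⟩
      δ r * 1ℚ                                    ≡⟨ Q.*-identityʳ (δ r) ⟩
      δ r                                         ∎

    Cp-suc : ∀ n r → Cp p (suc n) r ≡ act ∇ (Cp p n) r
    Cp-suc n r = begin
      Cp p (suc n) r                                                ≡⟨ Cp≡∑ (suc n) r ⟩
      ∑ 0 (suc (suc n)) (λ k → fromℕ (suc n C k) * g r k)           ≡⟨ sum-pascal n (g r) ⟩
      ∑ 0 (suc n) (λ k → fromℕ (n C k) * g r (suc k)) + ∑ 0 (suc n) (λ k → fromℕ (n C k) * g r k)
        ≡⟨ cong₂ _+_ (trans (∑-cong′ 0 (suc n) term) (∑-* 0 (suc n) (- 1ℚ) (λ k → fromℕ (n C k) * g (r ℤ.- pos 1) k))) (sym (Cp≡∑ n r)) ⟩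
      (- 1ℚ) * ∑ 0 (suc n) (λ k → fromℕ (n C k) * g (r ℤ.- pos 1) k) + Cp p n r
        ≡⟨ cong (λ x → (- 1ℚ) * x + Cp p n r) (Cp≡∑ n (r ℤ.- pos 1)) ⟨
      (- 1ℚ) * Cp p n (r ℤ.- pos 1) + Cp p n r                      ≡⟨ swap (Cp p n (r ℤ.- pos 1)) (Cp p n r) ⟩
      Cp p n r - Cp p n (r ℤ.- pos 1)                               ∎
      where
      g : ℤ → ℕ → ℚ
      g s k = indicator k s * (- 1ℚ) ^ k
      opaque
        unfolding _+_
        swap : ∀ x y → (- 1ℚ) * x + y ≡ y - x
        swap = solve-∀ ℚ-ring
        pull : ∀ c i m s → c * (i * (m * s)) ≡ m * (c * (i * s))
        pull = solve-∀ ℚ-ring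
      term : ∀ k → fromℕ (n C k) * g r (suc k) ≡ (- 1ℚ) * (fromℕ (n C k) * g (r ℤ.- pos 1) k)
      term k = trans (cong (λ i → fromℕ (n C k) * (i * ((- 1ℚ) * (- 1ℚ) ^ k))) (indicator-suc k r))
        (pull (fromℕ (n C k)) (indicator k (r ℤ.- pos 1)) (- 1ℚ) ((- 1ℚ) ^ k))

    Cp-∇^ : ∀ n m r → act (∇ P.^ n) (Cp p m) r ≡ Cp p (n ℕ.+ m) r
    Cp-∇^ zero m r = Q.*-identityˡ _
    Cp-∇^ (suc n) m r = trans (act-cong ∇ (Cp-∇^ n m) r) (sym (Cp-suc (n ℕ.+ m) r))

    Periodic : (ℤ → ℚ) → Set
    Periodic f = ∀ r → f (r ℤ.- pos p) ≡ f r

    -- Periodicity is invariance under (1 - ∇)^p, which commutes with `a`.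
    act-periodic : ∀ a {f} → Periodic f → Periodic (act a f)
    act-periodic a {f} per r = begin
      act a f (r ℤ.- pos p)                           ≡⟨ shift-act p (act a f) r ⟨
      act ((con 1ℚ ⊞ ⊟ ∇) P.^ p) (act a f) r          ≡⟨ act-comm ((con 1ℚ ⊞ ⊟ ∇) P.^ p) a f r ⟩
      act a (act ((con 1ℚ ⊞ ⊟ ∇) P.^ p) f) r          ≡⟨ act-cong a (λ s → trans (shift-act p f s) (per s)) r ⟩
      act a f r                                       ∎

    lnr-periodic : ∀ r → lnr (r ℤ.- pos p) p ≡ lnr r p
    lnr-periodic r = lnr-cong {r ℤ.- pos p} {r} {p} (ℤ.- pos 1) (s≤s z≤n) (cong (ℤ._+_ r) (negate (pos p)))
      where
      negate : ∀ m → ℤ.- m ≡ (ℤ.- pos 1) ℤ.* m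
      negate = solve-∀ ℤ-ring

    Cp-periodic : ∀ n → Periodic (Cp p n)
    Cp-periodic n r = trans (sym (unroll (r ℤ.- pos p))) (trans (act-periodic (∇ P.^ n) δ-periodic r) (unroll r))
      where
      δ-periodic : Periodic δ
      δ-periodic s = cong (λ j → if does (lnr (pos 0) p ℕ.≟ j) then 1ℚ else 0ℚ) (lnr-periodic s)
      unroll : ∀ s → act (∇ P.^ n) δ s ≡ Cp p n s
      unroll s = trans (act-cong (∇ P.^ n) (λ t → sym (Cp-0 t)) s)
        (trans (Cp-∇^ n 0 s) (cong (λ m → Cp p m s) (ℕₚ.+-identityʳ n)))

    W-𝟙 : ∀ k r → W k 𝟙 r ≡ (- fromℤ r) ^ k
    W-𝟙 k r = ⊛-identityʳ (exp (- fromℤ r)) k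

    W-𝟙-integral : ∀ k r → Integral (W k 𝟙 r)
    W-𝟙-integral k r = subst Integral (sym (W-𝟙 k r)) (integral-^ k (integral-neg (integral-ℤ r)))

    -- Fermat's little theorem: r^(p-1) is the indicator of p ∤ r.
    δ≋ : ∀ r → δ r ≋ 1ℚ - W (suc h) 𝟙 r
    δ≋ r = subst (λ x → δ r ≋ 1ℚ - x) (sym (trans (W-𝟙 (suc h) r) (cong (_^ suc h) (sym (fromℤ-neg r))))) (by-residue _ refl)
      where
      x = fromℤ (ℤ.- r)
      by-residue : ∀ j → lnr r p ≡ j → δ r ≋ 1ℚ - x ^ suc h
      by-residue zero eq = subst (_≋ 1ℚ - x ^ suc h) (sym (indicator-yes 0 r (sym eq)))
        (subst (_≋ 1ℚ - x ^ suc h) (1-0 1ℚ) (≋-+ ≋-refl (≋-neg (≋-sym power≋0))))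
        where
        opaque
          unfolding _+_
          1-0 : ∀ y → y - 0ℚ ≡ y
          1-0 = solve-∀ ℚ-ring
        x≋0 : x ≋ 0ℚ
        x≋0 = subst₂ _≋_ (sym (fromℤ-neg r)) (trans (cong (λ j → - fromℕ j) eq) (trans (cong -_ fromℤ-0) Q.ε⁻¹≈ε)) (≋-neg (fromℤ≋lnr r))
        power≋0 : x ^ suc h ≋ 0ℚ
        power≋0 = subst (x ^ suc h ≋_) (Q.zeroˡ (x ^ h)) (≋-*ʳ (integral-^ h (integral-ℤ (ℤ.- r))) x≋0)
      by-residue (suc j) eq = subst (_≋ 1ℚ - x ^ suc h) (sym (indicator-no 0 r (λ e → ℕₚ.1+n≢0 (trans (sym eq) (sym e)))))
        (subst (_≋ 1ℚ - x ^ suc h) (Q.-‿inverseʳ 1ℚ) (≋-+ ≋-refl (≋-neg (≋-sym (fermat-unit (ℤ.- r) (integral-neg ib) unit)))))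
        where
        j<p : suc j ℕ.< p
        j<p = subst (ℕ._< p) eq (lnr-< r {p} (s≤s z≤n))
        b = recip (fromℕ (suc j))
        ib : Integral b
        ib = integral-inv j<p
        unit : (- b) * x ≋ 1ℚ
        unit = subst₂ _≋_
          (trans (sym (-*- b (fromℤ r))) (cong ((- b) *_) (sym (fromℤ-neg r))))
          (recip-* j)
          (≋-*ˡ ib (subst (λ i → fromℤ r ≋ fromℕ i) eq (fromℤ≋lnr r)))

    -- Fleck quotients and their differences

    [-p]⁻¹ : ℚ
    [-p]⁻¹ = recip (- fromℕ p)

    -p*[-p]⁻¹ : (- fromℕ p) * [-p]⁻¹ ≡ 1ℚ
    -p*[-p]⁻¹ = recip-inverse (- fromℕ p) (λ eq → fromℕ≢0 (suc h) (trans (sym (Q.⁻¹-involutive (fromℕ p))) (trans (cong -_ eq) Q.ε⁻¹≈ε)))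

    -p^*[-p]⁻¹^ : ∀ n → (- fromℕ p) ^ n * [-p]⁻¹ ^ n ≡ 1ℚ
    -p^*[-p]⁻¹^ n = trans (sym (Q.^-distrib-* (- fromℕ p) [-p]⁻¹ n)) (trans (cong (_^ n) -p*[-p]⁻¹) (1^n≡1 n))

    opaque
      unfolding _+_

      -p^-ℤ : ∀ k → (ℚ.- ℕ→ℚ p) ^ℚℤ (ℤ.- pos k) ≡ [-p]⁻¹ ^ k
      -p^-ℤ zero = refl
      -p^-ℤ (suc k) = recip-unique ((ℚ.- ℕ→ℚ p) ^ℚ suc k) ([-p]⁻¹ ^ suc k)
        (trans (cong (_* [-p]⁻¹ ^ suc k) (^ℚ≡^ (- fromℕ p) (suc k))) (-p^*[-p]⁻¹^ (suc k)))

      Fp-0 : ∀ r → Fp p 0 r ≡ 1ℚ - fromℕ p * δ r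
      Fp-0 r = trans
        -- The floor of -1/(p - 1) is -1, because -1 = (p - 2) - (p - 1); so -p occurs to the first
        -- power.
        (cong (λ z → ((ℚ.- ℕ→ℚ p) ^ℚℤ (ℤ.- z)) * Cp p 0 r + 1ℚ) (floorDiv-unique {x = -[1+ 0 ]} {h} {suc h} -[1+ 0 ] (ℕₚ.n<1+n h) minus-one))
        (trans (cong (λ c → (- fromℕ p) * 1ℚ * c + 1ℚ) (Cp-0 r)) (tidy (fromℕ p) (δ r)))
        where
        tidy : ∀ x y → (- x) * 1ℚ * y + 1ℚ ≡ 1ℚ - x * y
        tidy = solve-∀ ℚ-ring
        minus-one : -[1+ 0 ] ≡ pos h ℤ.+ -[1+ 0 ] ℤ.* pos (suc h)
        minus-one = identity (pos h)
          where
          identity : ∀ m → -[1+ 0 ] ≡ m ℤ.+ -[1+ 0 ] ℤ.* (pos 1 ℤ.+ m)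
          identity = solve-∀ ℤ-ring

      Fp-suc : ∀ {m} a k → a ℕ.< suc h → m ≡ a ℕ.+ k ℕ.* suc h → ∀ r → Fp p (suc m) r ≡ [-p]⁻¹ ^ k * Cp p (suc m) r
      Fp-suc {m} a k a<p-1 eq r = trans
        (Q.+-identityʳ _)
        (cong (_* Cp p (suc m) r) (trans
          (cong (λ z → (ℚ.- ℕ→ℚ p) ^ℚℤ (ℤ.- z)) (floorDiv-unique {x = pos (suc m) ℤ.- pos 1} {a} {suc h} (pos k) a<p-1
            (trans (cong pos eq) (cong (ℤ._+_ (pos a)) (ℤₚ.pos-* k (suc h))))))
          (-p^-ℤ k)))

    Fp-suc-divMod : ∀ m r → Fp p (suc m) r ≡ [-p]⁻¹ ^ (m ℕᵐ./ suc h) * Cp p (suc m) r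
    Fp-suc-divMod m = Fp-suc (m ℕᵐ.% suc h) (m ℕᵐ./ suc h) (ℕᵐ.m%n<n m (suc h)) (ℕᵐ.m≡m%n+[m/n]*n m (suc h))

    -- The residue of r exceeds that of r - 1 by 1, except at multiples of p, where it drops from p
    -- - 1 to 0. By `Fp-0` the right side is F_p(0, r).
    lnr-periodic-difference : ∀ r → fromℕ (lnr r p) - fromℕ (lnr (r ℤ.- pos 1) p) ≡ 1ℚ - fromℕ p * δ r
    lnr-periodic-difference r = by-residue (lnr r p) refl
      where
      b = floorDiv r p
      division : r ≡ pos (lnr r p) ℤ.+ b ℤ.* pos p
      division = lnr-division r {p} (s≤s z≤n)
      by-residue : ∀ j → lnr r p ≡ j → fromℕ (lnr r p) - fromℕ (lnr (r ℤ.- pos 1) p) ≡ 1ℚ - fromℕ p * δ r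
      by-residue zero eq = begin
        fromℕ (lnr r p) - fromℕ (lnr (r ℤ.- pos 1) p)   ≡⟨ cong₂ (λ i j → fromℕ i - fromℕ j) eq wrap ⟩
        fromℕ 0 - fromℕ (suc h)                         ≡⟨ cong (_- fromℕ (suc h)) fromℤ-0 ⟩
        0ℚ - fromℕ (suc h)                              ≡⟨ tidy (fromℕ (suc h)) ⟩
        1ℚ - (1ℚ + fromℕ (suc h)) * 1ℚ                  ≡⟨ cong₂ (λ x y → 1ℚ - x * y) (sym (fromℕ-suc (suc h))) (sym (indicator-yes 0 r (sym eq))) ⟩
        1ℚ - fromℕ p * δ r                              ∎
        where
        opaque
          unfolding _+_
          tidy : ∀ x → 0ℚ - x ≡ 1ℚ - (1ℚ + x) * 1ℚ
          tidy = solve-∀ ℚ-ring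
        wrap : lnr (r ℤ.- pos 1) p ≡ suc h
        wrap = lnr-unique {r ℤ.- pos 1} {suc h} {p} (b ℤ.- pos 1) (ℕₚ.n<1+n (suc h))
          (trans (cong (ℤ._- pos 1) (trans division (cong (λ j → pos j ℤ.+ b ℤ.* pos p) eq))) (identity b (pos (suc h))))
          where
          identity : ∀ b m → (pos 0 ℤ.+ b ℤ.* (pos 1 ℤ.+ m)) ℤ.- pos 1 ≡ m ℤ.+ (b ℤ.- pos 1) ℤ.* (pos 1 ℤ.+ m)
          identity = solve-∀ ℤ-ring
      by-residue (suc j) eq = begin
        fromℕ (lnr r p) - fromℕ (lnr (r ℤ.- pos 1) p)   ≡⟨ cong₂ (λ i j → fromℕ i - fromℕ j) eq down ⟩
        fromℕ (suc j) - fromℕ j                         ≡⟨ cong (_- fromℕ j) (fromℕ-suc j) ⟩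
        1ℚ + fromℕ j - fromℕ j                          ≡⟨ tidy (fromℕ j) (fromℕ p) ⟩
        1ℚ - fromℕ p * 0ℚ                               ≡⟨ cong (λ y → 1ℚ - fromℕ p * y) (indicator-no 0 r (λ e → ℕₚ.1+n≢0 (trans (sym eq) (sym e)))) ⟨
        1ℚ - fromℕ p * δ r                              ∎
        where
        opaque
          unfolding _+_
          tidy : ∀ x y → 1ℚ + x - x ≡ 1ℚ - y * 0ℚ
          tidy = solve-∀ ℚ-ring
        down : lnr (r ℤ.- pos 1) p ≡ j
        down = lnr-unique {r ℤ.- pos 1} {j} {p} b (ℕₚ.<⇒≤ (subst (ℕ._< p) eq (lnr-< r {p} (s≤s z≤n))))
          (trans (cong (ℤ._- pos 1) (trans division (cong (λ j → pos j ℤ.+ b ℤ.* pos p) eq))) (identity (pos j) b (pos p)))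
          where
          identity : ∀ j b m → (pos 1 ℤ.+ j ℤ.+ b ℤ.* m) ℤ.- pos 1 ≡ j ℤ.+ b ℤ.* m
          identity = solve-∀ ℤ-ring

    -- Needed because `∇^-periodic` speaks only of differences of periodic functions. The function
    -- is the residue for n = 0 and a multiple of C_p(n - 1, ·) otherwise.
    Fp-∇ : ∀ n → ∃ λ g → Periodic g × (∀ r → Fp p n r ≡ act ∇ g r)
    Fp-∇ zero = (λ r → fromℕ (lnr r p)) , (λ r → cong fromℕ (lnr-periodic r)) , λ r → trans (Fp-0 r) (sym (lnr-periodic-difference r))
    Fp-∇ (suc m) = (λ r → c * Cp p m r) , (λ r → cong (c *_) (Cp-periodic m r)) , λ r → begin
      Fp p (suc m) r               ≡⟨ Fp-suc-divMod m r ⟩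
      c * Cp p (suc m) r           ≡⟨ cong (c *_) (Cp-suc m r) ⟩
      c * act ∇ (Cp p m) r         ≡⟨ act-* ∇ c (Cp p m) r ⟨
      act ∇ (λ s → c * Cp p m s) r ∎
      where c = [-p]⁻¹ ^ (m ℕᵐ./ suc h)

    act-∇^-constant : ∀ n c r → act (∇ P.^ suc n) (λ _ → c) r ≡ 0ℚ
    act-∇^-constant zero c r = Q.-‿inverseʳ (1ℚ * c)
    act-∇^-constant (suc n) c r = trans
      (cong₂ _-_ (act-∇^-constant n c r) (act-∇^-constant n c (r ℤ.- pos 1))) (Q.-‿inverseʳ 0ℚ)

    -- Raising n by p - 1 raises the floor by one, and the factor -p compensates for it. For n = 0
    -- the summand 1 is a constant, killed by ∇^(p-1).
    ∇^-Fp : ∀ n r → act (∇ P.^ suc h) (Fp p n) r ≡ (- fromℕ p) * Fp p (suc h ℕ.+ n) r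
    ∇^-Fp zero r = begin
      act (∇ P.^ suc h) (Fp p 0) r
        ≡⟨ act-cong (∇ P.^ suc h) (λ s → trans (Fp-0 s) (rewriteF (fromℕ p) (δ s))) r ⟩
      act (∇ P.^ suc h) (λ s → 1ℚ + (- fromℕ p) * δ s) r
        ≡⟨ act-+ (∇ P.^ suc h) (λ _ → 1ℚ) (λ s → (- fromℕ p) * δ s) r ⟩
      act (∇ P.^ suc h) (λ _ → 1ℚ) r + act (∇ P.^ suc h) (λ s → (- fromℕ p) * δ s) r
        ≡⟨ cong₂ _+_ (act-∇^-constant h 1ℚ r) (act-* (∇ P.^ suc h) (- fromℕ p) δ r) ⟩
      0ℚ + (- fromℕ p) * act (∇ P.^ suc h) δ r
        ≡⟨ Q.+-identityˡ _ ⟩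
      (- fromℕ p) * act (∇ P.^ suc h) δ r
        ≡⟨ cong ((- fromℕ p) *_) (trans (act-cong (∇ P.^ suc h) (λ s → sym (Cp-0 s)) r) (Cp-∇^ (suc h) 0 r)) ⟩
      (- fromℕ p) * Cp p (suc (h ℕ.+ 0)) r
        ≡⟨ cong ((- fromℕ p) *_) (trans (sym (Q.*-identityˡ _)) (sym (Fp-suc h 0 (ℕₚ.n<1+n h) refl r))) ⟩
      (- fromℕ p) * Fp p (suc h ℕ.+ 0) r ∎
      where
      opaque
        unfolding _+_
        rewriteF : ∀ x y → 1ℚ - x * y ≡ 1ℚ + (- x) * y
        rewriteF = solve-∀ ℚ-ring
    ∇^-Fp (suc m) r = begin
      act (∇ P.^ suc h) (Fp p (suc m)) r
        ≡⟨ act-cong (∇ P.^ suc h) (Fp-suc-divMod m) r ⟩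
      act (∇ P.^ suc h) (λ s → [-p]⁻¹ ^ k * Cp p (suc m) s) r
        ≡⟨ act-* (∇ P.^ suc h) ([-p]⁻¹ ^ k) (Cp p (suc m)) r ⟩
      [-p]⁻¹ ^ k * act (∇ P.^ suc h) (Cp p (suc m)) r
        ≡⟨ cong ([-p]⁻¹ ^ k *_) (Cp-∇^ (suc h) (suc m) r) ⟩
      [-p]⁻¹ ^ k * Cp p (suc h ℕ.+ suc m) r
        ≡⟨ Q.*-identityˡ _ ⟨
      1ℚ * ([-p]⁻¹ ^ k * Cp p (suc h ℕ.+ suc m) r)
        ≡⟨ cong (_* ([-p]⁻¹ ^ k * Cp p (suc h ℕ.+ suc m) r)) -p*[-p]⁻¹ ⟨
      (- fromℕ p) * [-p]⁻¹ * ([-p]⁻¹ ^ k * Cp p (suc h ℕ.+ suc m) r)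
        ≡⟨ regroup (- fromℕ p) [-p]⁻¹ ([-p]⁻¹ ^ k) (Cp p (suc h ℕ.+ suc m) r) ⟩
      (- fromℕ p) * ([-p]⁻¹ ^ suc k * Cp p (suc h ℕ.+ suc m) r)
        ≡⟨ cong ((- fromℕ p) *_) (Fp-suc (m ℕᵐ.% suc h) (suc k) (ℕᵐ.m%n<n m (suc h)) split r) ⟨
      (- fromℕ p) * Fp p (suc h ℕ.+ suc m) r ∎
      where
      k = m ℕᵐ./ suc h
      opaque
        unfolding _+_
        regroup : ∀ a b c d → a * b * (c * d) ≡ a * (b * c * d)
        regroup = solve-∀ ℚ-ring
      split : h ℕ.+ suc m ≡ m ℕᵐ.% suc h ℕ.+ suc k ℕ.* suc h
      split = begin
        h ℕ.+ suc m                                    ≡⟨ ℕₚ.+-suc h m ⟩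
        suc h ℕ.+ m                                    ≡⟨ cong (suc h ℕ.+_) (ℕᵐ.m≡m%n+[m/n]*n m (suc h)) ⟩
        suc h ℕ.+ (m ℕᵐ.% suc h ℕ.+ k ℕ.* suc h)       ≡⟨ ℕₚ.+-comm (suc h) _ ⟩
        m ℕᵐ.% suc h ℕ.+ k ℕ.* suc h ℕ.+ suc h         ≡⟨ ℕₚ.+-assoc (m ℕᵐ.% suc h) _ _ ⟩
        m ℕᵐ.% suc h ℕ.+ (k ℕ.* suc h ℕ.+ suc h)       ≡⟨ cong (m ℕᵐ.% suc h ℕ.+_) (ℕₚ.+-comm (k ℕ.* suc h) (suc h)) ⟩
        m ℕᵐ.% suc h ℕ.+ suc k ℕ.* suc h               ∎

    -- On ∇ g with g p-periodic, (1 - ∇)^p = 1 makes ∇^(p-1) equal to (-1)^p p u.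
    u : Poly
    u = frobeniusPoly (⊟ ∇)

    u-integral : IntegralPoly u
    u-integral = frobeniusPoly-integral (⊟-integral ∇)

    ⊟-^ : ∀ a n f r → act ((⊟ a) P.^ n) f r ≡ (- 1ℚ) ^ n * act (a P.^ n) f r
    ⊟-^ a n f r = trans (apply (P.^-distrib-* (con (- 1ℚ)) a n) f r) (act-con-^ (- 1ℚ) n (act (a P.^ n) f) r)

    ∇^-periodic : ∀ {g} → Periodic g → ∀ r → (- 1ℚ) ^ p * act (∇ P.^ suc h) (act ∇ g) r ≡ fromℕ p * act u (act ∇ g) r
    ∇^-periodic {g} per r = difference (g r) _ _ (begin
      g r                                                  ≡⟨ per r ⟨
      g (r ℤ.- pos p)                                      ≡⟨ shift-act p g r ⟨
      act ((con 1ℚ ⊞ ⊟ ∇) P.^ p) g r                       ≡⟨ apply (frobenius (⊟ ∇)) g r ⟩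
      1ℚ * g r + (act ((⊟ ∇) P.^ p) g r + fromℕ p * ((- 1ℚ) * act ∇ (act u g) r))
        ≡⟨ cong₂ (λ x y → 1ℚ * g r + (x + fromℕ p * ((- 1ℚ) * y)))
             (trans (⊟-^ ∇ p g r) (cong ((- 1ℚ) ^ p *_) (act-comm ∇ (∇ P.^ suc h) g r)))
             (act-comm ∇ u g r) ⟩
      1ℚ * g r + ((- 1ℚ) ^ p * act (∇ P.^ suc h) (act ∇ g) r + fromℕ p * ((- 1ℚ) * act u (act ∇ g) r)) ∎)
      where
      opaque
        unfolding _+_
        expand : ∀ x y z q → y ≡ (1ℚ * x + (y + q * ((- 1ℚ) * z))) - x + q * z
        expand = solve-∀ ℚ-ring
        cancel : ∀ x z q → x - x + q * z ≡ q * z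
        cancel = solve-∀ ℚ-ring
      difference : ∀ x y z → x ≡ 1ℚ * x + (y + fromℕ p * ((- 1ℚ) * z)) → y ≡ fromℕ p * z
      difference x y z eq = trans (expand x y z (fromℕ p))
        (trans (cong (λ t → t - x + fromℕ p * z) (sym eq)) (cancel x z (fromℕ p)))

    ∇^-Fp-u : ∀ n r → (- 1ℚ) ^ p * act (∇ P.^ suc h) (Fp p n) r ≡ fromℕ p * act u (Fp p n) r
    ∇^-Fp-u n r with g , per , eq ← Fp-∇ n = begin
      (- 1ℚ) ^ p * act (∇ P.^ suc h) (Fp p n) r    ≡⟨ cong ((- 1ℚ) ^ p *_) (act-cong (∇ P.^ suc h) eq r) ⟩
      (- 1ℚ) ^ p * act (∇ P.^ suc h) (act ∇ g) r   ≡⟨ ∇^-periodic per r ⟩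
      fromℕ p * act u (act ∇ g) r                  ≡⟨ cong (fromℕ p *_) (act-cong u eq r) ⟨
      fromℕ p * act u (Fp p n) r                   ∎

    -- Two evaluations of ∇^(p-1) F_p(n, ·), through periodicity and through the definition of the
    -- quotient, are compared and p is cancelled. The sign is 1 for odd p and -1 for p = 2.
    u-Fp : ∀ n r → act u (Fp p n) r ≡ (- ((- 1ℚ) ^ p)) * Fp p (suc h ℕ.+ n) r
    u-Fp n r = cancel-ℕ (suc h) (begin
      fromℕ p * act u (Fp p n) r                             ≡⟨ ∇^-Fp-u n r ⟨
      (- 1ℚ) ^ p * act (∇ P.^ suc h) (Fp p n) r              ≡⟨ cong ((- 1ℚ) ^ p *_) (∇^-Fp n r) ⟩
      (- 1ℚ) ^ p * ((- fromℕ p) * Fp p (suc h ℕ.+ n) r)      ≡⟨ regroup ((- 1ℚ) ^ p) (fromℕ p) _ ⟩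
      fromℕ p * ((- ((- 1ℚ) ^ p)) * Fp p (suc h ℕ.+ n) r)    ∎)
      where
      opaque
        unfolding _+_
        regroup : ∀ s q y → s * ((- q) * y) ≡ q * ((- s) * y)
        regroup = solve-∀ ℚ-ring

  -- Odd primes p = h′ + 3

  module OddPrime (h′ : ℕ) (p-prime : Prime (suc (suc (suc h′)))) where

    open Congruence (suc (suc (suc h′))) p-prime
    open AnyPrime (suc h′) p-prime

    h : ℕ
    h = suc h′

    -1^even : ∀ q → (- 1ℚ) ^ (q ℕ.* 2) ≡ 1ℚ
    -1^even zero = refl
    -1^even (suc q) = trans (square _) (-1^even q)
      where
      opaque
        unfolding _+_
        square : ∀ x → (- 1ℚ) * ((- 1ℚ) * x) ≡ x
        square = solve-∀ ℚ-ring

    -1^p : (- 1ℚ) ^ p ≡ - 1ℚ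
    -1^p = by-residue (p ℕᵐ.% 2) (ℕᵐ.m≡m%n+[m/n]*n p 2) (ℕᵐ.m%n<n p 2)
      where
      q = p ℕᵐ./ 2
      not-both : 2 ≡ 1 ⊎ 2 ≡ p → (- 1ℚ) ^ p ≡ - 1ℚ
      not-both (inj₁ ())
      not-both (inj₂ ())
      by-residue : ∀ r → p ≡ r ℕ.+ q ℕ.* 2 → r ℕ.< 2 → (- 1ℚ) ^ p ≡ - 1ℚ
      -- An even prime has the divisor 2, so it would be 2, whereas p is at least 3.
      by-residue zero eq _ = not-both (prime⇒irreducible p-prime (ℕᵈ.divides q eq))
      by-residue (suc zero) eq _ = trans (cong ((- 1ℚ) ^_) eq) (trans (cong ((- 1ℚ) *_) (-1^even q)) (Q.*-identityʳ (- 1ℚ)))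
      by-residue (suc (suc _)) eq (s≤s (s≤s ()))

    -- The shift by p - 1 and its p-th power

    u-shift : ∀ n r → act u (Fp p n) r ≡ Fp p (suc h ℕ.+ n) r
    u-shift n r = trans (u-Fp n r) (trans (cong (λ s → (- s) * Fp p (suc h ℕ.+ n) r) -1^p) (negate (Fp p (suc h ℕ.+ n) r)))
      where
      opaque
        unfolding _+_
        negate : ∀ x → (- (- 1ℚ)) * x ≡ x
        negate = solve-∀ ℚ-ring

    u^-shift : ∀ j n r → act (u P.^ j) (Fp p n) r ≡ Fp p (j ℕ.* suc h ℕ.+ n) r
    u^-shift zero n r = Q.*-identityˡ _
    u^-shift (suc j) n r = begin
      act u (act (u P.^ j) (Fp p n)) r             ≡⟨ act-cong u (u^-shift j n) r ⟩
      act u (Fp p (j ℕ.* suc h ℕ.+ n)) r           ≡⟨ u-shift (j ℕ.* suc h ℕ.+ n) r ⟩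
      Fp p (suc h ℕ.+ (j ℕ.* suc h ℕ.+ n)) r       ≡⟨ cong (λ m → Fp p m r) (ℕₚ.+-assoc (suc h) (j ℕ.* suc h) n) ⟨
      Fp p (suc j ℕ.* suc h ℕ.+ n) r               ∎

    -- The tail of `u` after its constant term 1; the sign of the argument -∇ is moved into it.
    u₁ : Poly
    u₁ = ⊟ ∑-poly (frobeniusCoeff ∘ suc) 0 h (⊟ ∇)

    u₁-integral : IntegralPoly u₁
    u₁-integral = ⊟-integral (∑-poly-integral 0 h (λ k k< → frobeniusCoeff-integral (s≤s (s≤s k<))) (⊟-integral ∇))

    u-split : u ≈ con 1ℚ ⊞ ∇ ⊠ u₁
    u-split = P.trans (frobeniusPoly-first (⊟ ∇))
      (P.+-congˡ (P.solve 3 (λ m d r → (m :* d) :* r := d :* (m :* r)) P.refl (con (- 1ℚ)) ∇ (∑-poly (frobeniusCoeff ∘ suc) 0 h (⊟ ∇))))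
      where open P using (_:+_; _:*_; _:=_)

    -- (u^p - 1)/p, where ∇^p has been replaced by - p ∇ u.
    Y : Poly
    Y = (∇ ⊠ u₁) ⊠ frobeniusPoly (∇ ⊠ u₁) ⊞ ⊟ (∇ ⊠ (u ⊠ u₁ P.^ p))

    Y-integral : IntegralPoly Y
    Y-integral = ((∇ ⊠ u₁-integral) ⊠ frobeniusPoly-integral (∇ ⊠ u₁-integral))
      ⊞ ⊟-integral (∇ ⊠ (u-integral ⊠ ^-integral p u₁-integral))

    -- The relation of 1 - ζ for a primitive p-th root of unity ζ, with ∇ in its place. It passes
    -- from `f` to `act a f`, which allows `u^p-act` to be iterated.
    Eisenstein : (ℤ → ℚ) → Set
    Eisenstein f = ∀ r → act (∇ P.^ suc h) f r ≡ (- fromℕ p) * act u f r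

    Fp-eisenstein : ∀ n → Eisenstein (Fp p n)
    Fp-eisenstein n r = trans (∇^-Fp n r) (cong ((- fromℕ p) *_) (sym (u-shift n r)))

    act-eisenstein : ∀ a {f} → Eisenstein f → Eisenstein (act a f)
    act-eisenstein a {f} e r = begin
      act (∇ P.^ suc h) (act a f) r             ≡⟨ act-comm (∇ P.^ suc h) a f r ⟩
      act a (act (∇ P.^ suc h) f) r             ≡⟨ act-cong a e r ⟩
      act a (λ s → (- fromℕ p) * act u f s) r   ≡⟨ act-* a (- fromℕ p) (act u f) r ⟩
      (- fromℕ p) * act a (act u f) r           ≡⟨ cong ((- fromℕ p) *_) (act-comm a u f r) ⟩
      (- fromℕ p) * act u (act a f) r           ∎

    u^p-act : ∀ {f} → Eisenstein f → ∀ r → act (u P.^ p) f r ≡ act (con 1ℚ ⊞ con (fromℕ p) ⊠ Y) f r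
    u^p-act {f} e r = begin
      act (u P.^ p) f r
        ≡⟨ apply (P.trans (P.^-congˡ p u-split) (frobenius (∇ ⊠ u₁))) f r ⟩
      1ℚ * f r + (act ((∇ ⊠ u₁) P.^ p) f r + fromℕ p * act NQ f r)
        ≡⟨ cong (λ x → 1ℚ * f r + (x + fromℕ p * act NQ f r)) power ⟩
      1ℚ * f r + ((- fromℕ p) * act Z f r + fromℕ p * act NQ f r)
        ≡⟨ tidy (1ℚ * f r) (fromℕ p) (act Z f r) (act NQ f r) ⟩
      1ℚ * f r + fromℕ p * (act NQ f r + (- 1ℚ) * act Z f r) ∎
      where
      open P using (_:+_; _:*_; _:=_)
      NQ Z : Poly
      NQ = (∇ ⊠ u₁) ⊠ frobeniusPoly (∇ ⊠ u₁)
      Z = ∇ ⊠ (u ⊠ u₁ P.^ p)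
      opaque
        unfolding _+_
        tidy : ∀ x q z y → x + ((- q) * z + q * y) ≡ x + q * (y + (- 1ℚ) * z)
        tidy = solve-∀ ℚ-ring
      power : act ((∇ ⊠ u₁) P.^ p) f r ≡ (- fromℕ p) * act Z f r
      power = begin
        act ((∇ ⊠ u₁) P.^ p) f r
          ≡⟨ apply (P.trans (P.^-distrib-* ∇ u₁ p)
               (P.solve 3 (λ d e a → (d :* e) :* a := (a :* d) :* e) P.refl ∇ (∇ P.^ suc h) (u₁ P.^ p))) f r ⟩
        act (u₁ P.^ p ⊠ ∇) (act (∇ P.^ suc h) f) r
          ≡⟨ act-cong (u₁ P.^ p ⊠ ∇) e r ⟩
        act (u₁ P.^ p ⊠ ∇) (λ s → (- fromℕ p) * act u f s) r
          ≡⟨ act-* (u₁ P.^ p ⊠ ∇) (- fromℕ p) (act u f) r ⟩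
        (- fromℕ p) * act ((u₁ P.^ p ⊠ ∇) ⊠ u) f r
          ≡⟨ cong ((- fromℕ p) *_) (apply (P.solve 3 (λ d v a → (a :* d) :* v := d :* (v :* a)) P.refl ∇ u (u₁ P.^ p)) f r) ⟩
        (- fromℕ p) * act Z f r ∎

    u^p^-act : ∀ s {f} → Eisenstein f → ∀ r → act ((u P.^ p) P.^ s) f r ≡ act ((con 1ℚ ⊞ con (fromℕ p) ⊠ Y) P.^ s) f r
    u^p^-act zero e r = refl
    u^p^-act (suc s) {f} e r = trans
      (u^p-act (act-eisenstein ((u P.^ p) P.^ s) e) r)
      (act-cong (con 1ℚ ⊞ con (fromℕ p) ⊠ Y) (u^p^-act s e) r)

    -- Powers of 1 + p Y

    Fp-iterate : ∀ s n r → Fp p (p ℕ.* s ℕ.* suc h ℕ.+ n) r ≡ act ((con 1ℚ ⊞ con (fromℕ p) ⊠ Y) P.^ s) (Fp p n) r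
    Fp-iterate s n r = begin
      Fp p (p ℕ.* s ℕ.* suc h ℕ.+ n) r                            ≡⟨ u^-shift (p ℕ.* s) n r ⟨
      act (u P.^ (p ℕ.* s)) (Fp p n) r                            ≡⟨ apply (P.^-assocʳ u p s) (Fp p n) r ⟨
      act ((u P.^ p) P.^ s) (Fp p n) r                            ≡⟨ u^p^-act s (Fp-eisenstein n) r ⟩
      act ((con 1ℚ ⊞ con (fromℕ p) ⊠ Y) P.^ s) (Fp p n) r         ∎

    -- As n + 1 < p^(k+1), the power of p in n + 1 is at most p^k. Each recursive step removes one
    -- factor p from numerator and denominator.
    p^-recip-integral : ∀ k n → suc n ℕ.< p ℕ.^ suc k → Integral (fromℕ p ^ k * recip (fromℕ (suc n)))
    p^-recip-integral k n n< with p ℕᵈ.∣? suc n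
    ... | no p∤n = integral-* (integral-^ k (integral-ℕ p)) (integral (suc n) (pos 1) p∤n (trans (*-recip n) (sym fromℤ-1)))
    p^-recip-integral zero n n< | yes p∣n = ⊥-elim (ℕᵈ.>⇒∤ (subst (suc n ℕ.<_) (ℕₚ.*-identityʳ p) n<) p∣n)
    p^-recip-integral (suc k) n n< | yes (ℕᵈ.divides (suc m) eq) = subst Integral (begin
      fromℕ p ^ k * recip (fromℕ (suc m))
        ≡⟨ Q.*-identityˡ _ ⟨
      1ℚ * (fromℕ p ^ k * recip (fromℕ (suc m)))
        ≡⟨ cong (_* (fromℕ p ^ k * recip (fromℕ (suc m)))) p*p⁻¹ ⟨
      fromℕ p * p⁻¹ * (fromℕ p ^ k * recip (fromℕ (suc m)))
        ≡⟨ regroup (fromℕ p) p⁻¹ (fromℕ p ^ k) (recip (fromℕ (suc m))) ⟩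
      fromℕ p ^ suc k * (recip (fromℕ (suc m)) * p⁻¹)
        ≡⟨ cong (fromℕ p ^ suc k *_) (recip-unique (fromℕ (suc n)) _ inverse) ⟨
      fromℕ p ^ suc k * recip (fromℕ (suc n)) ∎)
      (p^-recip-integral k m (ℕₚ.*-cancelˡ-< p (suc m) (p ℕ.^ suc k) (subst (ℕ._< p ℕ.* p ℕ.^ suc k) (trans eq (ℕₚ.*-comm (suc m) p)) n<)))
      where
      opaque
        unfolding _+_
        regroup : ∀ a b c d → a * b * (c * d) ≡ a * c * (d * b)
        regroup = solve-∀ ℚ-ring
        pair : ∀ a b c d → a * b * (c * d) ≡ a * c * (b * d)
        pair = solve-∀ ℚ-ring
      inverse : fromℕ (suc n) * (recip (fromℕ (suc m)) * p⁻¹) ≡ 1ℚ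
      inverse = begin
        fromℕ (suc n) * (recip (fromℕ (suc m)) * p⁻¹)
          ≡⟨ cong (_* (recip (fromℕ (suc m)) * p⁻¹)) (trans (cong fromℕ eq) (fromℕ-* (suc m) p)) ⟩
        fromℕ (suc m) * fromℕ p * (recip (fromℕ (suc m)) * p⁻¹)
          ≡⟨ pair (fromℕ (suc m)) (fromℕ p) (recip (fromℕ (suc m))) p⁻¹ ⟩
        fromℕ (suc m) * recip (fromℕ (suc m)) * (fromℕ p * p⁻¹)
          ≡⟨ cong₂ _*_ (*-recip m) p*p⁻¹ ⟩
        1ℚ * 1ℚ
          ≡⟨ Q.*-identityˡ 1ℚ ⟩
        1ℚ ∎

    -- This uses p > 2: for p = 2 and k = 0 the inequality would read 2 < 2.
    2+k<p^ : ∀ k → suc (suc k) ℕ.< p ℕ.^ suc k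
    2+k<p^ zero = subst (2 ℕ.<_) (sym (ℕₚ.*-identityʳ p)) (s≤s (s≤s (s≤s z≤n)))
    2+k<p^ (suc k) = ℕₚ.≤-trans
      (ℕₚ.+-mono-≤ (ℕₚ.≤-trans (s≤s z≤n) (2+k<p^ k)) (2+k<p^ k))
      (ℕₚ.+-monoʳ-≤ P (ℕₚ.m≤m+n P (suc h′ ℕ.* P)))
      where P = p ℕ.^ suc k

    scale-^ : ∀ q x k f r → act ((con q ⊠ x) P.^ k) f r ≡ q ^ k * act (x P.^ k) f r
    scale-^ q x k f r = trans (apply (P.^-distrib-* (con q) x k) f r) (act-con-^ q k (act (x P.^ k) f) r)

    ∑-poly-scale : ∀ c q n x → ∑-poly c 0 n (con q ⊠ x) ≈ ∑-poly (λ k → c k * q ^ k) 0 n x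
    ∑-poly-scale c q n x = same-action λ f r → begin
      act (∑-poly c 0 n (con q ⊠ x)) f r                       ≡⟨ act-∑-poly c 0 n (con q ⊠ x) f r ⟩
      ∑ 0 n (λ k → c k * act ((con q ⊠ x) P.^ k) f r)          ≡⟨ ∑-cong′ 0 n (λ k → trans (cong (c k *_) (scale-^ q x k f r)) (sym (Q.*-assoc (c k) (q ^ k) _))) ⟩
      ∑ 0 n (λ k → c k * q ^ k * act (x P.^ k) f r)            ≡⟨ act-∑-poly (λ k → c k * q ^ k) 0 n x f r ⟨
      act (∑-poly (λ k → c k * q ^ k) 0 n x) f r               ∎

    -- The point is that p^k/(k + 1) is divisible by p for all k > 0, as p is odd.
    power-expansion : ∀ {x} → IntegralPoly x → ∀ t → ∃ λ z → IntegralPoly z ×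
      (con 1ℚ ⊞ con (fromℕ p) ⊠ x) P.^ suc t ≈ con 1ℚ ⊞ con (fromℕ p * fromℕ (suc t)) ⊠ (x ⊞ con (fromℕ p) ⊠ z)
    power-expansion {x} ix t = x ⊠ (x ⊠ ∑-poly d 0 t x) , (ix ⊠ (ix ⊠ ∑-poly-integral 0 t (λ k _ → d-integral k) ix)) , (
      (con 1ℚ ⊞ q ⊠ x) P.^ suc t
        ≈⟨ binomial (q ⊠ x) (suc t) ⟩
      ∑-poly (λ k → fromℕ (suc t C k)) 0 (suc (suc t)) (q ⊠ x)
        ≈⟨ ∑-poly-first (λ k → fromℕ (suc t C k)) (suc t) (q ⊠ x) ⟩
      con (fromℕ 1) ⊞ (q ⊠ x) ⊠ ∑-poly (λ k → fromℕ (suc t C suc k)) 0 (suc t) (q ⊠ x)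
        ≈⟨ P.+-cong (P.reflexive (cong con fromℤ-1)) (P.*-congˡ (
             ∑-poly (λ k → fromℕ (suc t C suc k)) 0 (suc t) (q ⊠ x)
               ≈⟨ ∑-poly-scale _ (fromℕ p) (suc t) x ⟩
             ∑-poly (λ k → fromℕ (suc t C suc k) * fromℕ p ^ k) 0 (suc t) x
               ≈⟨ ∑-poly-cong 0 (suc t) x coefficient ⟩
             ∑-poly (λ k → fromℕ (suc t) * e k) 0 (suc t) x
               ≈⟨ ∑-poly-* (fromℕ (suc t)) e 0 (suc t) x ⟩
             s ⊠ ∑-poly e 0 (suc t) x
               ≈⟨ P.*-congˡ (∑-poly-first e t x) ⟩
             s ⊠ (con (e 0) ⊞ x ⊠ ∑-poly (e ∘ suc) 0 t x)
               ≈⟨ P.*-congˡ (P.+-cong (P.reflexive (cong con e-0)) (P.*-congˡ (P.trans (∑-poly-cong 0 t x e-suc) (∑-poly-* (fromℕ p) d 0 t x)))) ⟩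
             s ⊠ (con 1ℚ ⊞ x ⊠ (q ⊠ ∑-poly d 0 t x)) □)) ⟩
      con 1ℚ ⊞ (q ⊠ x) ⊠ (s ⊠ (con 1ℚ ⊞ x ⊠ (q ⊠ ∑-poly d 0 t x)))
        ≈⟨ P.+-congˡ (P.trans
             (P.solve 5 (λ q x s o y → (q :* x) :* (s :* (o :+ x :* (q :* y))) := (q :* s) :* (o :* x :+ q :* (x :* (x :* y)))) P.refl q x s (con 1ℚ) (∑-poly d 0 t x))
             (P.*-cong (same-action λ f r → sym (Q.*-assoc (fromℕ p) (fromℕ (suc t)) (f r))) (P.+-congʳ (P.*-identityˡ x)))) ⟩
      con 1ℚ ⊞ con (fromℕ p * fromℕ (suc t)) ⊠ (x ⊞ q ⊠ (x ⊠ (x ⊠ ∑-poly d 0 t x))) □)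
      where
      open P using (_:+_; _:*_; _:=_)
      q s : Poly
      q = con (fromℕ p)
      s = con (fromℕ (suc t))
      -- From (k + 1) C(t + 1, k + 1) = (t + 1) C(t, k), the coefficient C(t + 1, k + 1) p^k is t +
      -- 1 times `e k`. Beyond `e 0`, which is 1, each `e` is p times the p-integral `d`.
      e d : ℕ → ℚ
      e k = recip (fromℕ (suc k)) * fromℕ (t C k) * fromℕ p ^ k
      d k = fromℕ p ^ k * recip (fromℕ (suc (suc k))) * fromℕ (t C suc k)
      opaque
        unfolding _+_
        regroup₁ : ∀ a b c y → a * (b * c * y) ≡ b * (a * c) * y
        regroup₁ = solve-∀ ℚ-ring
        regroup₂ : ∀ a b c y → b * c * (a * y) ≡ a * (y * b * c)
        regroup₂ = solve-∀ ℚ-ring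
      d-integral : ∀ k → Integral (d k)
      d-integral k = integral-* (p^-recip-integral k (suc k) (2+k<p^ k)) (integral-ℕ (t C suc k))
      coefficient : ∀ k → fromℕ (suc t C suc k) * fromℕ p ^ k ≡ fromℕ (suc t) * e k
      coefficient k = sym (begin
        fromℕ (suc t) * (recip (fromℕ (suc k)) * fromℕ (t C k) * fromℕ p ^ k)
          ≡⟨ regroup₁ (fromℕ (suc t)) (recip (fromℕ (suc k))) (fromℕ (t C k)) (fromℕ p ^ k) ⟩
        recip (fromℕ (suc k)) * (fromℕ (suc t) * fromℕ (t C k)) * fromℕ p ^ k
          ≡⟨ cong (λ y → recip (fromℕ (suc k)) * y * fromℕ p ^ k) (choose-absorb-ℚ t k) ⟨
        recip (fromℕ (suc k)) * (fromℕ (suc k) * fromℕ (suc t C suc k)) * fromℕ p ^ k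
          ≡⟨ cong (_* fromℕ p ^ k) (trans (sym (Q.*-assoc _ _ _)) (trans (cong (_* fromℕ (suc t C suc k)) (recip-* k)) (Q.*-identityˡ _))) ⟩
        fromℕ (suc t C suc k) * fromℕ p ^ k ∎)
      e-0 : e 0 ≡ 1ℚ
      e-0 = trans (Q.*-identityʳ _) (trans (cong (recip (fromℕ 1) *_) refl) (recip-* 0))
      e-suc : ∀ k → e (suc k) ≡ fromℕ p * d k
      e-suc k = regroup₂ (fromℕ p) (recip (fromℕ (suc (suc k)))) (fromℕ (t C suc k)) (fromℕ p ^ k)

    -- Integrality of the Fleck quotients, and the difference quotient modulo p

    Cp-integral : ∀ n r → Integral (Cp p n r)
    Cp-integral n r = subst Integral (trans (Cp-∇^ n 0 r) (cong (λ m → Cp p m r) (ℕₚ.+-identityʳ n)))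
      (act-integral (^-integral n ∇) (λ s → subst Integral (sym (Cp-0 s)) (δ-integral s)) r)
      where
      δ-integral : ∀ s → Integral (δ s)
      δ-integral s = ≋-integral (δ≋ s) (integral-- integral-1 (W-𝟙-integral (suc h) s))

    Fp-base : ∀ a → a ℕ.< suc h → ∀ r → Fp p (suc a) r ≡ Cp p (suc a) r
    Fp-base a a<p-1 r = trans (Fp-suc a 0 a<p-1 (sym (ℕₚ.+-identityʳ a)) r) (Q.*-identityˡ _)

    next-period : ∀ a k → suc h ℕ.+ suc (a ℕ.+ k ℕ.* suc h) ≡ suc (a ℕ.+ suc k ℕ.* suc h)
    next-period a k = trans (ℕₚ.+-suc (suc h) (a ℕ.+ k ℕ.* suc h)) (cong suc (trans (sym (ℕₚ.+-assoc (suc h) a _))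
      (trans (cong (ℕ._+ k ℕ.* suc h) (ℕₚ.+-comm (suc h) a)) (ℕₚ.+-assoc a (suc h) _))))

    -- Fleck's divisibility theorem: in the first period, 1 ≤ n ≤ p - 1, the quotient is C_p(n, r)
    -- itself, and each further period applies the p-integral operator `u`.
    Fp-integral-suc : ∀ a k → a ℕ.< suc h → ∀ r → Integral (Fp p (suc (a ℕ.+ k ℕ.* suc h)) r)
    Fp-integral-suc a zero a<p-1 r = subst (λ m → Integral (Fp p (suc m) r)) (sym (ℕₚ.+-identityʳ a))
      (subst Integral (sym (Fp-base a a<p-1 r)) (Cp-integral (suc a) r))
    Fp-integral-suc a (suc k) a<p-1 r = subst Integral (trans (u-shift _ r) (cong (λ m → Fp p m r) (next-period a k)))
      (act-integral u-integral (Fp-integral-suc a k a<p-1) r)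

    Fp-integral : ∀ n r → Integral (Fp p n r)
    Fp-integral zero r = subst Integral (trans (cong (λ c → 1ℚ - fromℕ p * c) (Cp-0 r)) (sym (Fp-0 r)))
      (integral-- integral-1 (integral-* (integral-ℕ p) (Cp-integral 0 r)))
    Fp-integral (suc m) r = subst (λ m → Integral (Fp p (suc m) r)) (sym (ℕᵐ.m≡m%n+[m/n]*n m (suc h)))
      (Fp-integral-suc (m ℕᵐ.% suc h) (m ℕᵐ./ suc h) (ℕᵐ.m%n<n m (suc h)) r)

    -- The factor p s of K cancels against the expansion of g - f. The remaining factor p - 1 is -1
    -- modulo p, which produces the minus sign.
    quotient-≋ : ∀ {g f y z K s} → Integral y → Integral z → K * recip K ≡ 1ℚ → K ≡ fromℕ p * s * fromℕ (suc h) →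
      g ≡ 1ℚ * f + fromℕ p * s * (y + fromℕ p * z) → (g - f) * recip K ≋ - y
    quotient-≋ {g} {f} {y} {z} {K} {s} iy iz K*recip K-split expansion =
      ≋-cancel-ℕ {h} (ℕₚ.n<1+n (suc h)) (≋-trans (≡⇒≋ quotient-times) (≋-trans (p*+≋ iz) (≋-sym negative)))
      where
      opaque
        unfolding _+_
        cancel : ∀ x y → 1ℚ * x + y - x ≡ y
        cancel = solve-∀ ℚ-ring
        regroup : ∀ a b c d → a * ((b * d) * c) ≡ (b * a) * c * d
        regroup = solve-∀ ℚ-ring
        negated : ∀ c y → c * (- y) ≡ y + (1ℚ + c) * (- y)
        negated = solve-∀ ℚ-ring
      quotient-times : fromℕ (suc h) * ((g - f) * recip K) ≡ y + fromℕ p * z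
      quotient-times = begin
        fromℕ (suc h) * ((g - f) * recip K)
          ≡⟨ cong (λ x → fromℕ (suc h) * (x * recip K)) (trans (cong (_- f) expansion) (cancel f _)) ⟩
        fromℕ (suc h) * (fromℕ p * s * (y + fromℕ p * z) * recip K)
          ≡⟨ regroup (fromℕ (suc h)) (fromℕ p * s) (recip K) (y + fromℕ p * z) ⟩
        fromℕ p * s * fromℕ (suc h) * recip K * (y + fromℕ p * z)
          ≡⟨ cong (λ x → x * recip K * (y + fromℕ p * z)) K-split ⟨
        K * recip K * (y + fromℕ p * z)
          ≡⟨ cong (_* (y + fromℕ p * z)) K*recip ⟩
        1ℚ * (y + fromℕ p * z)
          ≡⟨ Q.*-identityˡ _ ⟩
        y + fromℕ p * z ∎
      negative : fromℕ (suc h) * (- y) ≋ y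
      negative = subst (_≋ y) (sym (trans (negated (fromℕ (suc h)) y) (cong (λ x → y + x * (- y)) (sym (fromℕ-suc (suc h)))))) (p*+≋ (integral-neg iy))

    difference-quotient : ∀ t n r {m} → m ≡ p ℕ.* suc t ℕ.* suc h →
      (Fp p (m ℕ.+ n) r - Fp p n r) * recip (fromℕ m) ≋ - act Y (Fp p n) r
    difference-quotient t n r {m} m-split = combine (power-expansion Y-integral t)
      where
      combine : (∃ λ z → IntegralPoly z × (con 1ℚ ⊞ con (fromℕ p) ⊠ Y) P.^ suc t ≈ con 1ℚ ⊞ con (fromℕ p * fromℕ (suc t)) ⊠ (Y ⊞ con (fromℕ p) ⊠ z)) →
        (Fp p (m ℕ.+ n) r - Fp p n r) * recip (fromℕ m) ≋ - act Y (Fp p n) r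
      combine (z , iz , expansion) =
        quotient-≋ {g = Fp p (m ℕ.+ n) r} {Fp p n r} {act Y (Fp p n) r} {act z (Fp p n) r} {fromℕ m} {fromℕ (suc t)}
          (act-integral Y-integral (Fp-integral n) r) (act-integral iz (Fp-integral n) r)
          (recip-inverse (fromℕ m) (λ eq → ℕₚ.1+n≢0 (trans (sym m-split) (fromℕ-injective {m} {0} (trans eq (sym fromℤ-0))))))
          (trans (cong fromℕ m-split) (trans (fromℕ-* (p ℕ.* suc t) (suc h)) (cong (_* fromℕ (suc h)) (fromℕ-* p (suc t)))))
          (trans (cong (λ k → Fp p (k ℕ.+ n) r) m-split) (trans (Fp-iterate (suc t) n r) (apply expansion (Fp p n) r)))

    -- Power series modulo p below a given degree

    IntegralBelow : ℕ → Series → Set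
    IntegralBelow d f = ∀ {k} → k ℕ.< d → Integral (f k)

    infix 4 _≋[_]_
    _≋[_]_ : Series → ℕ → Series → Set
    f ≋[ d ] g = ∀ {k} → k ℕ.< d → f k ≋ g k

    ≗⇒≋[] : ∀ {d f g} → f ≗ g → f ≋[ d ] g
    ≗⇒≋[] eq {k} _ = ≡⇒≋ (eq k)

    ≋[]-trans : ∀ {d f g l} → f ≋[ d ] g → g ≋[ d ] l → f ≋[ d ] l
    ≋[]-trans e e′ k<d = ≋-trans (e k<d) (e′ k<d)

    ≋[]-sym : ∀ {d f g} → f ≋[ d ] g → g ≋[ d ] f
    ≋[]-sym e k<d = ≋-sym (e k<d)

    ≋[]-integral : ∀ {d f g} → f ≋[ d ] g → IntegralBelow d g → IntegralBelow d f
    ≋[]-integral e ig k<d = ≋-integral (e k<d) (ig k<d)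

    -- A coefficient of the product involves no higher degrees of the factors, and its weights are
    -- binomial coefficients, hence integers.
    ⊛-integral : ∀ {d f g} → IntegralBelow d f → IntegralBelow d g → IntegralBelow d (f ⊛ g)
    ⊛-integral {d} {f} {g} if ig {n} n<d = subst Integral (sym (⊛-binomial f g n))
      (integral-sum 0 (suc n) (λ k _ k≤n → integral-* (integral-ℕ (n C k))
        (integral-* (if (ℕₚ.≤-<-trans (ℕₚ.≤-pred k≤n) n<d)) (ig (ℕₚ.≤-<-trans (ℕₚ.m∸n≤m n k) n<d)))))

    ⊛-≋ : ∀ {d f f′ g g′} → IntegralBelow d f′ → IntegralBelow d g → f ≋[ d ] f′ → g ≋[ d ] g′ → f ⊛ g ≋[ d ] f′ ⊛ g′
    ⊛-≋ {d} {f} {f′} {g} {g′} if′ ig ef eg {n} n<d = subst₂ _≋_ (sym (⊛-binomial f g n)) (sym (⊛-binomial f′ g′ n))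
      (≋-sum 0 (suc n) (λ k _ k≤n →
        let k<d = ℕₚ.≤-<-trans (ℕₚ.≤-pred k≤n) n<d
            n∸k<d = ℕₚ.≤-<-trans (ℕₚ.m∸n≤m n k) n<d
        in ≋-*ˡ (integral-ℕ (n C k)) (≋-* (if′ k<d) (ig n∸k<d) (ef k<d) (eg n∸k<d))))

    ⊛-≋ˡ : ∀ {d f g g′} → IntegralBelow d f → g ≋[ d ] g′ → IntegralBelow d g → f ⊛ g ≋[ d ] f ⊛ g′
    ⊛-≋ˡ {f = f} if eg ig = ⊛-≋ {f = f} if ig (≗⇒≋[] {f = f} (λ _ → refl)) eg

    constant-integral : ∀ {c d} → Integral c → IntegralBelow d (constant c)
    constant-integral ic {zero} _ = ic
    constant-integral ic {suc k} _ = integral-0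

    ^S-integral : ∀ {d f} n → IntegralBelow d f → IntegralBelow d (f S.^ n)
    ^S-integral zero if = constant-integral integral-1
    ^S-integral (suc n) if = ⊛-integral if (^S-integral n if)

    ^S-≋ : ∀ {d f g} n → IntegralBelow d f → IntegralBelow d g → f ≋[ d ] g → f S.^ n ≋[ d ] g S.^ n
    ^S-≋ zero if ig e = ≗⇒≋[] {f = 𝟙} (λ _ → refl)
    ^S-≋ (suc n) if ig e = ⊛-≋ ig (^S-integral n if) e (^S-≋ n if ig e)

    ser-integral : ∀ {a d} → IntegralPoly a → IntegralBelow d (ser a)
    ser-integral {a} ia {k} _ = subst Integral (sym (ser-act a k)) (act-integral ia (W-𝟙-integral k) (pos 0))

    -- The bound is sharp: in degree p - 1 the coefficient is 1/p. It fixes the range of all later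
    -- comparisons of series.
    expm1/X-integral : IntegralBelow (suc h) expm1/X
    expm1/X-integral k<p-1 = integral-inv (s≤s k<p-1)

    -- The recursion for B_(k+1) divides by k + 2, which stays below p in this range.
    B-integral : IntegralBelow (suc h) B
    B-integral {k} k<p-1 = upto k k<p-1 k ℕₚ.≤-refl
      where
      upto : ∀ n → n ℕ.< suc h → ∀ k → k ℕ.≤ n → Integral (B k)
      upto n n<p-1 zero _ = subst Integral (sym B-0) integral-1
      upto (suc n) n<p-1 (suc k) (s≤s k≤n) = subst Integral (sym (B-suc k))
        (integral-neg (integral-* (integral-inv (s≤s (ℕₚ.≤-trans (s≤s (s≤s k≤n)) n<p-1)))
          (integral-sum 0 (suc k) (λ j _ j≤k → integral-* (integral-ℕ (suc (suc k) C j))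
            (upto n (ℕₚ.<⇒≤ n<p-1) j (ℕₚ.≤-trans (ℕₚ.≤-pred j≤k) k≤n))))))

    X^-⊛-low : ∀ n g {k} → k ℕ.< n → (X S.^ n ⊛ g) k ≡ 0ℚ
    X^-⊛-low (suc n) g {zero} _ = trans (⊛-assoc X (X S.^ n) g 0) (Q.zeroˡ _)
    X^-⊛-low (suc n) g {suc k} (s≤s k<n) = begin
      ((X ⊛ X S.^ n) ⊛ g) (suc k)         ≡⟨ ⊛-assoc X (X S.^ n) g (suc k) ⟩
      (X ⊛ (X S.^ n ⊛ g)) (suc k)         ≡⟨ X-⊛-suc (X S.^ n ⊛ g) k ⟩
      fromℕ (suc k) * (X S.^ n ⊛ g) k     ≡⟨ cong (fromℕ (suc k) *_) (X^-⊛-low n g k<n) ⟩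
      fromℕ (suc k) * 0ℚ                  ≡⟨ Q.zeroʳ (fromℕ (suc k)) ⟩
      0ℚ                                  ∎

    -- With n = p this removes the powers (-∇)^p and (∇ u₁)^p from `frobenius` when series are
    -- compared below x^p.
    [X⊛]^-low : ∀ {f} g n → f ≗ X ⊛ g → ∀ {k} → k ℕ.< n → (f S.^ n) k ≡ 0ℚ
    [X⊛]^-low g n eq {k} k<n = trans (S.^-congˡ n eq k) (trans (S.^-distrib-* X g n k) (X^-⊛-low n (g S.^ n) k<n))

    D-^ : ∀ f n → D (f S.^ suc n) ≗ fromℕ (suc n) ∙ (f S.^ n ⊛ D f)
    D-^ f zero k = begin
      (D f ⊛ 𝟙) k + (f ⊛ 𝟘) k       ≡⟨ cong₂ _+_ (⊛-comm (D f) 𝟙 k) (trans (⊛-comm f 𝟘 k) (𝟘-⊛ f k)) ⟩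
      (𝟙 ⊛ D f) k + 0ℚ              ≡⟨ Q.+-identityʳ _ ⟩
      (𝟙 ⊛ D f) k                   ≡⟨ fromℕ1-* _ ⟨
      fromℕ 1 * (𝟙 ⊛ D f) k         ∎
    D-^ f (suc n) k = begin
      (D f ⊛ f S.^ suc n) k + (f ⊛ D (f S.^ suc n)) k
        ≡⟨ cong₂ _+_ (⊛-comm (D f) (f S.^ suc n) k) (trans (⊛-cong {f} (λ _ → refl) (D-^ f n) k) (⊛-∙ (fromℕ (suc n)) f (f S.^ n ⊛ D f) k)) ⟩
      y + fromℕ (suc n) * (f ⊛ (f S.^ n ⊛ D f)) k
        ≡⟨ cong (λ x → y + fromℕ (suc n) * x) (⊛-assoc f (f S.^ n) (D f) k) ⟨
      y + fromℕ (suc n) * y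
        ≡⟨ collect (fromℕ (suc n)) y ⟩
      (1ℚ + fromℕ (suc n)) * y
        ≡⟨ cong (_* y) (fromℕ-suc (suc n)) ⟨
      fromℕ (suc (suc n)) * y ∎
      where
      y = (f S.^ suc n ⊛ D f) k
      opaque
        unfolding _+_
        collect : ∀ a x → x + a * x ≡ (1ℚ + a) * x
        collect = solve-∀ ℚ-ring

    -- The series of u and of Y modulo p

    v : Series
    v = ser u

    v-integral : ∀ {d} → IntegralBelow d v
    v-integral = ser-integral u-integral

    ser-⊟ : ∀ a → ser (⊟ a) ≗ ⊖ ser a
    ser-⊟ a k = trans (constant-⊛ (- 1ℚ) (ser a) k) (Q.-1*x≈-x (ser a k))

    ser-⊟∇ : ser (⊟ ∇) ≗ X ⊛ expm1/X
    ser-⊟∇ k = trans (ser-⊟ ∇ k) (trans (cong -_ (1-exp k)) (Q.⁻¹-involutive ((X ⊛ expm1/X) k)))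

    -- Comparison of the coefficients of degree j + 1 in e^(px) = 1 + (e^x - 1)^p + p (e^x - 1) v,
    -- where the p-th power starts at x^p. The coefficient p^(j+1) of e^(px) comes from the action
    -- of (1 - ∇)^p as a translation by p.
    expm1/X⊛v-scaled : ∀ {j} → j ℕ.< suc h → fromℕ (suc j) * (expm1/X ⊛ v) j ≡ fromℕ p ^ j
    expm1/X⊛v-scaled {j} j<p-1 = cancel-ℕ (suc h) (begin
      fromℕ p * (fromℕ (suc j) * (expm1/X ⊛ v) j)
        ≡⟨ cong (fromℕ p *_) (X-⊛-suc (expm1/X ⊛ v) j) ⟨
      fromℕ p * (X ⊛ (expm1/X ⊛ v)) (suc j)
        ≡⟨ cong (fromℕ p *_) (⊛-assoc X expm1/X v (suc j)) ⟨
      fromℕ p * ((X ⊛ expm1/X) ⊛ v) (suc j)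
        ≡⟨ cong (fromℕ p *_) (⊛-cong {g = v} ser-⊟∇ (λ _ → refl) (suc j)) ⟨
      fromℕ p * (ser (⊟ ∇) ⊛ v) (suc j)
        ≡⟨ constant-⊛ (fromℕ p) (ser (⊟ ∇) ⊛ v) (suc j) ⟨
      (constant (fromℕ p) ⊛ (ser (⊟ ∇) ⊛ v)) (suc j)
        ≡⟨ trans (Q.+-identityˡ _) (Q.+-identityˡ _) ⟨
      0ℚ + (0ℚ + (constant (fromℕ p) ⊛ (ser (⊟ ∇) ⊛ v)) (suc j))
        ≡⟨ cong (λ x → 0ℚ + (x + (constant (fromℕ p) ⊛ (ser (⊟ ∇) ⊛ v)) (suc j)))
             (trans (ser-^ (⊟ ∇) p (suc j)) ([X⊛]^-low expm1/X p ser-⊟∇ (s≤s j<p-1))) ⟨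
      ser (con 1ℚ ⊞ ((⊟ ∇) P.^ p ⊞ con (fromℕ p) ⊠ (⊟ ∇ ⊠ u))) (suc j)
        ≡⟨ ser-cong (frobenius (⊟ ∇)) (suc j) ⟨
      ser ((con 1ℚ ⊞ ⊟ ∇) P.^ p) (suc j)
        ≡⟨ ser-act ((con 1ℚ ⊞ ⊟ ∇) P.^ p) (suc j) ⟩
      act ((con 1ℚ ⊞ ⊟ ∇) P.^ p) (W (suc j) 𝟙) (pos 0)
        ≡⟨ shift-act p (W (suc j) 𝟙) (pos 0) ⟩
      W (suc j) 𝟙 (pos 0 ℤ.- pos p)
        ≡⟨ W-𝟙 (suc j) (pos 0 ℤ.- pos p) ⟩
      (- fromℤ (pos 0 ℤ.- pos p)) ^ suc j
        ≡⟨ cong (_^ suc j) (trans (cong -_ (trans (fromℤ-sub (pos 0) (pos p)) (cong (_- fromℕ p) fromℤ-0))) (negated (fromℕ p))) ⟩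
      fromℕ p ^ suc j ∎)
      where
      opaque
        unfolding _+_
        negated : ∀ x → - (0ℚ - x) ≡ x
        negated = solve-∀ ℚ-ring

    expm1/X⊛v≋𝟙 : expm1/X ⊛ v ≋[ suc h ] 𝟙
    expm1/X⊛v≋𝟙 {zero} k<p-1 = ≡⇒≋ (trans (sym (fromℕ1-* _)) (expm1/X⊛v-scaled k<p-1))
    expm1/X⊛v≋𝟙 {suc j} k<p-1 = ≋-cancel-ℕ {suc j} (s≤s k<p-1)
      (≋-trans (≡⇒≋ (expm1/X⊛v-scaled k<p-1))
        (subst (fromℕ p ^ suc j ≋_) (sym (Q.zeroʳ (fromℕ (suc (suc j))))) (p*≋0 (integral-^ j (integral-ℕ p)))))

    v≋B : v ≋[ suc h ] B
    v≋B = ≋[]-trans (≗⇒≋[] rewrite-v)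
      (≋[]-trans (⊛-≋ˡ B-integral expm1/X⊛v≋𝟙 (⊛-integral expm1/X-integral v-integral)) (≗⇒≋[] (⊛-identityʳ B)))
      where
      open S using (_:*_; _:=_)
      rewrite-v : v ≗ B ⊛ (expm1/X ⊛ v)
      rewrite-v k = trans (sym (⊛-identityˡ v k)) (trans (⊛-cong {g = v} (λ j → sym (B⊛expm1/X j)) (λ _ → refl) k) (⊛-assoc B expm1/X v k))

    N NQ : Poly
    N = ∇ ⊠ u₁
    NQ = N ⊠ frobeniusPoly N

    ser-N : ser N ≗ X ⊛ (⊖ expm1/X ⊛ ser u₁)
    ser-N k = begin
      (ser ∇ ⊛ ser u₁) k                       ≡⟨ ⊛-cong {g = ser u₁} (λ j → trans (1-exp j) (S.-‿distribʳ-* X expm1/X j)) (λ _ → refl) k ⟩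
      ((X ⊛ ⊖ expm1/X) ⊛ ser u₁) k             ≡⟨ ⊛-assoc X (⊖ expm1/X) (ser u₁) k ⟩
      (X ⊛ (⊖ expm1/X ⊛ ser u₁)) k             ∎

    -- An equality and not merely a congruence, because `D-NQ` cancels p in it.
    v^p : ∀ {k} → k ℕ.< p → (v S.^ p) k ≡ 𝟙 k + fromℕ p * ser NQ k
    v^p {k} k<p = begin
      (v S.^ p) k                                           ≡⟨ ser-^ u p k ⟨
      ser (u P.^ p) k                                       ≡⟨ ser-cong (P.trans (P.^-congˡ p u-split) (frobenius N)) k ⟩
      𝟙 k + (ser (N P.^ p) k + (constant (fromℕ p) ⊛ ser NQ) k)
        ≡⟨ cong₂ (λ x y → 𝟙 k + (x + y)) (trans (ser-^ N p k) ([X⊛]^-low (⊖ expm1/X ⊛ ser u₁) p ser-N k<p)) (constant-⊛ (fromℕ p) (ser NQ) k) ⟩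
      𝟙 k + (0ℚ + fromℕ p * ser NQ k)                       ≡⟨ cong (𝟙 k +_) (Q.+-identityˡ _) ⟩
      𝟙 k + fromℕ p * ser NQ k                              ∎

    NQ-integral : IntegralPoly NQ
    NQ-integral = (∇ ⊠ u₁-integral) ⊠ frobeniusPoly-integral (∇ ⊠ u₁-integral)

    v^p≋𝟙 : v S.^ p ≋[ suc h ] 𝟙
    v^p≋𝟙 {k} k<p-1 = ≋-trans (≡⇒≋ (v^p (ℕₚ.<-trans k<p-1 (ℕₚ.n<1+n (suc h))))) (p*+≋ (ser-integral NQ-integral (ℕₚ.n<1+n k)))

    B^p≋𝟙 : B S.^ p ≋[ suc h ] 𝟙
    B^p≋𝟙 = ≋[]-trans (^S-≋ p B-integral v-integral (≋[]-sym v≋B)) v^p≋𝟙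

    -- Both series invert `v` modulo p.
    v^p-1≋expm1/X : v S.^ suc h ≋[ suc h ] expm1/X
    v^p-1≋expm1/X = ≋[]-trans (≗⇒≋[] (λ k → sym (⊛-identityʳ (v S.^ suc h) k)))
      (≋[]-trans (⊛-≋ˡ (^S-integral (suc h) v-integral) (≋[]-sym expm1/X⊛v≋𝟙) (constant-integral integral-1))
        (≋[]-trans (≗⇒≋[] (S.solve 3 (λ w e v → w :* (e :* v) := e :* (v :* w)) (λ _ → refl) (v S.^ suc h) expm1/X v))
          (≋[]-trans (⊛-≋ˡ expm1/X-integral v^p≋𝟙 (^S-integral p v-integral)) (≗⇒≋[] (⊛-identityʳ expm1/X)))))
      where open S using (_:*_; _:=_)

    -- log u ≡ - log((e^x - 1)/x): the derivative of (u^p - 1)/p is u^(p-1) Du ≡ Du/u.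
    D-NQ : D (ser NQ) ≋[ h ] ⊖ (B ⊛ D expm1/X)
    D-NQ {k} k<h = ≋-trans (≡⇒≋ exact) (≋-trans (⊛-≋ {h} (below expm1/X-integral) (D-integral v-integral) (below v^p-1≋expm1/X) (D-≋ v≋B) k<h) (≡⇒≋ swap))
      where
      below : ∀ {Q : ℕ → Set} → (∀ {k} → k ℕ.< suc h → Q k) → ∀ {k} → k ℕ.< h → Q k
      below f k<h = f (ℕₚ.<-trans k<h (ℕₚ.n<1+n h))
      D-integral : ∀ {f} → IntegralBelow (suc h) f → IntegralBelow h (D f)
      D-integral if k<h = if (s≤s k<h)
      D-≋ : ∀ {f g} → f ≋[ suc h ] g → D f ≋[ h ] D g
      D-≋ e k<h = e (s≤s k<h)
      exact : D (ser NQ) k ≡ (v S.^ suc h ⊛ D v) k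
      exact = cancel-ℕ (suc h) (begin
        fromℕ p * ser NQ (suc k)               ≡⟨ Q.+-identityˡ _ ⟨
        0ℚ + fromℕ p * ser NQ (suc k)          ≡⟨ v^p (s≤s (ℕₚ.<-trans k<h (ℕₚ.n<1+n h))) ⟨
        (v S.^ p) (suc k)                      ≡⟨ D-^ v (suc h) k ⟩
        fromℕ p * (v S.^ suc h ⊛ D v) k        ∎)
      -- The product rule applied to the constant product of `B` and `expm1/X`.
      swap : (expm1/X ⊛ D B) k ≡ - (B ⊛ D expm1/X) k
      swap = Q.inverseʳ-unique _ _ (trans (Q.+-comm _ _)
        (trans (cong (_+ (B ⊛ D expm1/X) k) (⊛-comm expm1/X (D B) k)) (B⊛expm1/X (suc k))))

    -- With d x = z for integers d and z, Fermat's theorem holds for d and z, and d can be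
    -- cancelled.
    fermat-integral : ∀ {x} → Integral x → x ^ p ≋ x
    fermat-integral {x} (integral d z p∤d eq) = ≋-cancelˡ {fromℕ d} (integral d (pos 1) p∤d (trans d*recip (sym fromℤ-1))) (trans (Q.*-comm _ _) d*recip)
      (≋-trans (≋-*ʳ (integral-^ p (integral d z p∤d eq)) (≋-sym (fermat-ℕ d)))
        (subst₂ _≋_ (trans (cong (_^ p) (sym eq)) (Q.^-distrib-* (fromℕ d) x p)) (sym eq) (fermat z)))
      where
      d*recip : fromℕ d * recip (fromℕ d) ≡ 1ℚ
      d*recip = recip-inverse (fromℕ d) (λ d≡0 → p∤d (subst (p ℕᵈ.∣_) (sym (fromℕ-injective {d} {0} (trans d≡0 (sym fromℤ-0)))) (p ℕᵈ.∣0)))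

    ^S-0 : ∀ f n → (f S.^ n) 0 ≡ f 0 ^ n
    ^S-0 f zero = refl
    ^S-0 f (suc n) = cong (f 0 *_) (^S-0 f n)

    -- The derivative of a p-th power has the factor p, so all exponential coefficients after the
    -- constant one vanish modulo p. The constant one is c^p, which is c modulo p.
    u₁^p≋ : ser u₁ S.^ p ≋[ suc h ] constant (ser u₁ 0)
    u₁^p≋ {zero} _ = subst (_≋ ser u₁ 0) (sym (^S-0 (ser u₁) p)) (fermat-integral (ser-integral {d = 1} u₁-integral {0} (s≤s z≤n)))
    u₁^p≋ {suc k} k<p-1 = subst (_≋ 0ℚ) (sym (D-^ (ser u₁) (suc h) k))
      (p*≋0 (⊛-integral {suc k} {ser u₁ S.^ suc h} {D (ser u₁)} (^S-integral (suc h) (ser-integral u₁-integral)) (λ {j} _ → ser-integral u₁-integral {suc j} (ℕₚ.n<1+n (suc j))) (ℕₚ.n<1+n k)))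

    Z : Poly
    Z = ∇ ⊠ (u ⊠ u₁ P.^ p)

    ser-Z : ∀ k → ser Z k ≡ - (X ⊛ ((expm1/X ⊛ v) ⊛ ser u₁ S.^ p)) k
    ser-Z k = begin
      (ser ∇ ⊛ (v ⊛ ser (u₁ P.^ p))) k
        ≡⟨ ⊛-cong {g = v ⊛ ser (u₁ P.^ p)} 1-exp (λ _ → refl) k ⟩
      (⊖ (X ⊛ expm1/X) ⊛ (v ⊛ ser (u₁ P.^ p))) k
        ≡⟨ S.-‿distribˡ-* (X ⊛ expm1/X) (v ⊛ ser (u₁ P.^ p)) k ⟨
      - ((X ⊛ expm1/X) ⊛ (v ⊛ ser (u₁ P.^ p))) k
        ≡⟨ cong -_ (S.solve 4 (λ x e v a → (x :* e) :* (v :* a) := x :* ((e :* v) :* a)) (λ _ → refl) X expm1/X v (ser (u₁ P.^ p)) k) ⟩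
      - (X ⊛ ((expm1/X ⊛ v) ⊛ ser (u₁ P.^ p))) k
        ≡⟨ cong -_ (⊛-cong {X} (λ _ → refl) (⊛-cong {expm1/X ⊛ v} (λ _ → refl) (ser-^ u₁ p)) k) ⟩
      - (X ⊛ ((expm1/X ⊛ v) ⊛ ser u₁ S.^ p)) k ∎
      where open S using (_:*_; _:=_)

    -- Modulo p the series of `Z` is linear: in -x (`expm1/X` v) u₁^p the bracket is 1 and the p-th
    -- power is constant.
    ser-Z-suc : ∀ {k} → k ℕ.< suc h → ser Z (suc k) ≋ - (fromℕ (suc k) * constant (ser u₁ 0) k)
    ser-Z-suc {k} k<p-1 = ≋-trans (≡⇒≋ (trans (ser-Z (suc k)) (cong -_ (X-⊛-suc _ k))))
      (≋-neg (≋-*ˡ (integral-ℕ (suc k)) (≋-trans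
        (⊛-≋ (constant-integral integral-1) (^S-integral p (ser-integral u₁-integral)) expm1/X⊛v≋𝟙 u₁^p≋ k<p-1)
        (≡⇒≋ (⊛-identityˡ (constant (ser u₁ 0)) k)))))

    -- The linear coefficients in u = 1 + ∇ u₁, since the series of ∇ begins with -x.
    u₁-0 : ser u₁ 0 ≡ - v 1
    u₁-0 = sym (begin
      - v 1                                            ≡⟨ cong -_ (ser-cong u-split 1) ⟩
      - (0ℚ + ser N 1)                                 ≡⟨ cong -_ (trans (Q.+-identityˡ _) (ser-N 1)) ⟩
      - (X ⊛ (⊖ expm1/X ⊛ ser u₁)) 1                   ≡⟨ cong -_ (trans (X-⊛-suc (⊖ expm1/X ⊛ ser u₁) 0) (fromℕ1-* ((⊖ expm1/X ⊛ ser u₁) 0))) ⟩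
      - ((- recip (fromℕ 1)) * ser u₁ 0)               ≡⟨ cong (λ x → - ((- x) * ser u₁ 0)) (trans (sym (fromℕ1-* _)) (*-recip 0)) ⟩
      - ((- 1ℚ) * ser u₁ 0)                            ≡⟨ double (ser u₁ 0) ⟩
      ser u₁ 0                                         ∎)
      where
      opaque
        unfolding _+_
        double : ∀ x → - ((- 1ℚ) * x) ≡ x
        double = solve-∀ ℚ-ring

    -- The term `Z` contributes although (∇ u₁)^p has no coefficients below x^p: on the Fleck
    -- quotients this power is -p Z, and `Y` was formed by dividing that by p.
    Y-series : ser Y ≋[ suc h ] ⊖ bernLog
    Y-series {k} k<p-1 = ≋-trans (≡⇒≋ (cong (ser NQ k +_) (ser-⊟ Z k))) (degree k k<p-1)
      where
      opaque
        unfolding _+_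
        linear : ∀ b → (- (b + 1ℚ)) - (- (1ℚ * (- b))) ≡ - (1ℚ + ((1ℚ + 1ℚ) * b + 0ℚ))
        linear = solve-∀ ℚ-ring
        no-Z : ∀ x c → - x - (- (c * 0ℚ)) ≡ - x
        no-Z = solve-∀ ℚ-ring
      two : fromℕ 2 ≡ 1ℚ + 1ℚ
      two = trans (fromℕ-suc 1) (cong (1ℚ +_) fromℤ-1)
      B-1 : 1ℚ + ((1ℚ + 1ℚ) * B 1 + 0ℚ) ≡ 0ℚ
      B-1 = trans (cong₂ (λ x y → x + (y * B 1 + 0ℚ)) (sym (trans (fromℕ1-* (B 0)) B-0)) (sym two)) (B-sum 0)
      degree : ∀ k → k ℕ.< suc h → ser NQ k - ser Z k ≋ - bernLog k
      degree zero _ = ≡⇒≋ (trans (cong₂ _-_ (cong (_* ser (frobeniusPoly N) 0) (trans (ser-N 0) (Q.zeroˡ _))) (trans (ser-Z 0) (cong -_ (Q.zeroˡ _))))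
        (vanish (ser (frobeniusPoly N) 0)))
        where
        opaque
          unfolding _+_
          vanish : ∀ y → 0ℚ * y - (- 0ℚ) ≡ - 0ℚ
          vanish = solve-∀ ℚ-ring
      -- `NQ` contributes -(B_1 + 1) and `Z` has the linear coefficient B_1, so the difference is
      -- -(1 + 2 B_1) = 0.
      degree (suc zero) 1<p-1 = ≋-trans
        (≋-+ (≋-trans (D-NQ (s≤s z≤n)) (≡⇒≋ (cong -_ (trans (sym (fromℕ1-* _)) (B⊛D-expm1/X 0)))))
             (≋-neg (≋-trans (ser-Z-suc (s≤s z≤n)) (≋-neg (≋-trans (≡⇒≋ (cong₂ _*_ fromℤ-1 u₁-0)) (≋-*ˡ integral-1 (≋-neg (v≋B 1<p-1))))))))
        (≡⇒≋ (trans (linear (B 1)) (cong -_ B-1)))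
      degree (suc (suc k)) k<p-1 = ≋-trans
        (≋-+ (≋-trans (D-NQ (ℕₚ.≤-pred k<p-1)) (≡⇒≋ (cong -_ (B⊛D-expm1/X-suc k))))
             (≋-neg (ser-Z-suc (ℕₚ.<⇒≤ k<p-1))))
        (≡⇒≋ (no-Z (bernLog (suc (suc k))) (fromℕ (suc (suc k)))))

    -- Signs, extraction of coefficients and Wilson's theorem

    -1^p-1 : (- 1ℚ) ^ suc h ≡ 1ℚ
    -1^p-1 = trans (double ((- 1ℚ) ^ suc h)) (trans (cong ((- 1ℚ) *_) -1^p) (square 1ℚ))
      where
      opaque
        unfolding _+_
        double : ∀ x → x ≡ (- 1ℚ) * ((- 1ℚ) * x)
        double = solve-∀ ℚ-ring
        square : ∀ x → (- 1ℚ) * (- x) ≡ x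
        square = solve-∀ ℚ-ring

    -1^square : ∀ n → (- 1ℚ) ^ n * (- 1ℚ) ^ n ≡ 1ℚ
    -1^square zero = Q.*-identityˡ 1ℚ
    -1^square (suc n) = trans (square ((- 1ℚ) ^ n)) (-1^square n)
      where
      opaque
        unfolding _+_
        square : ∀ x → ((- 1ℚ) * x) * ((- 1ℚ) * x) ≡ x * x
        square = solve-∀ ℚ-ring

    -1^complement : ∀ m n → m ℕ.+ n ≡ suc h → (- 1ℚ) ^ m ≡ (- 1ℚ) ^ n
    -1^complement m n eq = begin
      (- 1ℚ) ^ m                                  ≡⟨ Q.*-identityʳ _ ⟨
      (- 1ℚ) ^ m * 1ℚ                             ≡⟨ cong ((- 1ℚ) ^ m *_) (-1^square n) ⟨
      (- 1ℚ) ^ m * ((- 1ℚ) ^ n * (- 1ℚ) ^ n)      ≡⟨ Q.*-assoc _ _ _ ⟨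
      (- 1ℚ) ^ m * (- 1ℚ) ^ n * (- 1ℚ) ^ n        ≡⟨ cong (_* (- 1ℚ) ^ n) (trans (sym (Q.^-homo-* (- 1ℚ) m n)) (trans (cong ((- 1ℚ) ^_) eq) -1^p-1)) ⟩
      1ℚ * (- 1ℚ) ^ n                             ≡⟨ Q.*-identityˡ _ ⟩
      (- 1ℚ) ^ n                                  ∎

    ⊖X^ : ∀ m → (⊖ X) S.^ m ≗ (- 1ℚ) ^ m ∙ X S.^ m
    ⊖X^ zero k = sym (Q.*-identityˡ (𝟙 k))
    ⊖X^ (suc m) k = begin
      (⊖ X ⊛ (⊖ X) S.^ m) k                       ≡⟨ ⊛-cong {⊖ X} {(- 1ℚ) ∙ X} (λ j → sym (Q.-1*x≈-x (X j))) (⊖X^ m) k ⟩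
      (((- 1ℚ) ∙ X) ⊛ ((- 1ℚ) ^ m ∙ X S.^ m)) k   ≡⟨ ∙-⊛ (- 1ℚ) X ((- 1ℚ) ^ m ∙ X S.^ m) k ⟩
      (- 1ℚ) * (X ⊛ ((- 1ℚ) ^ m ∙ X S.^ m)) k     ≡⟨ cong ((- 1ℚ) *_) (⊛-∙ ((- 1ℚ) ^ m) X (X S.^ m) k) ⟩
      (- 1ℚ) * ((- 1ℚ) ^ m * (X ⊛ X S.^ m) k)     ≡⟨ Q.*-assoc _ _ _ ⟨
      (- 1ℚ) ^ suc m * (X S.^ suc m) k            ∎

    W-⊖X^ : ∀ m b g r → fromℕ (b !) * W (m ℕ.+ b) ((⊖ X) S.^ m ⊛ g) r ≡ (- 1ℚ) ^ m * (fromℕ ((m ℕ.+ b) !) * W b g r)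
    W-⊖X^ m b g r = begin
      fromℕ (b !) * (E ⊛ ((⊖ X) S.^ m ⊛ g)) (m ℕ.+ b)
        ≡⟨ cong (fromℕ (b !) *_) (S.solve 3 (λ e x g → e :* (x :* g) := x :* (e :* g)) (λ _ → refl) E ((⊖ X) S.^ m) g (m ℕ.+ b)) ⟩
      fromℕ (b !) * ((⊖ X) S.^ m ⊛ (E ⊛ g)) (m ℕ.+ b)
        ≡⟨ cong (fromℕ (b !) *_) (trans (⊛-cong {g = E ⊛ g} (⊖X^ m) (λ _ → refl) (m ℕ.+ b)) (∙-⊛ ((- 1ℚ) ^ m) (X S.^ m) (E ⊛ g) (m ℕ.+ b))) ⟩
      fromℕ (b !) * ((- 1ℚ) ^ m * (X S.^ m ⊛ (E ⊛ g)) (m ℕ.+ b))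
        ≡⟨ Q.x*yz≡y*xz (fromℕ (b !)) ((- 1ℚ) ^ m) _ ⟩
      (- 1ℚ) ^ m * (fromℕ (b !) * (X S.^ m ⊛ (E ⊛ g)) (m ℕ.+ b))
        ≡⟨ cong ((- 1ℚ) ^ m *_) (X^-⊛ m b (E ⊛ g)) ⟩
      (- 1ℚ) ^ m * (fromℕ ((m ℕ.+ b) !) * (E ⊛ g) b) ∎
      where
      open S using (_:*_; _:=_)
      E = exp (- fromℤ r)

    act-neg : ∀ a f r → act a (λ s → - f s) r ≡ - act a f r
    act-neg a f r = trans (act-cong a (λ s → sym (Q.-1*x≈-x (f s))) r) (trans (act-* a (- 1ℚ) f r) (Q.-1*x≈-x (act a f r)))

    ser-∇^ : ∀ n → ser (∇ P.^ n) ≗ (⊖ X) S.^ n ⊛ expm1/X S.^ n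
    ser-∇^ n k = trans (ser-^ ∇ n k) (trans (S.^-congˡ n (λ j → trans (1-exp j) (S.-‿distribˡ-* X expm1/X j)) k) (S.^-distrib-* (⊖ X) expm1/X n k))

    -- At least one ∇ is applied to δ = 1 - r^(p-1), so the constant 1 disappears and only the
    -- monomial is left.
    Cp-W : ∀ a r → Cp p (suc a) r ≋ - W (suc h) ((⊖ X) S.^ suc a ⊛ expm1/X S.^ suc a) r
    Cp-W a r = ≋-trans (≡⇒≋ (sym (trans (Cp-∇^ (suc a) 0 r) (cong (λ m → Cp p m r) (ℕₚ.+-identityʳ (suc a))))))
      (≋-trans (act-≋ (^-integral (suc a) ∇) (λ s → ≋-trans (≡⇒≋ (Cp-0 s)) (δ≋ s)) r) (≡⇒≋ (begin
        act (∇ P.^ suc a) (λ s → 1ℚ - w s) r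
          ≡⟨ act-+ (∇ P.^ suc a) (λ _ → 1ℚ) (λ s → - w s) r ⟩
        act (∇ P.^ suc a) (λ _ → 1ℚ) r + act (∇ P.^ suc a) (λ s → - w s) r
          ≡⟨ cong₂ _+_ (act-∇^-constant a 1ℚ r) (act-neg (∇ P.^ suc a) w r) ⟩
        0ℚ - act (∇ P.^ suc a) w r
          ≡⟨ Q.+-identityˡ _ ⟩
        - act (∇ P.^ suc a) w r
          ≡⟨ cong -_ (W-act (∇ P.^ suc a) (suc h) 𝟙 r) ⟨
        - W (suc h) (ser (∇ P.^ suc a) ⊛ 𝟙) r
          ≡⟨ cong -_ (W-cong (suc h) (λ k → trans (⊛-identityʳ (ser (∇ P.^ suc a)) k) (ser-∇^ (suc a) k)) r) ⟩
        - W (suc h) ((⊖ X) S.^ suc a ⊛ expm1/X S.^ suc a) r ∎)))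
      where w = W (suc h) 𝟙

    Cp-diagonal : ∀ {n} → n ℕ.< p → Cp p n (pos 0) ≡ 1ℚ
    Cp-diagonal {n} n<p = begin
      Cp p n (pos 0)
        ≡⟨ Cp≡∑ n (pos 0) ⟩
      fromℕ 1 * (indicator 0 (pos 0) * 1ℚ) + ∑ 1 n (λ k → fromℕ (n C k) * (indicator k (pos 0) * (- 1ℚ) ^ k))
        ≡⟨ cong₂ _+_ (trans (fromℕ1-* _) (trans (Q.*-identityʳ _) (indicator-yes 0 (pos 0) refl)))
             (trans (∑-cong 1 n {g = λ k → 0ℚ * 0ℚ} vanish) (trans (∑-* 1 n 0ℚ (λ _ → 0ℚ)) (Q.zeroˡ _))) ⟩
      1ℚ + 0ℚ
        ≡⟨ Q.+-identityʳ 1ℚ ⟩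
      1ℚ ∎
      where
      vanish : ∀ k → 1 ℕ.≤ k → k ℕ.< 1 ℕ.+ n → fromℕ (n C k) * (indicator k (pos 0) * (- 1ℚ) ^ k) ≡ 0ℚ * 0ℚ
      vanish k 1≤k k≤n = trans (cong (fromℕ (n C k) *_) (trans (cong (_* (- 1ℚ) ^ k) (indicator-no k (pos 0) k≢0)) (Q.zeroˡ _)))
        (trans (Q.zeroʳ _) (sym (Q.zeroˡ 0ℚ)))
        where
        k≢0 : lnr (pos k) p ≢ lnr (pos 0) p
        k≢0 eq = ℕₚ.<⇒≢ 1≤k (sym (trans (sym (lnr-unique {pos k} {k} {p} (pos 0) (ℕₚ.≤-<-trans (ℕₚ.≤-pred k≤n) n<p) (sym (ℤₚ.+-identityʳ (pos k))))) eq))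

    W-0-constant : ∀ g r → W 0 g r ≡ g 0
    W-0-constant g r = Q.*-identityˡ (g 0)

    expm1/X^-0 : ∀ n → (expm1/X S.^ n) 0 ≡ 1ℚ
    expm1/X^-0 n = trans (^S-0 expm1/X n) (trans (cong (_^ n) (trans (sym (fromℕ1-* _)) (*-recip 0))) (1^n≡1 n))

    -- Two values of C_p(p - 1, 0): it is 1, because only k = 0 contributes, and by `Cp-W` it is
    -- minus the coefficient of x^(p-1)/(p-1)! in (-x)^(p-1) times a series with constant term 1.
    wilson : fromℕ (suc h !) ≋ - 1ℚ
    wilson = ≋-trans (≡⇒≋ (sym (Q.⁻¹-involutive (fromℕ (suc h !))))) (≋-neg (≋-sym 1≋))
      where
      g = expm1/X S.^ suc h
      value : W (suc h) ((⊖ X) S.^ suc h ⊛ g) (pos 0) ≡ fromℕ (suc h !)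
      value = begin
        W (suc h) ((⊖ X) S.^ suc h ⊛ g) (pos 0)
          ≡⟨ cong (λ k → W k ((⊖ X) S.^ suc h ⊛ g) (pos 0)) (ℕₚ.+-identityʳ (suc h)) ⟨
        W (suc h ℕ.+ 0) ((⊖ X) S.^ suc h ⊛ g) (pos 0)
          ≡⟨ fromℕ1-* _ ⟨
        fromℕ (0 !) * W (suc h ℕ.+ 0) ((⊖ X) S.^ suc h ⊛ g) (pos 0)
          ≡⟨ W-⊖X^ (suc h) 0 g (pos 0) ⟩
        (- 1ℚ) ^ suc h * (fromℕ ((suc h ℕ.+ 0) !) * W 0 g (pos 0))
          ≡⟨ cong₂ (λ x y → x * (fromℕ ((suc h ℕ.+ 0) !) * y)) -1^p-1 (trans (W-0-constant g (pos 0)) (expm1/X^-0 (suc h))) ⟩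
        1ℚ * (fromℕ ((suc h ℕ.+ 0) !) * 1ℚ)
          ≡⟨ trans (Q.*-identityˡ _) (Q.*-identityʳ _) ⟩
        fromℕ ((suc h ℕ.+ 0) !)
          ≡⟨ cong (λ k → fromℕ (k !)) (ℕₚ.+-identityʳ (suc h)) ⟩
        fromℕ (suc h !) ∎
      1≋ : 1ℚ ≋ - fromℕ (suc h !)
      1≋ = ≋-trans (≡⇒≋ (sym (Cp-diagonal (ℕₚ.n<1+n (suc h))))) (≋-trans (Cp-W h (pos 0)) (≡⇒≋ (cong -_ value)))

    !*recip : ∀ b → fromℕ (b !) * recip (fromℕ (b !)) ≡ 1ℚ
    !*recip b = recip-inverse (fromℕ (b !)) (λ eq → ℕ.≢-nonZero⁻¹ (b !) {{b ℕₚ.!≢0}} (fromℕ-injective {b !} {0} (trans eq (sym fromℤ-0))))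

    p∤! : ∀ b → b ℕ.< p → ¬ (p ℕᵈ.∣ b !)
    p∤! zero _ = ℕᵈ.>⇒∤ 1<p
    p∤! (suc b) b<p = p∤product (p∤small b<p) (p∤! b (ℕₚ.<⇒≤ b<p))

    recip-!-integral : ∀ {b} → b ℕ.< p → Integral (recip (fromℕ (b !)))
    recip-!-integral {b} b<p = integral (b !) (pos 1) (p∤! b b<p) (trans (!*recip b) (sym fromℤ-1))

    ≋-cancel-! : ∀ {b x y} → b ℕ.< p → fromℕ (b !) * x ≋ fromℕ (b !) * y → x ≋ y
    ≋-cancel-! {b} b<p = ≋-cancelˡ (recip-!-integral b<p) (trans (Q.*-comm _ _) (!*recip b))

    -- Wilson's theorem is the case j = 0. Otherwise a factor j + 1 is traded for m + 1, which is
    -- -(j + 1) modulo p.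
    factorial-product : ∀ m j → m ℕ.+ j ≡ suc h → fromℕ (m !) * fromℕ (j !) ≋ - (- 1ℚ) ^ m
    factorial-product m zero eq = subst (λ k → fromℕ (k !) * fromℕ 1 ≋ - (- 1ℚ) ^ k) (trans (sym eq) (ℕₚ.+-identityʳ m))
      (≋-trans (≡⇒≋ (trans (Q.*-comm _ _) (fromℕ1-* _))) (≋-trans wilson (≡⇒≋ (cong -_ (sym -1^p-1)))))
    factorial-product m (suc j) eq = ≋-trans (≡⇒≋ rearranged)
      (≋-trans (p*+≋ (integral-* (integral-ℕ (m !)) (integral-ℕ (j !))))
        (≋-trans (≋-neg (factorial-product (suc m) j (trans (sym (ℕₚ.+-suc m j)) eq))) (≡⇒≋ (double ((- 1ℚ) ^ m)))))
      where
      opaque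
        unfolding _+_
        double : ∀ x → - (- ((- 1ℚ) * x)) ≡ - x
        double = solve-∀ ℚ-ring
        regroup : ∀ m j x y → x * (j * y) ≡ - (m * x * y) + (m + j) * (x * y)
        regroup = solve-∀ ℚ-ring
      p-split : fromℕ (suc m) + fromℕ (suc j) ≡ fromℕ p
      p-split = trans (sym (fromℕ-+ (suc m) (suc j))) (cong (λ k → fromℕ (suc k)) eq)
      rearranged : fromℕ (m !) * fromℕ (suc j !) ≡ - (fromℕ (suc m !) * fromℕ (j !)) + fromℕ p * (fromℕ (m !) * fromℕ (j !))
      rearranged = begin
        fromℕ (m !) * fromℕ (suc j !)
          ≡⟨ cong (fromℕ (m !) *_) (fromℕ-* (suc j) (j !)) ⟩
        fromℕ (m !) * (fromℕ (suc j) * fromℕ (j !))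
          ≡⟨ regroup (fromℕ (suc m)) (fromℕ (suc j)) (fromℕ (m !)) (fromℕ (j !)) ⟩
        - (fromℕ (suc m) * fromℕ (m !) * fromℕ (j !)) + (fromℕ (suc m) + fromℕ (suc j)) * (fromℕ (m !) * fromℕ (j !))
          ≡⟨ cong₂ (λ x y → - (x * fromℕ (j !)) + y * (fromℕ (m !) * fromℕ (j !))) (sym (fromℕ-* (suc m) (m !))) p-split ⟩
        - (fromℕ (suc m !) * fromℕ (j !)) + fromℕ p * (fromℕ (m !) * fromℕ (j !)) ∎

    -- Expansion of the Fleck quotients modulo p

    𝟙^ : ∀ n → 𝟙 S.^ n ≗ 𝟙
    𝟙^ zero k = refl
    𝟙^ (suc n) k = trans (⊛-identityˡ (𝟙 S.^ n) k) (𝟙^ n k)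

    -- Since B^p is 1 modulo p in this range, exponents count modulo p. This is the origin of the
    -- order of the Bernoulli polynomials in the theorem.
    B^-mod : ∀ i → B S.^ i ≋[ suc h ] B S.^ (lnr (pos i) p)
    B^-mod i = ≋[]-trans (≗⇒≋[] split) (≋[]-trans
      (⊛-≋ˡ {f = B S.^ r} (^S-integral r B-integral) (≋[]-trans (^S-≋ q (^S-integral p B-integral) (constant-integral integral-1) B^p≋𝟙) (≗⇒≋[] (𝟙^ q)))
        (^S-integral q (^S-integral p B-integral)))
      (≗⇒≋[] (⊛-identityʳ (B S.^ r))))
      where
      r = i ℕᵐ.% p
      q = i ℕᵐ./ p
      split : B S.^ i ≗ B S.^ r ⊛ (B S.^ p) S.^ q
      split k = trans (cong (λ j → (B S.^ j) k) (trans (ℕᵐ.m≡m%n+[m/n]*n i p) (cong (r ℕ.+_) (ℕₚ.*-comm q p))))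
        (trans (S.^-homo-* B r (p ℕ.* q) k) (⊛-cong {B S.^ r} (λ _ → refl) (λ j → sym (S.^-assocʳ B p q j)) k))

    B^-cong : ∀ i j → lnr (pos i) p ≡ lnr (pos j) p → B S.^ i ≋[ suc h ] B S.^ j
    B^-cong i j eq = ≋[]-trans (B^-mod i) (≋[]-trans (≗⇒≋[] (λ k → cong (λ e → (B S.^ e) k) eq)) (≋[]-sym (B^-mod j)))

    -- Modulo p, F_p(n, r) is up to sign and factorials the coefficient of x^b in e^(-rx) `T`. `T`
    -- itself need not be a power of `B`, with which it agrees only below x^(p-1); keeping it lets
    -- `W-act` compute the action of `Y` exactly.
    record Expansion (n : ℕ) : Set where
      field
        a b : ℕ
        a+b≡h : a ℕ.+ b ≡ h
        nLow≡ : nLow p n ≡ suc a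
        nUp≡ : nUp p n ≡ b
        T : Series
        T-integral : IntegralBelow (suc h) T
        T≋B^ : T ≋[ suc h ] B S.^ lnr (ℤ.- pos n) p
        Fp≋ : ∀ r → Fp p n r ≋ - W (suc h) ((⊖ X) S.^ suc a ⊛ T) r

    -- Here n_* = p - 1 and n^* = 0. Modulo p, F_p(0, r) is 1, and so is -(p - 1)! by Wilson's
    -- theorem.
    expansion-0 : Expansion 0
    expansion-0 = record
      { a = h ; b = 0 ; a+b≡h = ℕₚ.+-identityʳ h
      ; nLow≡ = cong suc (lnr-unique { -[1+ 0 ]} {h} {suc h} -[1+ 0 ] (ℕₚ.n<1+n h) (minus-one (pos h)))
      ; nUp≡ = refl
      ; T = 𝟙 ; T-integral = constant-integral integral-1
      ; T≋B^ = ≗⇒≋[] {f = 𝟙} (λ _ → refl)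
      ; Fp≋ = λ r → ≋-trans (≡⇒≋ (Fp-0 r)) (≋-trans (drop r) (≋-sym (value r)))
      }
      where
      minus-one : ∀ m → -[1+ 0 ] ≡ m ℤ.+ -[1+ 0 ] ℤ.* (pos 1 ℤ.+ m)
      minus-one = solve-∀ ℤ-ring
      opaque
        unfolding _+_
        move : ∀ q d → 1ℚ - q * d ≡ 1ℚ + q * (- d)
        move = solve-∀ ℚ-ring
      drop : ∀ r → 1ℚ - fromℕ p * δ r ≋ 1ℚ
      drop r = ≋-trans (≡⇒≋ (move (fromℕ p) (δ r))) (p*+≋ (integral-neg (subst Integral (Cp-0 r) (Cp-integral 0 r))))
      value : ∀ r → - W (suc h) ((⊖ X) S.^ suc h ⊛ 𝟙) r ≋ 1ℚ
      value r = ≋-trans (≋-neg (≋-trans (≡⇒≋ (begin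
        W (suc h) ((⊖ X) S.^ suc h ⊛ 𝟙) r
          ≡⟨ cong (λ k → W k ((⊖ X) S.^ suc h ⊛ 𝟙) r) (ℕₚ.+-identityʳ (suc h)) ⟨
        W (suc h ℕ.+ 0) ((⊖ X) S.^ suc h ⊛ 𝟙) r
          ≡⟨ fromℕ1-* _ ⟨
        fromℕ (0 !) * W (suc h ℕ.+ 0) ((⊖ X) S.^ suc h ⊛ 𝟙) r
          ≡⟨ W-⊖X^ (suc h) 0 𝟙 r ⟩
        (- 1ℚ) ^ suc h * (fromℕ ((suc h ℕ.+ 0) !) * W 0 𝟙 r)
          ≡⟨ cong₂ (λ x y → x * (fromℕ ((suc h ℕ.+ 0) !) * y)) -1^p-1 (W-0-constant 𝟙 r) ⟩
        1ℚ * (fromℕ ((suc h ℕ.+ 0) !) * 1ℚ)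
          ≡⟨ trans (Q.*-identityˡ _) (Q.*-identityʳ _) ⟩
        fromℕ ((suc h ℕ.+ 0) !)
          ≡⟨ cong (λ k → fromℕ (k !)) (ℕₚ.+-identityʳ (suc h)) ⟩
        fromℕ (suc h !) ∎)) wilson)) (≡⇒≋ (Q.⁻¹-involutive 1ℚ))

    -- The first period is `Cp-W`; each further one applies `u`, which multiplies the series by `v`.
    Fp-W : ∀ a k → a ℕ.< suc h → ∀ r →
      Fp p (suc (a ℕ.+ k ℕ.* suc h)) r ≋ - W (suc h) ((⊖ X) S.^ suc a ⊛ (v S.^ k ⊛ expm1/X S.^ suc a)) r
    Fp-W a zero a<p-1 r = ≋-trans (≡⇒≋ (trans (cong (λ m → Fp p (suc m) r) (ℕₚ.+-identityʳ a)) (Fp-base a a<p-1 r)))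
      (≋-trans (Cp-W a r) (≡⇒≋ (cong -_ (W-cong (suc h)
        (⊛-cong {(⊖ X) S.^ suc a} (λ _ → refl) (λ j → sym (⊛-identityˡ (expm1/X S.^ suc a) j))) r))))
    Fp-W a (suc k) a<p-1 r = ≋-trans (≡⇒≋ (trans (cong (λ m → Fp p m r) (sym (next-period a k))) (sym (u-shift (suc (a ℕ.+ k ℕ.* suc h)) r))))
      (≋-trans (act-≋ u-integral (Fp-W a k a<p-1) r) (≡⇒≋ (begin
        act u (λ s → - W (suc h) V s) r       ≡⟨ act-neg u (W (suc h) V) r ⟩
        - act u (W (suc h) V) r               ≡⟨ cong -_ (W-act u (suc h) V r) ⟨
        - W (suc h) (v ⊛ V) r                 ≡⟨ cong -_ (W-cong (suc h) (S.solve 4 (λ v x w e → v :* (x :* (w :* e)) := x :* ((v :* w) :* e)) (λ _ → refl) v ((⊖ X) S.^ suc a) (v S.^ k) (expm1/X S.^ suc a)) r) ⟩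
        - W (suc h) ((⊖ X) S.^ suc a ⊛ (v S.^ suc k ⊛ expm1/X S.^ suc a)) r ∎)))
      where
      open S using (_:*_; _:=_)
      V = (⊖ X) S.^ suc a ⊛ (v S.^ k ⊛ expm1/X S.^ suc a)

    v^⊛expm1/X^ : ∀ a k q → lnr (pos k) p ≡ lnr (pos (q ℕ.+ a)) p → v S.^ k ⊛ expm1/X S.^ a ≋[ suc h ] B S.^ q
    v^⊛expm1/X^ a k q eq = ≋[]-trans
      (⊛-≋ {f = v S.^ k} (^S-integral (q ℕ.+ a) B-integral) (^S-integral a expm1/X-integral)
        (≋[]-trans (^S-≋ k v-integral B-integral v≋B) (B^-cong k (q ℕ.+ a) eq)) (≗⇒≋[] {f = expm1/X S.^ a} (λ _ → refl)))
      (≗⇒≋[] cancel)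
      where
      cancel : B S.^ (q ℕ.+ a) ⊛ expm1/X S.^ a ≗ B S.^ q
      cancel j = begin
        (B S.^ (q ℕ.+ a) ⊛ expm1/X S.^ a) j            ≡⟨ ⊛-cong {g = expm1/X S.^ a} (S.^-homo-* B q a) (λ _ → refl) j ⟩
        ((B S.^ q ⊛ B S.^ a) ⊛ expm1/X S.^ a) j        ≡⟨ ⊛-assoc (B S.^ q) (B S.^ a) (expm1/X S.^ a) j ⟩
        (B S.^ q ⊛ (B S.^ a ⊛ expm1/X S.^ a)) j        ≡⟨ ⊛-cong {B S.^ q} (λ _ → refl) (λ i → sym (S.^-distrib-* B expm1/X a i)) j ⟩
        (B S.^ q ⊛ (B ⊛ expm1/X) S.^ a) j              ≡⟨ ⊛-cong {B S.^ q} (λ _ → refl) (λ i → trans (S.^-congˡ a B⊛expm1/X i) (𝟙^ a i)) j ⟩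
        (B S.^ q ⊛ 𝟙) j                                ≡⟨ ⊛-identityʳ (B S.^ q) j ⟩
        (B S.^ q) j                                    ∎

    expansion-suc : ∀ a b k → a ℕ.+ b ≡ h → Expansion (suc (a ℕ.+ k ℕ.* suc h))
    expansion-suc a b k eq = record
      { a = a ; b = b ; a+b≡h = eq
      ; nLow≡ = cong suc (lnr-unique {pos m} {a} {suc h} (pos k) a<p-1 (cong (ℤ._+_ (pos a)) (ℤₚ.pos-* k (suc h))))
      ; nUp≡ = lnr-unique {ℤ.- pos (suc m)} {b} {suc h} (ℤ.- (pos 1 ℤ.+ pos k)) b<p-1 up
      ; T = v S.^ k ⊛ expm1/X S.^ suc a
      ; T-integral = ⊛-integral {f = v S.^ k} (^S-integral k v-integral) (^S-integral (suc a) expm1/X-integral)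
      -- From n = 1 + a + k (p - 1), -n is k - (a + 1) modulo p: `v` counts as B and `expm1/X` as
      -- its inverse.
      ; T≋B^ = v^⊛expm1/X^ (suc a) k q (sym (lnr-cong {pos (q ℕ.+ suc a)} {pos k} {p} (ℤ.- (pos k ℤ.+ floorDiv (ℤ.- pos (suc m)) p)) (s≤s z≤n) residue))
      ; Fp≋ = Fp-W a k a<p-1
      }
      where
      m = a ℕ.+ k ℕ.* suc h
      q = lnr (ℤ.- pos (suc m)) p
      a<p-1 : a ℕ.< suc h
      a<p-1 = s≤s (subst (a ℕ.≤_) eq (ℕₚ.m≤m+n a b))
      b<p-1 : b ℕ.< suc h
      b<p-1 = s≤s (subst (b ℕ.≤_) eq (ℕₚ.m≤n+m b a))
      pos-m : pos (suc m) ≡ pos 1 ℤ.+ (pos a ℤ.+ pos k ℤ.* pos (suc h))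
      pos-m = cong (λ x → pos 1 ℤ.+ (pos a ℤ.+ x)) (ℤₚ.pos-* k (suc h))
      -- As a + b = p - 2, the number n + b is (k + 1)(p - 1).
      up : ℤ.- pos (suc m) ≡ pos b ℤ.+ (ℤ.- (pos 1 ℤ.+ pos k)) ℤ.* pos (suc h)
      up = begin
        ℤ.- pos (suc m)
          ≡⟨ cong ℤ.-_ pos-m ⟩
        ℤ.- (pos 1 ℤ.+ (pos a ℤ.+ pos k ℤ.* pos (suc h)))
          ≡⟨ cong (λ x → ℤ.- (pos 1 ℤ.+ (pos a ℤ.+ pos k ℤ.* pos (suc x)))) eq ⟨
        ℤ.- (pos 1 ℤ.+ (pos a ℤ.+ pos k ℤ.* (pos 1 ℤ.+ (pos a ℤ.+ pos b))))
          ≡⟨ identity (pos a) (pos b) (pos k) ⟩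
        pos b ℤ.+ (ℤ.- (pos 1 ℤ.+ pos k)) ℤ.* (pos 1 ℤ.+ (pos a ℤ.+ pos b))
          ≡⟨ cong (λ x → pos b ℤ.+ (ℤ.- (pos 1 ℤ.+ pos k)) ℤ.* pos (suc x)) eq ⟩
        pos b ℤ.+ (ℤ.- (pos 1 ℤ.+ pos k)) ℤ.* pos (suc h) ∎
        where
        identity : ∀ a b k → ℤ.- (pos 1 ℤ.+ (a ℤ.+ k ℤ.* (pos 1 ℤ.+ (a ℤ.+ b)))) ≡ b ℤ.+ (ℤ.- (pos 1 ℤ.+ k)) ℤ.* (pos 1 ℤ.+ (a ℤ.+ b))
        identity = solve-∀ ℤ-ring
      residue : pos (q ℕ.+ suc a) ≡ pos k ℤ.+ (ℤ.- (pos k ℤ.+ floorDiv (ℤ.- pos (suc m)) p)) ℤ.* pos p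
      residue = shift (pos q) (floorDiv (ℤ.- pos (suc m)) p) (pos a) (pos k) (pos (suc h))
        (trans (cong ℤ.-_ (sym pos-m)) (lnr-division (ℤ.- pos (suc m)) {p} (s≤s z≤n)))
        where
        shift : ∀ q f a k m → ℤ.- (pos 1 ℤ.+ (a ℤ.+ k ℤ.* m)) ≡ q ℤ.+ f ℤ.* (pos 1 ℤ.+ m) →
          q ℤ.+ (pos 1 ℤ.+ a) ≡ k ℤ.+ (ℤ.- (k ℤ.+ f)) ℤ.* (pos 1 ℤ.+ m)
        shift q f a k m e = begin
          q ℤ.+ (pos 1 ℤ.+ a)
            ≡⟨ solve (q ∷ f ∷ a ∷ m ∷ []) ℤ-ring ⟩
          (q ℤ.+ f ℤ.* (pos 1 ℤ.+ m)) ℤ.- f ℤ.* (pos 1 ℤ.+ m) ℤ.+ (pos 1 ℤ.+ a)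
            ≡⟨ cong (λ x → x ℤ.- f ℤ.* (pos 1 ℤ.+ m) ℤ.+ (pos 1 ℤ.+ a)) e ⟨
          ℤ.- (pos 1 ℤ.+ (a ℤ.+ k ℤ.* m)) ℤ.- f ℤ.* (pos 1 ℤ.+ m) ℤ.+ (pos 1 ℤ.+ a)
            ≡⟨ solve (f ∷ a ∷ k ∷ m ∷ []) ℤ-ring ⟩
          k ℤ.+ (ℤ.- (k ℤ.+ f)) ℤ.* (pos 1 ℤ.+ m) ∎

    expansion : ∀ n → Expansion n
    expansion zero = expansion-0
    expansion (suc m) = subst (λ m → Expansion (suc m)) (sym (ℕᵐ.m≡m%n+[m/n]*n m (suc h)))
      (expansion-suc (m ℕᵐ.% suc h) (h ∸ m ℕᵐ.% suc h) (m ℕᵐ./ suc h) (ℕₚ.m+[n∸m]≡n (ℕₚ.≤-pred (ℕᵐ.m%n<n m (suc h)))))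

    W-≋ : ∀ {k f g} r → k ℕ.< suc h → IntegralBelow (suc h) f → f ≋[ suc h ] g → W k f r ≋ W k g r
    W-≋ {k} {f} {g} r k<p-1 if e = ⊛-≋ {f = exp (- fromℤ r)} (λ {j} _ → integral-^ j (integral-neg (integral-ℤ r))) if (≗⇒≋[] {f = exp (- fromℤ r)} (λ _ → refl)) e k<p-1

    bernoulliSum : ℕ → ℕ → ℤ → ℚ
    bernoulliSum b q r = (- 1ℚ) ^ b * recip (fromℕ (b !)) * W b (bernLog ⊛ B S.^ q) r

    -- `Y` multiplies the expansion by -`bernLog`. Once (-x)^(a+1) is split off, only degrees up to
    -- b < p - 1 matter. Finally (p - 1)! is -1 modulo p, and (-1)^(a+1) = (-1)^b because a + 1 + b
    -- = p - 1 is even.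
    Y-Fp : ∀ {n} (e : Expansion n) r → - act Y (Fp p n) r ≋ bernoulliSum (Expansion.b e) (lnr (ℤ.- pos n) p) r
    Y-Fp {n} e r = ≋-trans (≋-neg (≋-trans (act-≋ Y-integral Fp≋ r) (≡⇒≋ (act-neg Y (W (suc h) V) r))))
      (≋-trans (≡⇒≋ (trans (Q.⁻¹-involutive _) (trans (sym (W-act Y (suc h) V r)) (W-cong (suc h) reorder r))))
        (≋-cancel-! {b} (ℕₚ.<-trans b<p-1 (ℕₚ.n<1+n (suc h))) (≋-trans (≡⇒≋ left) (≋-trans middle (≡⇒≋ (sym right))))))
      where
      open Expansion e
      open S using (_:*_; _:=_)
      q = lnr (ℤ.- pos n) p
      V = (⊖ X) S.^ suc a ⊛ T
      V′ = (⊖ X) S.^ suc a ⊛ (ser Y ⊛ T)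
      opaque
        unfolding _+_
        signs : ∀ s x → s * ((- 1ℚ) * (- x)) ≡ s * x
        signs = solve-∀ ℚ-ring
        regroup : ∀ f s i x → f * (s * i * x) ≡ s * (f * i * x)
        regroup = solve-∀ ℚ-ring
      b<p-1 : b ℕ.< suc h
      b<p-1 = s≤s (subst (b ℕ.≤_) a+b≡h (ℕₚ.m≤n+m b a))
      sum : suc a ℕ.+ b ≡ suc h
      sum = cong suc a+b≡h
      reorder : ser Y ⊛ V ≗ V′
      reorder = S.solve 3 (λ y x t → y :* (x :* t) := x :* (y :* t)) (λ _ → refl) (ser Y) ((⊖ X) S.^ suc a) T
      left : fromℕ (b !) * W (suc h) V′ r ≡ (- 1ℚ) ^ suc a * (fromℕ (suc h !) * W b (ser Y ⊛ T) r)
      left = subst (λ k → fromℕ (b !) * W k V′ r ≡ (- 1ℚ) ^ suc a * (fromℕ (k !) * W b (ser Y ⊛ T) r)) sum (W-⊖X^ (suc a) b (ser Y ⊛ T) r)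
      T-series : ser Y ⊛ T ≋[ suc h ] ⊖ (bernLog ⊛ B S.^ q)
      T-series = ≋[]-trans (⊛-≋ {f = ser Y} {f′ = ⊖ bernLog} bernLog-integral T-integral Y-series T≋B^) (≗⇒≋[] (λ k → sym (S.-‿distribˡ-* bernLog (B S.^ q) k)))
        where
        bernLog-integral : IntegralBelow (suc h) (⊖ bernLog)
        bernLog-integral = ≋[]-integral (≋[]-sym Y-series) (ser-integral Y-integral)
      YT-integral : IntegralBelow (suc h) (ser Y ⊛ T)
      YT-integral = ⊛-integral (ser-integral Y-integral) T-integral
      W-negated : W b (⊖ (bernLog ⊛ B S.^ q)) r ≡ - W b (bernLog ⊛ B S.^ q) r
      W-negated = sym (S.-‿distribʳ-* (exp (- fromℤ r)) (bernLog ⊛ B S.^ q) b)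
      exp-integral : IntegralBelow (suc h) (exp (- fromℤ r))
      exp-integral {j} _ = integral-^ j (integral-neg (integral-ℤ r))
      middle : (- 1ℚ) ^ suc a * (fromℕ (suc h !) * W b (ser Y ⊛ T) r) ≋ (- 1ℚ) ^ b * W b (bernLog ⊛ B S.^ q) r
      middle = ≋-trans
        (≋-*ˡ (integral-^ (suc a) (integral-neg integral-1))
          (≋-* (integral-neg integral-1) (⊛-integral {f = exp (- fromℤ r)} exp-integral YT-integral b<p-1) wilson
            (W-≋ r b<p-1 YT-integral T-series)))
        (≡⇒≋ (trans (cong (λ x → (- 1ℚ) ^ suc a * ((- 1ℚ) * x)) W-negated)
          (trans (signs ((- 1ℚ) ^ suc a) (W b (bernLog ⊛ B S.^ q) r)) (cong (_* W b (bernLog ⊛ B S.^ q) r) (-1^complement (suc a) b sum)))))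
      right : fromℕ (b !) * bernoulliSum b q r ≡ (- 1ℚ) ^ b * W b (bernLog ⊛ B S.^ q) r
      right = begin
        fromℕ (b !) * ((- 1ℚ) ^ b * recip (fromℕ (b !)) * W b (bernLog ⊛ B S.^ q) r)
          ≡⟨ regroup (fromℕ (b !)) ((- 1ℚ) ^ b) (recip (fromℕ (b !))) (W b (bernLog ⊛ B S.^ q) r) ⟩
        (- 1ℚ) ^ b * (fromℕ (b !) * recip (fromℕ (b !)) * W b (bernLog ⊛ B S.^ q) r)
          ≡⟨ cong (λ x → (- 1ℚ) ^ b * (x * W b (bernLog ⊛ B S.^ q) r)) (!*recip b) ⟩
        (- 1ℚ) ^ b * (1ℚ * W b (bernLog ⊛ B S.^ q) r)
          ≡⟨ cong ((- 1ℚ) ^ b *_) (Q.*-identityˡ _) ⟩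
        (- 1ℚ) ^ b * W b (bernLog ⊛ B S.^ q) r ∎

    -- Comparison of the two Bernoulli sums

    coefficient-≋ : ∀ a k j → a ℕ.+ (k ℕ.+ j) ≡ h →
      (- 1ℚ) ^ (k ℕ.+ j) * recip (fromℕ ((k ℕ.+ j) !)) * (fromℕ ((k ℕ.+ j) C k) * (- 1ℚ) ^ j)
      ≋ (- 1ℚ) ^ a * fromℕ (suc a !) * fromℕ ((suc a ℕ.+ k) C suc a)
    -- Both sides are multiplied by k! j!. The left becomes (-1)^k exactly. On the right (a + 1 +
    -- k)! j! is left over, and as a + 1 + k + j = p - 1 `factorial-product` evaluates it.
    coefficient-≋ a k j eq = ≋-cancel-! {k} k<p (≋-cancel-! {j} j<p (≋-trans (≡⇒≋ left) (≋-sym right)))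
      where
      k≤h : k ℕ.≤ h
      k≤h = ℕₚ.≤-trans (ℕₚ.m≤m+n k j) (subst (k ℕ.+ j ℕ.≤_) eq (ℕₚ.m≤n+m (k ℕ.+ j) a))
      j≤h : j ℕ.≤ h
      j≤h = ℕₚ.≤-trans (ℕₚ.m≤n+m j k) (subst (k ℕ.+ j ℕ.≤_) eq (ℕₚ.m≤n+m (k ℕ.+ j) a))
      k<p : k ℕ.< p
      k<p = s≤s (ℕₚ.m≤n⇒m≤1+n k≤h)
      j<p : j ℕ.< p
      j<p = s≤s (ℕₚ.m≤n⇒m≤1+n j≤h)
      opaque
        unfolding _+_
        regroup₁ : ∀ j k s t i c u → j * (k * (s * t * i * (c * u))) ≡ s * (t * u) * (c * (k * j) * i)
        regroup₁ = solve-∀ ℚ-ring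
        regroup₂ : ∀ j k s f c → j * (k * (s * f * c)) ≡ s * (c * (f * k) * j)
        regroup₂ = solve-∀ ℚ-ring
        signs : ∀ x y → x * - ((- 1ℚ) * (x * y)) ≡ x * x * y
        signs = solve-∀ ℚ-ring
      n = k ℕ.+ j
      left : fromℕ (j !) * (fromℕ (k !) * ((- 1ℚ) ^ n * recip (fromℕ (n !)) * (fromℕ (n C k) * (- 1ℚ) ^ j))) ≡ (- 1ℚ) ^ k
      left = begin
        fromℕ (j !) * (fromℕ (k !) * ((- 1ℚ) ^ n * recip (fromℕ (n !)) * (fromℕ (n C k) * (- 1ℚ) ^ j)))
          ≡⟨ cong (λ x → fromℕ (j !) * (fromℕ (k !) * (x * recip (fromℕ (n !)) * (fromℕ (n C k) * (- 1ℚ) ^ j)))) (Q.^-homo-* (- 1ℚ) k j) ⟩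
        fromℕ (j !) * (fromℕ (k !) * ((- 1ℚ) ^ k * (- 1ℚ) ^ j * recip (fromℕ (n !)) * (fromℕ (n C k) * (- 1ℚ) ^ j)))
          ≡⟨ regroup₁ (fromℕ (j !)) (fromℕ (k !)) ((- 1ℚ) ^ k) ((- 1ℚ) ^ j) (recip (fromℕ (n !))) (fromℕ (n C k)) ((- 1ℚ) ^ j) ⟩
        (- 1ℚ) ^ k * ((- 1ℚ) ^ j * (- 1ℚ) ^ j) * (fromℕ (n C k) * (fromℕ (k !) * fromℕ (j !)) * recip (fromℕ (n !)))
          ≡⟨ cong₂ (λ x y → (- 1ℚ) ^ k * x * (y * recip (fromℕ (n !)))) (-1^square j) (choose-factorial k j) ⟩
        (- 1ℚ) ^ k * 1ℚ * (fromℕ (n !) * recip (fromℕ (n !)))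
          ≡⟨ cong₂ _*_ (Q.*-identityʳ _) (!*recip n) ⟩
        (- 1ℚ) ^ k * 1ℚ
          ≡⟨ Q.*-identityʳ _ ⟩
        (- 1ℚ) ^ k ∎
      right : fromℕ (j !) * (fromℕ (k !) * ((- 1ℚ) ^ a * fromℕ (suc a !) * fromℕ ((suc a ℕ.+ k) C suc a))) ≋ (- 1ℚ) ^ k
      right = ≋-trans (≡⇒≋ (begin
        fromℕ (j !) * (fromℕ (k !) * ((- 1ℚ) ^ a * fromℕ (suc a !) * fromℕ ((suc a ℕ.+ k) C suc a)))
          ≡⟨ regroup₂ (fromℕ (j !)) (fromℕ (k !)) ((- 1ℚ) ^ a) (fromℕ (suc a !)) (fromℕ ((suc a ℕ.+ k) C suc a)) ⟩
        (- 1ℚ) ^ a * (fromℕ ((suc a ℕ.+ k) C suc a) * (fromℕ (suc a !) * fromℕ (k !)) * fromℕ (j !))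
          ≡⟨ cong (λ x → (- 1ℚ) ^ a * (x * fromℕ (j !))) (choose-factorial (suc a) k) ⟩
        (- 1ℚ) ^ a * (fromℕ ((suc a ℕ.+ k) !) * fromℕ (j !)) ∎))
        (≋-trans (≋-*ˡ (integral-^ a (integral-neg integral-1))
            (factorial-product (suc a ℕ.+ k) j (cong suc (trans (ℕₚ.+-assoc a k j) eq))))
          (≡⇒≋ (begin
            (- 1ℚ) ^ a * - ((- 1ℚ) * (- 1ℚ) ^ (a ℕ.+ k))          ≡⟨ cong (λ x → (- 1ℚ) ^ a * - ((- 1ℚ) * x)) (Q.^-homo-* (- 1ℚ) a k) ⟩
            (- 1ℚ) ^ a * - ((- 1ℚ) * ((- 1ℚ) ^ a * (- 1ℚ) ^ k))   ≡⟨ signs ((- 1ℚ) ^ a) ((- 1ℚ) ^ k) ⟩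
            (- 1ℚ) ^ a * (- 1ℚ) ^ a * (- 1ℚ) ^ k                  ≡⟨ cong (_* (- 1ℚ) ^ k) (-1^square a) ⟩
            1ℚ * (- 1ℚ) ^ k                                       ≡⟨ Q.*-identityˡ _ ⟩
            (- 1ℚ) ^ k                                            ∎)))

    bernLog-integral : IntegralBelow (suc h) bernLog
    bernLog-integral {k} k<p-1 = subst Integral (Q.⁻¹-involutive (bernLog k)) (integral-neg (≋[]-integral (≋[]-sym Y-series) (ser-integral Y-integral) k<p-1))

    -- The sums agree term by term: e^(-rx) contributes (-r)^(b-k), whose sign goes into the
    -- coefficient treated by `coefficient-≋`.
    expressions-≋ : ∀ a b q r → a ℕ.+ b ≡ h → firstExpression b q r ≋ secondExpression b (suc a) q r
    expressions-≋ a b q r a+b = subst₂ _≋_ (sym lhs) (sym rhs) (≋-sum 0 (suc b) term)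
      where
      c = bernLog ⊛ B S.^ q
      opaque
        unfolding _+_
        swap₂ : ∀ s n m x c → s * (n * ((m * x) * c)) ≡ s * (n * m) * (x * c)
        swap₂ = solve-∀ ℚ-ring
        swap₃ : ∀ s n x c → s * (n * x * c) ≡ s * n * (x * c)
        swap₃ = solve-∀ ℚ-ring
      lhs : firstExpression b q r ≡ ∑ 0 (suc b) (λ k → (- 1ℚ) ^ b * recip (fromℕ (b !)) * (fromℕ (b C k) * (c k * exp (- fromℤ r) (b ∸ k))))
      lhs = trans (firstExpression≡ b q r) (trans (cong ((- 1ℚ) ^ b * recip (fromℕ (b !)) *_)
          (trans (⊛-comm (exp (- fromℤ r)) c b) (⊛-binomial c (exp (- fromℤ r)) b)))
        (sym (∑-* 0 (suc b) ((- 1ℚ) ^ b * recip (fromℕ (b !))) (λ k → fromℕ (b C k) * (c k * exp (- fromℤ r) (b ∸ k))))))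
      rhs : secondExpression b (suc a) q r ≡ ∑ 0 (suc b) (λ k → (- 1ℚ) ^ a * fromℕ (suc a !) * (fromℕ ((suc a ℕ.+ k) C suc a) * fromℤ r ^ (b ∸ k) * c k))
      rhs = trans (secondExpression≡ b (suc a) q r)
        (sym (∑-* 0 (suc b) ((- 1ℚ) ^ a * fromℕ (suc a !)) (λ k → fromℕ ((suc a ℕ.+ k) C suc a) * fromℤ r ^ (b ∸ k) * c k)))
      c-integral : IntegralBelow (suc h) c
      c-integral = ⊛-integral {f = bernLog} bernLog-integral (^S-integral q B-integral)
      by-complement : ∀ k j → a ℕ.+ (k ℕ.+ j) ≡ h →
        (- 1ℚ) ^ (k ℕ.+ j) * recip (fromℕ ((k ℕ.+ j) !)) * (fromℕ ((k ℕ.+ j) C k) * (c k * exp (- fromℤ r) j))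
        ≋ (- 1ℚ) ^ a * fromℕ (suc a !) * (fromℕ ((suc a ℕ.+ k) C suc a) * fromℤ r ^ j * c k)
      by-complement k j eq = ≋-trans (≡⇒≋ (begin
        s * (fromℕ ((k ℕ.+ j) C k) * (c k * (- fromℤ r) ^ j))
          ≡⟨ cong (λ x → s * (fromℕ ((k ℕ.+ j) C k) * x)) (trans (Q.*-comm _ _) (cong (_* c k) (trans (cong (_^ j) (sym (Q.-1*x≈-x (fromℤ r)))) (Q.^-distrib-* (- 1ℚ) (fromℤ r) j)))) ⟩
        s * (fromℕ ((k ℕ.+ j) C k) * ((- 1ℚ) ^ j * fromℤ r ^ j * c k))
          ≡⟨ swap₂ s (fromℕ ((k ℕ.+ j) C k)) ((- 1ℚ) ^ j) (fromℤ r ^ j) (c k) ⟩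
        s * (fromℕ ((k ℕ.+ j) C k) * (- 1ℚ) ^ j) * (fromℤ r ^ j * c k) ∎))
        (≋-trans (≋-*ʳ (integral-* (integral-^ j (integral-ℤ r)) (c-integral k<p-1)) (coefficient-≋ a k j eq))
          (≡⇒≋ (sym (swap₃ ((- 1ℚ) ^ a * fromℕ (suc a !)) (fromℕ ((suc a ℕ.+ k) C suc a)) (fromℤ r ^ j) (c k)))))
        where
        s = (- 1ℚ) ^ (k ℕ.+ j) * recip (fromℕ ((k ℕ.+ j) !))
        k<p-1 : k ℕ.< suc h
        k<p-1 = s≤s (ℕₚ.≤-trans (ℕₚ.m≤m+n k j) (subst (k ℕ.+ j ℕ.≤_) eq (ℕₚ.m≤n+m (k ℕ.+ j) a)))
      term : ∀ k → 0 ℕ.≤ k → k ℕ.< suc b →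
        (- 1ℚ) ^ b * recip (fromℕ (b !)) * (fromℕ (b C k) * (c k * exp (- fromℤ r) (b ∸ k)))
        ≋ (- 1ℚ) ^ a * fromℕ (suc a !) * (fromℕ ((suc a ℕ.+ k) C suc a) * fromℤ r ^ (b ∸ k) * c k)
      term k _ k≤b = subst (λ n → (- 1ℚ) ^ n * recip (fromℕ (n !)) * (fromℕ (n C k) * (c k * exp (- fromℤ r) (b ∸ k)))
          ≋ (- 1ℚ) ^ a * fromℕ (suc a !) * (fromℕ ((suc a ℕ.+ k) C suc a) * fromℤ r ^ (b ∸ k) * c k))
        (ℕₚ.m+[n∸m]≡n (ℕₚ.≤-pred k≤b))
        (by-complement k (b ∸ k) (trans (cong (a ℕ.+_) (ℕₚ.m+[n∸m]≡n (ℕₚ.≤-pred k≤b))) a+b))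

    increasing-congruences : ∀ n r → let nu = nUp p n ; nl = nLow p n ; q = lnr (ℤ.- pos n) p in
      (∀ t {m} → m ≡ p ℕ.* suc t ℕ.* suc h → (Fp p (m ℕ.+ n) r - Fp p n r) * recip (fromℕ m) ≋ firstExpression nu q r)
      × firstExpression nu q r ≋ secondExpression nu nl q r
    increasing-congruences n r = (λ t {m} eq → subst (λ i → (Fp p (m ℕ.+ n) r - Fp p n r) * recip (fromℕ m) ≋ firstExpression i q r) (sym nUp≡)
        (≋-trans (difference-quotient t n r eq) (≋-trans (Y-Fp e r) (≡⇒≋ (sym (firstExpression≡ b q r))))))
      , subst₂ (λ i j → firstExpression i q r ≋ secondExpression i j q r) (sym nUp≡) (sym nLow≡) (expressions-≋ a b q r a+b≡h)
      where
      q = lnr (ℤ.- pos n) p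
      e : Expansion n
      e = expansion n
      open Expansion e using (a; b; a+b≡h; nUp≡; nLow≡)

  -- The prime 2, where n^* = 0

  firstExpression-0 : ∀ q r → firstExpression 0 q r ≡ 0ℚ
  firstExpression-0 q r = trans (firstExpression≡ 0 q r)
    (trans (cong ((- 1ℚ) ^ 0 * recip (fromℕ (0 !)) *_) (trans (Q.*-identityˡ _) (Q.zeroˡ ((B S.^ q) 0)))) (Q.zeroʳ _))

  secondExpression-0 : ∀ nl q r → secondExpression 0 nl q r ≡ 0ℚ
  secondExpression-0 nl q r = trans (secondExpression≡ 0 nl q r)
    (trans (cong ((- 1ℚ) ^ (nl ∸ 1) * fromℕ (nl !) *_)
      (trans (Q.+-identityʳ _) (trans (cong (fromℕ ((nl ℕ.+ 0) C nl) * fromℤ r ^ 0 *_) (Q.zeroˡ ((B S.^ q) 0))) (Q.zeroʳ _)))) (Q.zeroʳ _))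

  module PrimeTwo (2-prime : Prime 2) where

    open Congruence 2 2-prime
    open AnyPrime 0 2-prime using (frobeniusPoly-first; u-Fp)

    -- For p = 2 the operator `u` has the single coefficient C(2, 1)/2 = 1, and `u-Fp` has the sign
    -- -1.
    Fp-suc-2 : ∀ n r → Fp 2 (suc n) r ≡ - Fp 2 n r
    Fp-suc-2 n r = begin
      Fp 2 (suc n) r
        ≡⟨ isolate (Fp 2 (suc n) r) ⟩
      - ((- ((- 1ℚ) ^ 2)) * Fp 2 (suc n) r)
        ≡⟨ cong -_ (u-Fp n r) ⟨
      - act (AnyPrime.u 0 2-prime) (Fp 2 n) r
        ≡⟨ cong -_ (trans (apply (frobeniusPoly-first (⊟ ∇)) (Fp 2 n) r) (constant-term (Fp 2 n r) (Fp 2 n (r ℤ.- pos 1)))) ⟩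
      - Fp 2 n r ∎
      where
      opaque
        unfolding _+_
        isolate : ∀ x → x ≡ - ((- ((- 1ℚ) * ((- 1ℚ) * 1ℚ))) * x)
        isolate = solve-∀ ℚ-ring
        constant-term : ∀ x y → 1ℚ * x + (- 1ℚ) * (0ℚ * x - 0ℚ * y) ≡ x
        constant-term = solve-∀ ℚ-ring

    Fp-even : ∀ j n r → Fp 2 (j ℕ.* 2 ℕ.+ n) r ≡ Fp 2 n r
    Fp-even zero n r = refl
    Fp-even (suc j) n r = trans (Fp-suc-2 (suc (j ℕ.* 2 ℕ.+ n)) r)
      (trans (cong -_ (Fp-suc-2 (j ℕ.* 2 ℕ.+ n) r)) (trans (Q.⁻¹-involutive _) (Fp-even j n r)))

    increasing-congruences : ∀ n r → let nu = nUp 2 n ; nl = nLow 2 n ; q = lnr (ℤ.- pos n) 2 in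
      (∀ t {m} → m ≡ 2 ℕ.* suc t ℕ.* 1 → (Fp 2 (m ℕ.+ n) r - Fp 2 n r) * recip (fromℕ m) ≋ firstExpression nu q r)
      × firstExpression nu q r ≋ secondExpression nu nl q r
    increasing-congruences n r = (λ t {m} eq → ≡⇒≋ (trans (vanish t m eq) (sym first)))
      , ≡⇒≋ (trans first (sym second))
      where
      q = lnr (ℤ.- pos n) 2
      nUp≡0 : nUp 2 n ≡ 0
      nUp≡0 = ℕₚ.n<1⇒n≡0 (lnr-< (ℤ.- pos n) {1} (s≤s z≤n))
      first : firstExpression (nUp 2 n) q r ≡ 0ℚ
      first = trans (cong (λ i → firstExpression i q r) nUp≡0) (firstExpression-0 q r)
      second : secondExpression (nUp 2 n) (nLow 2 n) q r ≡ 0ℚ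
      second = trans (cong (λ i → secondExpression i (nLow 2 n) q r) nUp≡0) (secondExpression-0 (nLow 2 n) q r)
      vanish : ∀ t m → m ≡ 2 ℕ.* suc t ℕ.* 1 → (Fp 2 (m ℕ.+ n) r - Fp 2 n r) * recip (fromℕ m) ≡ 0ℚ
      vanish t m eq = trans (cong (_* recip (fromℕ m)) (trans (cong (_- Fp 2 n r)
        (trans (cong (λ k → Fp 2 (k ℕ.+ n) r) (trans eq (trans (ℕₚ.*-identityʳ (2 ℕ.* suc t)) (ℕₚ.*-comm 2 (suc t))))) (Fp-even (suc t) n r)))
        (Q.-‿inverseʳ (Fp 2 n r)))) (Q.zeroˡ _)

  -- All primes

  recip-neg : ∀ x → x ≢ 0ℚ → recip (- x) ≡ - recip x
  recip-neg x x≢0 = recip-unique (- x) (- recip x) (trans (-*- x (recip x)) (recip-inverse x x≢0))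

  lnr-neg-+ : ∀ n d {M} k → 0 ℕ.< M → d ≡ k ℕ.* M → lnr (ℤ.- pos n) M ≡ lnr (ℤ.- pos (d ℕ.+ n)) M
  lnr-neg-+ n d {M} k 0<M eq = lnr-cong {ℤ.- pos n} {ℤ.- pos (d ℕ.+ n)} {M} (pos k) 0<M
    (trans (identity (pos n) (pos d)) (cong (λ x → ℤ.- pos (d ℕ.+ n) ℤ.+ x) (trans (cong pos eq) (ℤₚ.pos-* k M))))
    where
    identity : ∀ n d → ℤ.- n ≡ ℤ.- (d ℤ.+ n) ℤ.+ d
    identity = solve-∀ ℤ-ring

  ∣⇒multiple : ∀ a b d → d ≢ 0 → a ℕ.* b ℕᵈ.∣ d → ∃ λ t → d ≡ a ℕ.* suc t ℕ.* b
  ∣⇒multiple a b d d≢0 (ℕᵈ.divides zero eq) = ⊥-elim (d≢0 eq)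
  ∣⇒multiple a b d d≢0 (ℕᵈ.divides (suc t) eq) = t ,
    trans eq (trans (sym (ℕₚ.*-assoc (suc t) a b)) (cong (ℕ._* b) (ℕₚ.*-comm (suc t) a)))

  increasing-congruences : ∀ p (p-prime : Prime p) n r →
    let open Congruence p p-prime ; nu = nUp p n ; nl = nLow p n ; q = lnr (ℤ.- pos n) p in
    (∀ t {m} → m ≡ p ℕ.* suc t ℕ.* (p ∸ 1) → (Fp p (m ℕ.+ n) r - Fp p n r) * recip (fromℕ m) ≋ firstExpression nu q r)
    × firstExpression nu q r ≋ secondExpression nu nl q r
  increasing-congruences 0 p-prime = ⊥-elim (¬prime[0] p-prime)
  increasing-congruences 1 p-prime = ⊥-elim (¬prime[1] p-prime)
  increasing-congruences 2 p-prime = PrimeTwo.increasing-congruences p-prime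
  increasing-congruences (suc (suc (suc h′))) p-prime = OddPrime.increasing-congruences h′ p-prime

  module _ (p : ℕ) (p-prime : Prime p) (r : ℤ) where

    open Congruence p p-prime

    Quotient≋ : ℕ → ℕ → ℤ → Set
    Quotient≋ m n d = (Fp p m r - Fp p n r) * recip (fromℤ d) ≋ firstExpression (nUp p n) (lnr (ℤ.- pos n) p) r

    quotient-increasing : ∀ n d → d ≢ 0 → p ℕ.* (p ∸ 1) ℕᵈ.∣ d → Quotient≋ (d ℕ.+ n) n (pos d)
    quotient-increasing n d d≢0 div =
      proj₁ (increasing-congruences p p-prime n r) (proj₁ (∣⇒multiple p (p ∸ 1) d d≢0 div)) (proj₂ (∣⇒multiple p (p ∸ 1) d d≢0 div))

    -- The difference quotient is symmetric in its two indices, and the Bernoulli sum depends on n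
    -- only through the residues of -n modulo p - 1 and modulo p, which adding d does not change.
    quotient-decreasing : ∀ n d → d ≢ 0 → p ℕ.* (p ∸ 1) ℕᵈ.∣ d → Quotient≋ n (d ℕ.+ n) (ℤ.- pos d)
    quotient-decreasing n d d≢0 div = ≋-trans (≡⇒≋ flip)
      (subst₂ (λ i j → (Fp p (d ℕ.+ n) r - Fp p n r) * recip (fromℕ d) ≋ firstExpression i j r)
        (lnr-neg-+ n d (p ℕ.* suc t) (ℕₚ.m<n⇒0<n∸m 1<p) d-split)
        (lnr-neg-+ n d (suc t ℕ.* (p ∸ 1)) 0<p (trans d-split (trans (ℕₚ.*-assoc p (suc t) (p ∸ 1)) (ℕₚ.*-comm p (suc t ℕ.* (p ∸ 1))))))
        (quotient-increasing n d d≢0 div))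
      where
      t = proj₁ (∣⇒multiple p (p ∸ 1) d d≢0 div)
      d-split : d ≡ p ℕ.* suc t ℕ.* (p ∸ 1)
      d-split = proj₂ (∣⇒multiple p (p ∸ 1) d d≢0 div)
      opaque
        unfolding _+_
        signs : ∀ x y z → (x - y) * (- z) ≡ (y - x) * z
        signs = solve-∀ ℚ-ring
      flip : (Fp p n r - Fp p (d ℕ.+ n) r) * recip (fromℤ (ℤ.- pos d)) ≡ (Fp p (d ℕ.+ n) r - Fp p n r) * recip (fromℕ d)
      flip = trans (cong ((Fp p n r - Fp p (d ℕ.+ n) r) *_) (trans (cong recip (fromℤ-neg (pos d)))
          (recip-neg (fromℕ d) (λ eq → d≢0 (fromℕ-injective {d} {0} (trans eq (sym fromℤ-0)))))))
        (signs (Fp p n r) (Fp p (d ℕ.+ n) r) (recip (fromℕ d)))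

    quotient-≋-first : ∀ m n → m ≢ n → p ℕ.* (p ∸ 1) ℕᵈ.∣ ℤ.∣ pos m ℤ.- pos n ∣ → Quotient≋ m n (pos m ℤ.- pos n)
    quotient-≋-first m n m≢n div = by-order (ℕₚ.<-cmp m n)
      where
      by-order : Tri (m ℕ.< n) (m ≡ n) (n ℕ.< m) → Quotient≋ m n (pos m ℤ.- pos n)
      by-order (tri≈ _ m≡n _) = ⊥-elim (m≢n m≡n)
      by-order (tri> _ _ n<m) = subst₂ (λ k x → Quotient≋ k n x) (ℕₚ.m∸n+n≡m (ℕₚ.<⇒≤ n<m)) (sym difference)
        (quotient-increasing n (m ∸ n) (ℕₚ.m>n⇒m∸n≢0 n<m) (subst (λ x → p ℕ.* (p ∸ 1) ℕᵈ.∣ ℤ.∣ x ∣) difference div))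
        where
        difference : pos m ℤ.- pos n ≡ pos (m ∸ n)
        difference = trans (ℤₚ.m-n≡m⊖n m n) (ℤₚ.⊖-≥ (ℕₚ.<⇒≤ n<m))
      by-order (tri< m<n _ _) = subst₂ (λ k x → Quotient≋ m k x) (ℕₚ.m∸n+n≡m (ℕₚ.<⇒≤ m<n)) (sym difference)
        (quotient-decreasing m (n ∸ m) (ℕₚ.m>n⇒m∸n≢0 m<n)
          (subst (p ℕ.* (p ∸ 1) ℕᵈ.∣_) (trans (cong ℤ.∣_∣ difference) (ℤₚ.∣-i∣≡∣i∣ (pos (n ∸ m)))) div))
        where
        difference : pos m ℤ.- pos n ≡ ℤ.- pos (n ∸ m)
        difference = trans (ℤₚ.m-n≡m⊖n m n) (ℤₚ.⊖-≤ (ℕₚ.<⇒≤ m<n))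

  opaque
    unfolding _+_

    quotient-unfold : ∀ x y z → (x - y) * recip (fromℤ z) ≡ (x ℚ.- y) ℚ.* inv (ℤ→ℚ z)
    quotient-unfold x y z = refl

  congruences : ∀ p → Prime p → ∀ r m n → m ≢ n → pos (p ℕ.* (p ∸ 1)) ∣ (pos m ℤ.- pos n) →
    let nu = nUp p n ; nl = nLow p n ; q = lnr (ℤ.- pos n) p in
    ((Fp p m r ℚ.- Fp p n r) ℚ.* inv (ℤ→ℚ (pos m ℤ.- pos n))) ≡ firstExpression nu q r [modℚ p ]
    × firstExpression nu q r ≡ secondExpression nu nl q r [modℚ p ]
  congruences p p-prime r m n m≢n div =
    subst (λ x → x ≡ firstExpression (nUp p n) (lnr (ℤ.- pos n) p) r [modℚ p ])
      (quotient-unfold (Fp p m r) (Fp p n r) (pos m ℤ.- pos n))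
      (≋⇒≡[modℚ] (quotient-≋-first p p-prime r m n m≢n div))
    , ≋⇒≡[modℚ] (proj₂ (increasing-congruences p p-prime n r))
    where open Congruence p p-prime

open import Data.Nat using (ℕ; _*_; _∸_; _+_; _!)
open import Data.Nat.Combinatorics using (_C_)
open import Data.Nat.Primality using (Prime)
open import Data.Integer using (ℤ; +_)
open import Data.Integer as ℤ using ()
open import Data.Integer.Divisibility using (_∣_)
open import Data.Rational as ℚ using (ℚ; 1ℚ)
open import Data.Product using (_×_)
open import Relation.Binary.PropositionalEquality using (_≢_)

theorem1p1 : (p : ℕ) → Prime p → (r : ℤ) → (m n : ℕ) → m ≢ n →
  (+ (p * (p ∸ 1))) ∣ (+ m ℤ.- + n) →
  let nu = nUp p n
      nl = nLow p n
      q = lnr (ℤ.- + n) p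
      E1 = ((ℚ.- 1ℚ) ^ℚ nu) ℚ.* inv (ℕ→ℚ (nu !)) ℚ.*
           Σ[ 2 ≤k≤ nu ] (λ k → ℕ→ℚ (nu C k) ℚ.* (B k ℚ.* inv (ℕ→ℚ k))
                                  ℚ.* BP q (nu ∸ k) (ℚ.- ℤ→ℚ r))
      E2 = ((ℚ.- 1ℚ) ^ℚ (nl ∸ 1)) ℚ.* ℕ→ℚ (nl !) ℚ.*
           Σ[ 2 ≤k≤ nu ] (λ k → ℕ→ℚ ((nl + k) C nl) ℚ.* (ℤ→ℚ r ^ℚ (nu ∸ k))
             ℚ.* Σ[ 2 ≤k≤ k ] (λ j → ℕ→ℚ (k C j) ℚ.* (B j ℚ.* inv (ℕ→ℚ j))
                                      ℚ.* Bo q (k ∸ j)))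
  in ((Fp p m r ℚ.- Fp p n r) ℚ.* inv (ℤ→ℚ (+ m ℤ.- + n))) ≡ E1 [modℚ p ]
     × E1 ≡ E2 [modℚ p ]
theorem1p1 = FleckQuotients.congruences
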